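{- Let $\Sigma=\{1,\dots,\sigma\}$ and let $1\le k\le n$ be integers. There exists an exact circular $k$-mismatch sketch ($k$-ECS) for $\Sigma^n$ of size $\tilde{O}(k)$.
   Context: Strings $S\in\Sigma^n$ are written $S[1]S[2]\cdots S[n]$. $\mathsf{Ham}(S,T)=|\{i\in[n]: S[i]\ne T[i]\}|$ for $S,T\in\Sigma^n$. $\mathsf{cyc}(S)=S[2]\cdots S[n]S[1]$ and $\mathsf{cyc}^m$ denotes its $m$-fold iterate for $m\in\mathbb{Z}$ (negative $m$ meaning the inverse rotation). A randomized function $X\to Y$ is a random variable whose values are functions $X\to Y$; in a sketch, a single random draw of the encoding function is applied to both strings (shared randomness). "With high probability" means with probability at least $1-n^{ -\Omega(1)}$. $\tilde O(\cdot)$ suppresses $\log^{O(1)} n$ factors. A $k$-ECS for $\Pi\subseteq\Sigma^n$ is a pair of randomized functions $\mathtt{sk}:\Pi\to\{0,1\}^*$ and $\mathtt{dec}:\{0,1\}^*\times\{0,1\}^*\times\mathbb{Z}\to\mathbb{N}$ such that for every $S_1,S_2\in\Pi$ and $m\in\mathbb{Z}$, with high probability: if $\mathsf{Ham}(S_1,\mathsf{cyc}^m(S_2))\le k$ then $\mathtt{dec}(\mathtt{sk}(S_1),\mathtt{sk}(S_2),m)=\mathsf{Ham}(S_1,\mathsf{cyc}^m(S_2))$, and otherwise $\mathtt{dec}(\mathtt{sk}(S_1),\mathtt{sk}(S_2),m)>k$. A sketch for $\Pi$ has size $s$ if for every $S\in\Pi$, $|\mathtt{sk}(S)|\le s$ with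 high probability. -}

module Defs where

open import Data.Nat using (ℕ; zero; suc; _+_; _*_; _^_; _≤_; _<_; _≤ᵇ_)
open import Data.Nat.Logarithm using (⌊log₂_⌋)
open import Data.Integer using (ℤ; +_; -[1+_])
open import Data.Bool using (Bool; true; false; if_then_else_)
open import Data.Bool.Properties using () renaming (_≟_ to _≟ᵇ_)
open import Data.Fin using (Fin)
open import Data.Fin.Properties using () renaming (_≟_ to _≟ᶠ_)
open import Data.Vec using (Vec; []; _∷_; _∷ʳ_; last; init)
open import Data.List using (List; length; filter; concatMap; map) renaming ([] to []ˡ; _∷_ to _∷ˡ_)
open import Data.Product using (Σ; _×_; _,_)
open import Function using (_∘_)
open import Relation.Nullary.Decidable using (does)
open import Data.Nat using (_≡ᵇ_)
open import Relation.Binary.PropositionalEquality using (_≡_)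

Str : ℕ → ℕ → Set
Str σ n = Vec (Fin σ) n

Ham : ∀ {σ n} → Str σ n → Str σ n → ℕ
Ham [] [] = 0
Ham (x ∷ xs) (y ∷ ys) = (if does (x ≟ᶠ y) then 0 else 1) + Ham xs ys

cyc : ∀ {σ n} → Str σ n → Str σ n
cyc [] = []
cyc (x ∷ xs) = xs ∷ʳ x

cycInv : ∀ {σ n} → Str σ n → Str σ n
cycInv [] = []
cycInv (x ∷ xs) = last (x ∷ xs) ∷ init (x ∷ xs)

iter : ∀ {A : Set} → (A → A) → ℕ → A → A
iter f zero a = a
iter f (suc m) a = f (iter f m a)

cycPow : ∀ {σ n} → ℤ → Str σ n → Str σ n
cycPow (+ m) = iter cyc m
cycPow -[1+ m ] = iter cycInv (suc m)

-- Randomness: a uniformly random seed in {0,1}^r.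
Seed : ℕ → Set
Seed r = Vec Bool r

allSeeds : (r : ℕ) → List (Seed r)
allSeeds zero = [] ∷ˡ []ˡ
allSeeds (suc r) = concatMap (λ s → (true ∷ s) ∷ˡ (false ∷ s) ∷ˡ []ˡ) (allSeeds r)

count : ∀ {r} → (Seed r → Bool) → ℕ
count {r} ev = length (filter (λ s → ev s ≟ᵇ true) (allSeeds r))

-- Pr[bad] ≤ n^{-c/d}, i.e. (#bad / 2^r)^d ≤ n^{-c}
PrBadBound : (n c d r : ℕ) → (Seed r → Bool) → Set
PrBadBound n c d r bad = (count bad ^ d) * (n ^ c) ≤ (2 ^ r) ^ d

Sketcher : ℕ → ℕ → ℕ → Set
Sketcher σ n r = Seed r → Str σ n → List Bool

Decoder : ℕ → Set
Decoder r = Seed r → List Bool → List Bool → ℤ → ℕ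

correctOn : ∀ {σ n r} (k : ℕ) → Sketcher σ n r → Decoder r →
            Str σ n → Str σ n → ℤ → Seed r → Bool
correctOn k sk dec S₁ S₂ m s =
  let h = Ham S₁ (cycPow m S₂)
      out = dec s (sk s S₁) (sk s S₂) m
  in if h ≤ᵇ k then out ≡ᵇ h else (suc k ≤ᵇ out)

IsECS : (σ n k c d r : ℕ) → Sketcher σ n r → Decoder r → Set
IsECS σ n k c d r sk dec =
  ∀ (S₁ S₂ : Str σ n) (m : ℤ) →
    PrBadBound n c d r (λ s → if correctOn k sk dec S₁ S₂ m s then false else true)

HasSize : (σ n c d r sz : ℕ) → Sketcher σ n r → Set
HasSize σ n c d r sz sk =
  ∀ (S : Str σ n) → PrBadBound n c d r (λ s → suc sz ≤ᵇ length (sk s S))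

polylogBound : ℕ → ℕ → ℕ → ℕ
polylogBound C n k = C * k * (suc ⌊log₂ n ⌋ ^ C)

{-# OPTIONS --safe #-}
-- Strings are first recoded by a random hash of the alphabet into O(log n) bits.  The sketch of x
-- consists of pairs (r , H (cyc^r x)) for O(log n) rotations r, where H is a random linear map over
-- F₂ with Õ(k) output bits; being linear, H reveals the difference of any two recorded rotations
-- (of the same string or of both) that are at distance Õ(k).  Two kinds of rotations are recorded.
--
-- (1) Generators of the group of shifts spanned by the approximate periods of x, i.e. by the a with
--     Ham x (cyc^a x) = Õ(k).  A gcd chain shows that log n of them suffice.
-- (2) For O(log n) independent trials, a rotation chosen by correlated sampling: restrict every
--     rotation of x to a random set of about n/k positions, and pick one whose restriction is
--     selected by a shared random function.  If Ham x (cyc^m y) ≤ k, then with constant probability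
--     both parties pick equal restrictions, and equal restrictions force the picked rotations of x
--     and y to be at distance Õ(k).
--
-- A successful trial aligns x and cyc^m y up to an approximate period of x, and (1) removes that
-- ambiguity.  The decoder outputs the largest distance among all pairs of strings that are
-- consistent with the recorded differences; the true pair always is.
module Submission where

open import Defs
open import Data.Bool using (Bool; true; false; if_then_else_; _xor_; _∧_)
open import Data.Bool.Properties using (T-≡) renaming (_≟_ to _≟ᵇ_)
open import Data.Fin using (Fin; zero; suc; combine; toℕ; _↑ˡ_; _↑ʳ_; splitAt)
open import Data.Fin.Properties using (combine-injective; toℕ-fromℕ<; all?; splitAt⁻¹-↑ˡ; splitAt⁻¹-↑ʳ) renaming (_≟_ to _≟ᶠ_)
open import Data.Integer using (ℤ) renaming (+_ to pos; -[1+_] to negsuc)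
open import Data.List as List using (List; []; _∷_; length)
open import Data.List.Relation.Unary.All as All using (All; []; _∷_)
open import Data.Nat
open import Data.Nat.Divisibility using (_∣_; _∣?_; divides)
open import Data.Nat.DivMod using (_%_; _/_; _mod_; m≡m%n+[m/n]*n; m<n⇒m%n≡m; m%n<n; m<n*o⇒m/o<n; [m+n]%n≡m%n; n%n≡0)
open import Data.Nat.GCD using (gcd; gcd[m,n]∣m; gcd[m,n]∣n; gcd[m,n]≢0; gcd-GCD; module Bézout)
open import Data.Nat.Induction using (<-rec)
open import Data.Nat.Logarithm using (⌊log₂_⌋; ⌊log₂[2^n]⌋≡n; ⌊log₂⌋-mono-≤; ⌊log₂⌊n/2⌋⌋≡⌊log₂n⌋∸1)
open import Data.Nat.Properties
open import Data.Nat.Tactic.RingSolver using (solve-∀)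
open import Data.Product using (Σ; ∃; _×_; _,_; proj₁; proj₂; uncurry)
open import Data.Sum using (_⊎_; inj₁; inj₂)
open import Data.Vec as Vec using (Vec; []; _∷_; _∷ʳ_; _++_; take; drop; lookup; map; zipWith; replicate; concat; toList; initLast)
open import Data.Vec.Properties using (∷-injective; ∷-injectiveˡ; ∷-injectiveʳ; lookup-map; lookup-++ˡ; lookup-++ʳ; map-∷ʳ; length-toList) renaming (≡-dec to ≡-decᵛ)
open import Function using (_∘_)
open import Function.Bundles using (Equivalence)
open import Relation.Binary.Definitions using (tri<; tri≈; tri>)
open import Relation.Binary.PropositionalEquality
open import Relation.Nullary using (¬_; Dec; yes; no; contradiction)
open import Relation.Nullary.Decidable using (does; map′; _×-dec_; _⊎-dec_; _→-dec_; ¬?)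

-- Probabilities are natural-number sums with the denominators cleared. Only the sketch is charged
-- for, so the shared seed may hold a truly random function on exponentially many items.
--
-- The obstacle is that the recorded differences do not determine either string, so the decoder
-- cannot recover the strings. It suffices to control the error y = X + x of a candidate X against
-- the true string x. A recognised difference between two rotations forces the errors to coincide at
-- these rotations. The shifts that fix the error of the first string form a subgroup; it contains
-- the generators of (1), hence every approximate period. One successful trial of (2) then carries
-- the error of the first string to that of the second at offset exactly m. Equal errors cancel in
-- the difference, so every consistent candidate pair has the true distance.
--
-- If the distance exceeds k, no alignment is required: a maximum over the consistent pairs is at
-- least the true distance.

-- Counting over sample spaces

-- Sample spaces: a ∈ El Ω is read as a uniformly random outcome, so probabilities are
-- sums ∑ Ω divided by ∣ Ω ∣.
data Space : Set where
  bit : Space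
  _⊗_ : Space → Space → Space
  vec : Space → ℕ → Space

infixr 5 _⊗_

El : Space → Set
El bit       = Bool
El (a ⊗ b)   = El a × El b
El (vec a n) = Vec (El a) n

-- The number of random bits behind one outcome. Every size is thus a power of two, and rates such
-- as 1/k or 1/n are rounded to powers of two.
dim : Space → ℕ
dim bit       = 1
dim (a ⊗ b)   = dim a + dim b
dim (vec a n) = n * dim a

∑ : (a : Space) → (El a → ℕ) → ℕ
∑ bit             f = f true + f false
∑ (a ⊗ b)         f = ∑ a λ x → ∑ b λ y → f (x , y)
∑ (vec a zero)    f = f []
∑ (vec a (suc n)) f = ∑ a λ x → ∑ (vec a n) λ xs → f (x ∷ xs)

∣_∣ : Space → ℕ
∣ a ∣ = 2 ^ dim a

∑-mono : ∀ a {f g : El a → ℕ} → (∀ x → f x ≤ g x) → ∑ a f ≤ ∑ a g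
∑-mono bit             p = +-mono-≤ (p true) (p false)
∑-mono (a ⊗ b)         p = ∑-mono a λ x → ∑-mono b λ y → p (x , y)
∑-mono (vec a zero)    p = p []
∑-mono (vec a (suc n)) p = ∑-mono a λ x → ∑-mono (vec a n) λ xs → p (x ∷ xs)

∑-cong : ∀ a {f g : El a → ℕ} → (∀ x → f x ≡ g x) → ∑ a f ≡ ∑ a g
∑-cong a p = ≤-antisym (∑-mono a (≤-reflexive ∘ p)) (∑-mono a (≤-reflexive ∘ sym ∘ p))

∑-+ : ∀ a (f g : El a → ℕ) → ∑ a (λ x → f x + g x) ≡ ∑ a f + ∑ a g
∑-+ bit f g = lemma (f true) (g true) (f false) (g false)
  where lemma : ∀ p q r s → p + q + (r + s) ≡ p + r + (q + s)
        lemma = solve-∀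
∑-+ (a ⊗ b) f g = trans (∑-cong a λ x → ∑-+ b _ _) (∑-+ a _ _)
∑-+ (vec a zero) f g = refl
∑-+ (vec a (suc n)) f g = trans (∑-cong a λ x → ∑-+ (vec a n) _ _) (∑-+ a _ _)

∑-*ˡ : ∀ a c (f : El a → ℕ) → ∑ a (λ x → c * f x) ≡ c * ∑ a f
∑-*ˡ bit c f = sym (*-distribˡ-+ c (f true) (f false))
∑-*ˡ (a ⊗ b) c f = trans (∑-cong a λ x → ∑-*ˡ b c _) (∑-*ˡ a c _)
∑-*ˡ (vec a zero) c f = refl
∑-*ˡ (vec a (suc n)) c f = trans (∑-cong a λ x → ∑-*ˡ (vec a n) c _) (∑-*ˡ a c _)

∑-*ʳ : ∀ a c (f : El a → ℕ) → ∑ a (λ x → f x * c) ≡ ∑ a f * c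
∑-*ʳ a c f = trans (∑-cong a λ x → *-comm (f x) c) (trans (∑-*ˡ a c f) (*-comm c _))

∑-const : ∀ a c → ∑ a (λ _ → c) ≡ ∣ a ∣ * c
∑-const bit c = cong (c +_) (sym (+-identityʳ c))
∑-const (a ⊗ b) c = begin
  ∑ a (λ _ → ∑ b (λ _ → c))    ≡⟨ ∑-cong a (λ _ → ∑-const b c) ⟩
  ∑ a (λ _ → ∣ b ∣ * c)        ≡⟨ ∑-const a _ ⟩
  ∣ a ∣ * (∣ b ∣ * c)          ≡⟨ *-assoc ∣ a ∣ _ _ ⟨
  ∣ a ∣ * ∣ b ∣ * c            ≡⟨ cong (_* c) (^-distribˡ-+-* 2 (dim a) (dim b)) ⟨
  ∣ a ⊗ b ∣ * c                ∎
  where open ≡-Reasoning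
∑-const (vec a zero) c = sym (+-identityʳ c)
∑-const (vec a (suc n)) c = begin
  ∑ a (λ _ → ∑ (vec a n) (λ _ → c)) ≡⟨ ∑-cong a (λ _ → ∑-const (vec a n) c) ⟩
  ∑ a (λ _ → ∣ vec a n ∣ * c)       ≡⟨ ∑-const a _ ⟩
  ∣ a ∣ * (∣ vec a n ∣ * c)         ≡⟨ *-assoc ∣ a ∣ _ _ ⟨
  ∣ a ∣ * ∣ vec a n ∣ * c           ≡⟨ cong (_* c) (^-distribˡ-+-* 2 (dim a) (n * dim a)) ⟨
  ∣ vec a (suc n) ∣ * c             ∎
  where open ≡-Reasoning

∑-swap : ∀ a b (f : El a → El b → ℕ) →
         ∑ a (λ x → ∑ b (f x)) ≡ ∑ b (λ y → ∑ a λ x → f x y)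
∑-swap bit b f = sym (∑-+ b (f true) (f false))
∑-swap (a ⊗ a′) b f = trans (∑-cong a λ x → ∑-swap a′ b _) (∑-swap a b _)
∑-swap (vec a zero) b f = refl
∑-swap (vec a (suc n)) b f = trans (∑-cong a λ x → ∑-swap (vec a n) b _) (∑-swap a b _)

≤∑ : ∀ a (f : El a → ℕ) x → f x ≤ ∑ a f
≤∑ bit f true = m≤m+n _ _
≤∑ bit f false = m≤n+m _ _
≤∑ (a ⊗ b) f (x , y) = ≤-trans (≤∑ b _ y) (≤∑ a _ x)
≤∑ (vec a zero) f [] = ≤-refl
≤∑ (vec a (suc n)) f (x ∷ xs) = ≤-trans (≤∑ (vec a n) _ xs) (≤∑ a _ x)

any? : ∀ a {P : El a → Set} → (∀ x → Dec (P x)) → Dec (∃ P)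
any? bit {P} P? = map′ to from (P? true ⊎-dec P? false)
  where
  to : P true ⊎ P false → ∃ P
  to (inj₁ p) = true , p
  to (inj₂ p) = false , p
  from : ∃ P → P true ⊎ P false
  from (true , p)  = inj₁ p
  from (false , p) = inj₂ p
any? (a ⊗ b) P? = map′ (λ (x , y , p) → (x , y) , p) (λ ((x , y) , p) → x , y , p)
  (any? a λ x → any? b λ y → P? (x , y))
any? (vec a zero) P? = map′ (λ p → [] , p) (λ { ([] , p) → p }) (P? [])
any? (vec a (suc n)) P? = map′ (λ (x , xs , p) → x ∷ xs , p) (λ { (x ∷ xs , p) → x , xs , p })
  (any? a λ x → any? (vec a n) λ xs → P? (x ∷ xs))

Max : (a : Space) → (El a → ℕ) → ℕ
Max bit             f = f true ⊔ f false
Max (a ⊗ b)         f = Max a λ x → Max b λ y → f (x , y)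
Max (vec a zero)    f = f []
Max (vec a (suc n)) f = Max a λ x → Max (vec a n) λ xs → f (x ∷ xs)

≤Max : ∀ a (f : El a → ℕ) x → f x ≤ Max a f
≤Max bit f true = m≤m⊔n _ _
≤Max bit f false = m≤n⊔m _ _
≤Max (a ⊗ b) f (x , y) = ≤-trans (≤Max b _ y) (≤Max a _ x)
≤Max (vec a zero) f [] = ≤-refl
≤Max (vec a (suc n)) f (x ∷ xs) = ≤-trans (≤Max (vec a n) _ xs) (≤Max a _ x)

Max≤ : ∀ a {f : El a → ℕ} {c} → (∀ x → f x ≤ c) → Max a f ≤ c
Max≤ bit p = ⊔-lub (p true) (p false)
Max≤ (a ⊗ b) p = Max≤ a λ x → Max≤ b λ y → p (x , y)
Max≤ (vec a zero) p = p []
Max≤ (vec a (suc n)) p = Max≤ a λ x → Max≤ (vec a n) λ xs → p (x ∷ xs)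

𝟙 : ∀ {P : Set} → Dec P → ℕ
𝟙 p = if does p then 1 else 0

𝟙-yes : ∀ {P : Set} (p? : Dec P) → P → 𝟙 p? ≡ 1
𝟙-yes (yes _) p = refl
𝟙-yes (no ¬p) p = contradiction p ¬p

𝟙-no : ∀ {P : Set} (p? : Dec P) → ¬ P → 𝟙 p? ≡ 0
𝟙-no (yes p) ¬p = contradiction p ¬p
𝟙-no (no _)  ¬p = refl

𝟙≤1 : ∀ {P : Set} (p? : Dec P) → 𝟙 p? ≤ 1
𝟙≤1 (yes _) = ≤-refl
𝟙≤1 (no _)  = z≤n

𝟙≤ : ∀ {P : Set} (p? : Dec P) {m} → (P → 1 ≤ m) → 𝟙 p? ≤ m
𝟙≤ (yes p) f = f p
𝟙≤ (no _)  f = z≤n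

𝟙⁻ : ∀ {P : Set} (p? : Dec P) → 1 ≤ 𝟙 p? → P
𝟙⁻ (yes p) _ = p
𝟙⁻ (no _) ()

𝟙-mono : ∀ {P Q : Set} (p? : Dec P) (q? : Dec Q) → (P → Q) → 𝟙 p? ≤ 𝟙 q?
𝟙-mono p? q? f = 𝟙≤ p? λ p → ≤-reflexive (sym (𝟙-yes q? (f p)))

𝟙-cong : ∀ {P Q : Set} (p? : Dec P) (q? : Dec Q) → (P → Q) → (Q → P) → 𝟙 p? ≡ 𝟙 q?
𝟙-cong p? q? f g = ≤-antisym (𝟙-mono p? q? f) (𝟙-mono q? p? g)

𝟙-× : ∀ {P Q : Set} (p? : Dec P) (q? : Dec Q) → 𝟙 (p? ×-dec q?) ≡ 𝟙 p? * 𝟙 q?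
𝟙-× (yes _) (yes _) = refl
𝟙-× (yes _) (no _)  = refl
𝟙-× (no _)  _       = refl

-- A single coordinate of a uniform vector is uniform; the factor `∣ a ∣` replaces a division.
∑-lookup : ∀ a {N} (i : Fin N) (f : El a → ℕ) →
           ∣ a ∣ * ∑ (vec a N) (λ g → f (lookup g i)) ≡ ∣ vec a N ∣ * ∑ a f
∑-lookup a {suc N} zero f = begin
  ∣ a ∣ * ∑ a (λ x → ∑ (vec a N) λ _ → f x) ≡⟨ cong (∣ a ∣ *_) (∑-cong a λ x → ∑-const (vec a N) (f x)) ⟩
  ∣ a ∣ * ∑ a (λ x → ∣ vec a N ∣ * f x)     ≡⟨ cong (∣ a ∣ *_) (∑-*ˡ a ∣ vec a N ∣ f) ⟩
  ∣ a ∣ * (∣ vec a N ∣ * ∑ a f)             ≡⟨ *-assoc ∣ a ∣ _ _ ⟨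
  ∣ a ∣ * ∣ vec a N ∣ * ∑ a f               ≡⟨ cong (_* ∑ a f) (^-distribˡ-+-* 2 (dim a) (N * dim a)) ⟨
  ∣ vec a (suc N) ∣ * ∑ a f ∎
  where open ≡-Reasoning
∑-lookup a {suc N} (suc i) f = begin
  ∣ a ∣ * ∑ a (λ x → ∑ (vec a N) λ g → f (lookup g i)) ≡⟨ cong (∣ a ∣ *_) (∑-const a _) ⟩
  ∣ a ∣ * (∣ a ∣ * ∑ (vec a N) λ g → f (lookup g i)) ≡⟨ cong (∣ a ∣ *_) (∑-lookup a i f) ⟩
  ∣ a ∣ * (∣ vec a N ∣ * ∑ a f)             ≡⟨ *-assoc ∣ a ∣ _ _ ⟨
  ∣ a ∣ * ∣ vec a N ∣ * ∑ a f               ≡⟨ cong (_* ∑ a f) (^-distribˡ-+-* 2 (dim a) (N * dim a)) ⟨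
  ∣ vec a (suc N) ∣ * ∑ a f ∎
  where open ≡-Reasoning

-- Pairwise independence of the coordinates: the form in which the randomness of the firing table
-- and of the alphabet hash enters.
∑-lookup₂ : ∀ a {N} (i j : Fin N) → i ≢ j → (f : El a → El a → ℕ) →
            ∣ a ∣ * ∣ a ∣ * ∑ (vec a N) (λ g → f (lookup g i) (lookup g j)) ≡
            ∣ vec a N ∣ * ∑ a (λ x → ∑ a (f x))
∑-lookup₂ a zero zero i≢j f = contradiction refl i≢j
∑-lookup₂ a {suc N} zero (suc j) i≢j f = begin
  A * A * ∑ a (λ x → ∑ (vec a N) λ g → f x (lookup g j)) ≡⟨ *-assoc A A _ ⟩
  A * (A * ∑ a (λ x → ∑ (vec a N) λ g → f x (lookup g j))) ≡⟨ cong (A *_) (∑-*ˡ a A _) ⟨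
  A * ∑ a (λ x → A * ∑ (vec a N) λ g → f x (lookup g j)) ≡⟨ cong (A *_) (∑-cong a λ x → ∑-lookup a j (f x)) ⟩
  A * ∑ a (λ x → ∣ vec a N ∣ * ∑ a (f x)) ≡⟨ cong (A *_) (∑-*ˡ a ∣ vec a N ∣ (λ x → ∑ a (f x))) ⟩
  A * (∣ vec a N ∣ * ∑ a (λ x → ∑ a (f x))) ≡⟨ *-assoc A _ _ ⟨
  A * ∣ vec a N ∣ * ∑ a (λ x → ∑ a (f x)) ≡⟨ cong (_* ∑ a (λ x → ∑ a (f x))) (^-distribˡ-+-* 2 (dim a) (N * dim a)) ⟨
  ∣ vec a (suc N) ∣ * ∑ a (λ x → ∑ a (f x)) ∎
  where open ≡-Reasoning
        A = ∣ a ∣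
∑-lookup₂ a {suc N} (suc i) zero i≢j f =
  trans (∑-lookup₂ a zero (suc i) (i≢j ∘ sym) (λ x y → f y x))
        (cong (∣ vec a (suc N) ∣ *_) (∑-swap a a _))
∑-lookup₂ a {suc N} (suc i) (suc j) i≢j f = begin
  A * A * ∑ a (λ x → ∑ (vec a N) λ g → f (lookup g i) (lookup g j)) ≡⟨ cong (A * A *_) (∑-const a _) ⟩
  A * A * (A * ∑ (vec a N) λ g → f (lookup g i) (lookup g j)) ≡⟨ lemma A _ ⟩
  A * (A * A * ∑ (vec a N) λ g → f (lookup g i) (lookup g j)) ≡⟨ cong (A *_) (∑-lookup₂ a i j (i≢j ∘ cong suc) f) ⟩
  A * (∣ vec a N ∣ * ∑ a (λ x → ∑ a (f x))) ≡⟨ *-assoc A _ _ ⟨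
  A * ∣ vec a N ∣ * ∑ a (λ x → ∑ a (f x)) ≡⟨ cong (_* ∑ a (λ x → ∑ a (f x))) (^-distribˡ-+-* 2 (dim a) (N * dim a)) ⟨
  ∣ vec a (suc N) ∣ * ∑ a (λ x → ∑ a (f x)) ∎
  where open ≡-Reasoning
        A = ∣ a ∣
        lemma : ∀ p q → p * p * (p * q) ≡ p * (p * p * q)
        lemma = solve-∀

∏ᵛ : ∀ {A : Set} {n} → (A → ℕ) → Vec A n → ℕ
∏ᵛ f []       = 1
∏ᵛ f (x ∷ xs) = f x * ∏ᵛ f xs

-- Full independence: the expectation of a product over the coordinates factors. It serves the `s`
-- parities of a hash and the `T` trials.
∑-∏ᵛ : ∀ a N (f : El a → ℕ) → ∑ (vec a N) (∏ᵛ f) ≡ ∑ a f ^ N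
∑-∏ᵛ a zero f = refl
∑-∏ᵛ a (suc N) f = trans (∑-cong a λ x → ∑-*ˡ (vec a N) (f x) (∏ᵛ f))
  (trans (∑-*ʳ a _ f) (cong (∑ a f *_) (∑-∏ᵛ a N f)))

-- Uniform seeds and uniform outcomes

fromSeed : ∀ a → Seed (dim a) → El a
fromSeed bit (b ∷ [])        = b
fromSeed (a ⊗ b) s           = fromSeed a (take (dim a) s) , fromSeed b (drop (dim a) s)
fromSeed (vec a zero) s      = []
fromSeed (vec a (suc n)) s   = fromSeed a (take (dim a) s) ∷ fromSeed (vec a n) (drop (dim a) s)

∑-++ : ∀ m n (f : Seed (m + n) → ℕ) →
       ∑ (vec bit (m + n)) f ≡ ∑ (vec bit m) (λ u → ∑ (vec bit n) λ v → f (u ++ v))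
∑-++ zero n f = refl
∑-++ (suc m) n f = cong₂ _+_ (∑-++ m n _) (∑-++ m n _)

take-++ : ∀ {A : Set} m {n} (u : Vec A m) (v : Vec A n) → take m (u ++ v) ≡ u
take-++ zero [] v = refl
take-++ (suc m) (x ∷ u) v = cong (x ∷_) (take-++ m u v)

drop-++ : ∀ {A : Set} m {n} (u : Vec A m) (v : Vec A n) → drop m (u ++ v) ≡ v
drop-++ zero [] v = refl
drop-++ (suc m) (x ∷ u) v = drop-++ m u v

-- Disjoint segments of a uniform seed are independent and uniform, so events on seeds can be
-- counted over a structured sample space.
∑-fromSeed : ∀ a (f : El a → ℕ) → ∑ (vec bit (dim a)) (f ∘ fromSeed a) ≡ ∑ a f
∑-fromSeed bit f = refl
∑-fromSeed (a ⊗ b) f = begin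
  ∑ (vec bit (dim a + dim b)) (f ∘ fromSeed (a ⊗ b)) ≡⟨ ∑-++ (dim a) (dim b) _ ⟩
  _ ≡⟨ ∑-cong (vec bit (dim a)) (λ u → ∑-cong (vec bit (dim b)) λ v →
         cong₂ (λ u′ v′ → f (fromSeed a u′ , fromSeed b v′)) (take-++ (dim a) u v) (drop-++ (dim a) u v)) ⟩
  _ ≡⟨ ∑-cong (vec bit (dim a)) (λ u → ∑-fromSeed b _) ⟩
  _ ≡⟨ ∑-fromSeed a _ ⟩
  ∑ (a ⊗ b) f ∎
  where open ≡-Reasoning
∑-fromSeed (vec a zero) f = refl
∑-fromSeed (vec a (suc n)) f = begin
  ∑ (vec bit (dim a + n * dim a)) (f ∘ fromSeed (vec a (suc n))) ≡⟨ ∑-++ (dim a) (n * dim a) _ ⟩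
  _ ≡⟨ ∑-cong (vec bit (dim a)) (λ u → ∑-cong (vec bit (n * dim a)) λ v →
         cong₂ (λ u′ v′ → f (fromSeed a u′ ∷ fromSeed (vec a n) v′)) (take-++ (dim a) u v) (drop-++ (dim a) u v)) ⟩
  _ ≡⟨ ∑-cong (vec bit (dim a)) (λ u → ∑-fromSeed (vec a n) _) ⟩
  _ ≡⟨ ∑-fromSeed a _ ⟩
  ∑ (vec a (suc n)) f ∎
  where open ≡-Reasoning

length-filter-∷ : ∀ {A : Set} (ev : A → Bool) s ss →
  List.length (List.filter (λ s → ev s ≟ᵇ true) (s List.∷ ss)) ≡
  𝟙 (ev s ≟ᵇ true) + List.length (List.filter (λ s → ev s ≟ᵇ true) ss)
length-filter-∷ ev s ss with ev s
... | true  = refl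
... | false = refl

-- `allSeeds` lists the two extensions of each seed side by side, whereas `∑` splits on the first
-- bit at the outside; a count does not see the order.
length-filter-concatMap : ∀ {r} (ev : Seed (suc r) → Bool) (ss : List.List (Seed r)) →
  List.length (List.filter (λ s → ev s ≟ᵇ true) (List.concatMap (λ s → (true ∷ s) List.∷ (false ∷ s) List.∷ List.[]) ss)) ≡
  List.length (List.filter (λ s → ev (true ∷ s) ≟ᵇ true) ss) + List.length (List.filter (λ s → ev (false ∷ s) ≟ᵇ true) ss)
length-filter-concatMap ev List.[] = refl
length-filter-concatMap ev (s List.∷ ss) = begin
  _ ≡⟨ length-filter-∷ ev (true ∷ s) _ ⟩
  t + _ ≡⟨ cong (t +_) (length-filter-∷ ev (false ∷ s) _) ⟩
  t + (f + _) ≡⟨ cong (λ z → t + (f + z)) (length-filter-concatMap ev ss) ⟩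
  t + (f + (ts + fs)) ≡⟨ lemma t f ts fs ⟩
  (t + ts) + (f + fs) ≡⟨ cong₂ _+_ (length-filter-∷ (ev ∘ (true ∷_)) s ss) (length-filter-∷ (ev ∘ (false ∷_)) s ss) ⟨
  _ ∎
  where
  open ≡-Reasoning
  t = 𝟙 (ev (true ∷ s) ≟ᵇ true)
  f = 𝟙 (ev (false ∷ s) ≟ᵇ true)
  ts = List.length (List.filter (λ s → ev (true ∷ s) ≟ᵇ true) ss)
  fs = List.length (List.filter (λ s → ev (false ∷ s) ≟ᵇ true) ss)
  lemma : ∀ p q r s → p + (q + (r + s)) ≡ p + r + (q + s)
  lemma = solve-∀

count-∑ : ∀ {r} (ev : Seed r → Bool) → count ev ≡ ∑ (vec bit r) (λ s → 𝟙 (ev s ≟ᵇ true))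
count-∑ {zero} ev with ev []
... | true  = refl
... | false = refl
count-∑ {suc r} ev = trans (length-filter-concatMap ev (allSeeds r))
  (cong₂ _+_ (count-∑ (ev ∘ (true ∷_))) (count-∑ (ev ∘ (false ∷_))))

-- Sums over initial segments of the naturals

∑< : ℕ → (ℕ → ℕ) → ℕ
∑< zero    f = 0
∑< (suc n) f = f 0 + ∑< n (f ∘ suc)

∑<-mono : ∀ n {f g : ℕ → ℕ} → (∀ i → i < n → f i ≤ g i) → ∑< n f ≤ ∑< n g
∑<-mono zero p = z≤n
∑<-mono (suc n) p = +-mono-≤ (p 0 z<s) (∑<-mono n λ i i<n → p (suc i) (s<s i<n))

∑<-cong : ∀ n {f g : ℕ → ℕ} → (∀ i → i < n → f i ≡ g i) → ∑< n f ≡ ∑< n g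
∑<-cong n p = ≤-antisym (∑<-mono n λ i i<n → ≤-reflexive (p i i<n)) (∑<-mono n λ i i<n → ≤-reflexive (sym (p i i<n)))

∑<-+ : ∀ n (f g : ℕ → ℕ) → ∑< n (λ i → f i + g i) ≡ ∑< n f + ∑< n g
∑<-+ zero f g = refl
∑<-+ (suc n) f g = trans (cong (f 0 + g 0 +_) (∑<-+ n _ _)) (lemma (f 0) (g 0) (∑< n (f ∘ suc)) (∑< n (g ∘ suc)))
  where lemma : ∀ p q r s → p + q + (r + s) ≡ p + r + (q + s)
        lemma = solve-∀

∑<-*ˡ : ∀ n c (f : ℕ → ℕ) → ∑< n (λ i → c * f i) ≡ c * ∑< n f
∑<-*ˡ zero c f = sym (*-zeroʳ c)
∑<-*ˡ (suc n) c f = trans (cong (c * f 0 +_) (∑<-*ˡ n c _)) (sym (*-distribˡ-+ c (f 0) _))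

∑<-const : ∀ n c → ∑< n (λ _ → c) ≡ n * c
∑<-const zero c = refl
∑<-const (suc n) c = cong (c +_) (∑<-const n c)

∑<-bound : ∀ n {f : ℕ → ℕ} {c} → (∀ i → i < n → f i ≤ c) → ∑< n f ≤ n * c
∑<-bound n p = ≤-trans (∑<-mono n p) (≤-reflexive (∑<-const n _))

≤∑< : ∀ n (f : ℕ → ℕ) i → i < n → f i ≤ ∑< n f
≤∑< (suc n) f zero _ = m≤m+n _ _
≤∑< (suc n) f (suc i) (s<s i<n) = ≤-trans (≤∑< n (f ∘ suc) i i<n) (m≤n+m _ _)

∑<-last : ∀ n (f : ℕ → ℕ) → ∑< (suc n) f ≡ ∑< n f + f n
∑<-last zero f = +-comm (f 0) 0
∑<-last (suc n) f = trans (cong (f 0 +_) (∑<-last n (f ∘ suc))) (sym (+-assoc (f 0) _ _))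

∑<-monoˡ : ∀ {m n} (f : ℕ → ℕ) → m ≤ n → ∑< m f ≤ ∑< n f
∑<-monoˡ f z≤n = z≤n
∑<-monoˡ f (s≤s m≤n) = +-monoʳ-≤ (f 0) (∑<-monoˡ (f ∘ suc) m≤n)

-- For a shift by one, both sums complete to the same sum of `suc n` terms, and periodicity makes
-- the two missing end terms equal.
∑<-rotate : ∀ n (f : ℕ → ℕ) → (∀ i → f (n + i) ≡ f i) → ∀ m → ∑< n (λ i → f (m + i)) ≡ ∑< n f
∑<-rotate n f per zero = refl
∑<-rotate n f per (suc m) = trans (∑<-cong n λ i _ → cong f (sym (+-suc m i)))
  (trans step (∑<-rotate n f per m))
  where
  g = λ i → f (m + i)
  step : ∑< n (g ∘ suc) ≡ ∑< n g
  step = +-cancelˡ-≡ (g 0) _ _ (trans (∑<-last n g)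
    (trans (+-comm _ (g n)) (cong (_+ ∑< n g) (trans (cong f (+-comm m n)) (trans (per m) (cong f (sym (+-identityʳ m))))))))

∑-∑< : ∀ a n (f : El a → ℕ → ℕ) → ∑ a (λ x → ∑< n (f x)) ≡ ∑< n (λ i → ∑ a λ x → f x i)
∑-∑< a zero f = trans (∑-const a 0) (*-zeroʳ ∣ a ∣)
∑-∑< a (suc n) f = trans (∑-+ a _ _) (cong (∑ a (λ x → f x 0) +_) (∑-∑< a n _))

-- At most one term is nonzero, and it is at most 1. Later `f` marks the firing positions without
-- clash and `c` the event that both parties choose equal names.
∑<-unique : ∀ n (f : ℕ → ℕ) c → (∀ i → i < n → f i ≤ 1) → (∀ i → i < n → 1 ≤ f i → 1 ≤ c) →
            (∀ i j → i < n → j < n → 1 ≤ f i → 1 ≤ f j → i ≡ j) → ∑< n f ≤ c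
∑<-unique zero f c _ _ _ = z≤n
∑<-unique (suc n) f c ≤1 ⇒c uniq with 1 ≤? f 0
... | no f0≱1 = subst (λ z → z + ∑< n (f ∘ suc) ≤ c) (sym (n<1⇒n≡0 (≰⇒> f0≱1)))
  (∑<-unique n (f ∘ suc) c (λ i l → ≤1 (suc i) (s<s l)) (λ i l → ⇒c (suc i) (s<s l))
     (λ i j l l′ p p′ → suc-injective (uniq _ _ (s<s l) (s<s l′) p p′)))
... | yes f0≥1 = ≤-trans (+-mono-≤ (≤1 0 z<s) rest) (⇒c 0 z<s f0≥1)
  where
  zero-rest : ∀ i → i < n → f (suc i) ≤ 0
  zero-rest i l with 1 ≤? f (suc i)
  ... | no p = s≤s⁻¹ (≰⇒> p)
  ... | yes p with () ← uniq 0 (suc i) z<s (s<s l) f0≥1 p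
  rest : ∑< n (f ∘ suc) ≤ 0
  rest = ≤-trans (∑<-bound n zero-rest) (≤-reflexive (*-zeroʳ n))

-- Words, random parities and random masks

Word : ℕ → Set
Word b = Vec Bool b

infix 4 _≟ʷ_ _≟ᵛ_
infixl 6 _⊕_

_≟ʷ_ : ∀ {b} (u v : Word b) → Dec (u ≡ v)
_≟ʷ_ = ≡-decᵛ _≟ᵇ_

_≟ᵛ_ : ∀ {b n} (u v : Vec (Word b) n) → Dec (u ≡ v)
_≟ᵛ_ = ≡-decᵛ _≟ʷ_

_⊕_ : ∀ {b} → Word b → Word b → Word b
_⊕_ = zipWith _xor_

0ʷ 1ʷ : ∀ {b} → Word b
0ʷ = replicate _ false
1ʷ = replicate _ true

xor-exchange : ∀ a b c d → a xor b ≡ c xor d → a xor c ≡ b xor d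
xor-exchange false false false false _ = refl
xor-exchange false false true  true  _ = refl
xor-exchange false true  false true  _ = refl
xor-exchange false true  true  false _ = refl
xor-exchange true  false false true  _ = refl
xor-exchange true  false true  false _ = refl
xor-exchange true  true  false false _ = refl
xor-exchange true  true  true  true  _ = refl

-- Addition over F₂ is its own inverse. This turns equal differences between two strings into equal
-- errors of two candidates, and back.
⊕-exchange : ∀ {b} (s t u v : Word b) → s ⊕ t ≡ u ⊕ v → s ⊕ u ≡ t ⊕ v
⊕-exchange [] [] [] [] _ = refl
⊕-exchange (a ∷ s) (b ∷ t) (c ∷ u) (d ∷ v) eq =
  cong₂ _∷_ (xor-exchange a b c d (∷-injectiveˡ eq)) (⊕-exchange s t u v (∷-injectiveʳ eq))

⊕-self : ∀ {b} (u : Word b) → u ⊕ u ≡ 0ʷ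
⊕-self [] = refl
⊕-self (false ∷ u) = cong (false ∷_) (⊕-self u)
⊕-self (true  ∷ u) = cong (false ∷_) (⊕-self u)

⊕≡0⇒≡ : ∀ {b} (u v : Word b) → u ⊕ v ≡ 0ʷ → u ≡ v
⊕≡0⇒≡ [] [] _ = refl
⊕≡0⇒≡ (false ∷ u) (false ∷ v) eq = cong (false ∷_) (⊕≡0⇒≡ u v (∷-injectiveʳ eq))
⊕≡0⇒≡ (true  ∷ u) (true  ∷ v) eq = cong (true ∷_) (⊕≡0⇒≡ u v (∷-injectiveʳ eq))
⊕≡0⇒≡ (false ∷ u) (true  ∷ v) ()
⊕≡0⇒≡ (true  ∷ u) (false ∷ v) ()

∑-≟ʷ : ∀ {b} (u : Word b) → ∑ (vec bit b) (λ v → 𝟙 (v ≟ʷ u)) ≡ 1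
∑-≟ʷ [] = refl
∑-≟ʷ {suc b} (true ∷ u) = cong₂ _+_
  (trans (∑-cong (vec bit b) λ v → 𝟙-cong (true ∷ v ≟ʷ true ∷ u) (v ≟ʷ u) ∷-injectiveʳ (cong (true ∷_))) (∑-≟ʷ u))
  (trans (∑-cong (vec bit b) λ v → 𝟙-no (false ∷ v ≟ʷ true ∷ u) λ ()) (trans (∑-const (vec bit b) 0) (*-zeroʳ ∣ vec bit b ∣)))
∑-≟ʷ {suc b} (false ∷ u) = cong₂ _+_
  (trans (∑-cong (vec bit b) λ v → 𝟙-no (true ∷ v ≟ʷ false ∷ u) λ ()) (trans (∑-const (vec bit b) 0) (*-zeroʳ ∣ vec bit b ∣)))
  (trans (∑-cong (vec bit b) λ v → 𝟙-cong (false ∷ v ≟ʷ false ∷ u) (v ≟ʷ u) ∷-injectiveʳ (cong (false ∷_))) (∑-≟ʷ u))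

ne : ∀ {b} → Word b → Word b → ℕ
ne u v = if does (u ≟ʷ v) then 0 else 1

ne-≡ : ∀ {b} (u v : Word b) → u ≡ v → ne u v ≡ 0
ne-≡ u v u≡v with u ≟ʷ v
... | yes _ = refl
... | no u≢v = contradiction u≡v u≢v

ne-≢ : ∀ {b} (u v : Word b) → u ≢ v → ne u v ≡ 1
ne-≢ u v u≢v with u ≟ʷ v
... | yes u≡v = contradiction u≡v u≢v
... | no _ = refl

ne-⊕ : ∀ {b} (u v : Word b) → ne u v ≡ ne (u ⊕ v) 0ʷ
ne-⊕ u v with u ≟ʷ v
... | yes refl = sym (ne-≡ _ _ (⊕-self u))
... | no u≢v = sym (ne-≢ _ _ (u≢v ∘ ⊕≡0⇒≡ u v))

ne-sym : ∀ {b} (u v : Word b) → ne u v ≡ ne v u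
ne-sym u v with u ≟ʷ v
... | yes refl = sym (ne-≡ u u refl)
... | no u≢v = sym (ne-≢ v u (u≢v ∘ sym))

ne-triangle : ∀ {b} (u v w : Word b) → ne u w ≤ ne u v + ne v w
ne-triangle u v w with u ≟ʷ v
... | yes refl = ≤-refl
... | no _ with u ≟ʷ w
...   | yes _ = z≤n
...   | no _  = s≤s z≤n

dist : ∀ {b} → ℕ → (ℕ → Word b) → (ℕ → Word b) → ℕ
dist n x y = ∑< n λ i → ne (x i) (y i)

wt : ∀ {b} → ℕ → (ℕ → Word b) → ℕ
wt n z = dist n z (λ _ → 0ʷ)

_⊞_ : ∀ {b} → (ℕ → Word b) → (ℕ → Word b) → ℕ → Word b
(x ⊞ y) i = x i ⊕ y i

dist-⊞ : ∀ {b} n (x y : ℕ → Word b) → dist n x y ≡ wt n (x ⊞ y)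
dist-⊞ n x y = ∑<-cong n λ i _ → ne-⊕ (x i) (y i)

dist-sym : ∀ {b} n (x y : ℕ → Word b) → dist n x y ≡ dist n y x
dist-sym n x y = ∑<-cong n λ i _ → ne-sym (x i) (y i)

dist-triangle : ∀ {b} n (x y z : ℕ → Word b) → dist n x z ≤ dist n x y + dist n y z
dist-triangle n x y z = ≤-trans (∑<-mono n λ i _ → ne-triangle (x i) (y i) (z i)) (≤-reflexive (∑<-+ n _ _))

-- Random parities and the linear hash

inner : ∀ {b} → Word b → Word b → Bool
inner []      []      = false
inner (x ∷ u) (y ∷ v) = (x ∧ y) xor inner u v

dot : ∀ {b n} → Vec (Word b) n → (ℕ → Word b) → Bool
dot []       x = false
dot (a ∷ as) x = inner a (x 0) xor dot as (x ∘ suc)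

-- A fair bit, tested against every weight `f`: a fixed summand of a parity can then be absorbed
-- into `f`.
Balanced : (a : Space) → (El a → Bool) → Set
Balanced a φ = ∀ (f : Bool → ℕ) → 2 * ∑ a (f ∘ φ) ≡ ∣ a ∣ * (f true + f false)

xor-sumʳ : ∀ (f : Bool → ℕ) c → f (true xor c) + f (false xor c) ≡ f true + f false
xor-sumʳ f true  = +-comm (f false) (f true)
xor-sumʳ f false = refl

xor-sumˡ : ∀ (f : Bool → ℕ) c → f (c xor true) + f (c xor false) ≡ f true + f false
xor-sumˡ f true  = +-comm (f false) (f true)
xor-sumˡ f false = refl

inner-balanced : ∀ {b} (u : Word b) → u ≢ 0ʷ → Balanced (vec bit b) (λ w → inner w u)
inner-balanced [] u≢0 f = contradiction refl u≢0
inner-balanced {suc b} (true ∷ u) u≢0 f = begin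
  2 * (∑ B (λ w → f (true xor inner w u)) + ∑ B (λ w → f (false xor inner w u))) ≡⟨ cong (2 *_) (∑-+ B _ _) ⟨
  2 * ∑ B (λ w → f (true xor inner w u) + f (false xor inner w u)) ≡⟨ cong (2 *_) (∑-cong B λ w → xor-sumʳ f (inner w u)) ⟩
  2 * ∑ B (λ w → f true + f false) ≡⟨ cong (2 *_) (∑-const B _) ⟩
  2 * (∣ B ∣ * (f true + f false)) ≡⟨ *-assoc 2 ∣ B ∣ _ ⟨
  2 * ∣ B ∣ * (f true + f false) ∎
  where open ≡-Reasoning
        B = vec bit b
inner-balanced {suc b} (false ∷ u) u≢0 f = begin
  2 * (S + S) ≡⟨ lemma S ⟩
  2 * (2 * S) ≡⟨ cong (2 *_) (inner-balanced u (u≢0 ∘ cong (false ∷_)) f) ⟩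
  2 * (∣ B ∣ * (f true + f false)) ≡⟨ *-assoc 2 ∣ B ∣ _ ⟨
  2 * ∣ B ∣ * (f true + f false) ∎
  where open ≡-Reasoning
        B = vec bit b
        S = ∑ B (λ w → f (inner w u))
        lemma : ∀ s → 2 * (s + s) ≡ 2 * (2 * s)
        lemma = solve-∀

∣vec-suc∣ : ∀ a n c → ∣ a ∣ * (∣ vec a n ∣ * c) ≡ ∣ vec a (suc n) ∣ * c
∣vec-suc∣ a n c = trans (sym (*-assoc ∣ a ∣ _ c)) (cong (_* c) (sym (^-distribˡ-+-* 2 (dim a) (n * dim a))))

-- With all other coefficients fixed, the random coefficient at one nonzero letter already makes the
-- parity fair; hence the exchange of sums when that letter comes first.
dot-balanced : ∀ {b} n (x : ℕ → Word b) i → i < n → x i ≢ 0ʷ → Balanced (vec (vec bit b) n) (λ a → dot a x)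
dot-balanced {b} (suc n) x zero _ x≢0 f = begin
  2 * ∑ B (λ a → ∑ Bn λ as → f (inner a (x 0) xor dot as (x ∘ suc))) ≡⟨ cong (2 *_) (∑-swap B Bn _) ⟩
  2 * ∑ Bn (λ as → ∑ B λ a → f (inner a (x 0) xor dot as (x ∘ suc))) ≡⟨ ∑-*ˡ Bn 2 _ ⟨
  ∑ Bn (λ as → 2 * ∑ B λ a → f (inner a (x 0) xor dot as (x ∘ suc))) ≡⟨ ∑-cong Bn (λ as → trans
      (inner-balanced (x 0) x≢0 (λ t → f (t xor dot as (x ∘ suc)))) (cong (∣ B ∣ *_) (xor-sumʳ f (dot as (x ∘ suc))))) ⟩
  ∑ Bn (λ as → ∣ B ∣ * (f true + f false)) ≡⟨ ∑-*ˡ Bn ∣ B ∣ (λ _ → f true + f false) ⟩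
  ∣ B ∣ * ∑ Bn (λ as → (f true + f false)) ≡⟨ cong (∣ B ∣ *_) (∑-const Bn _) ⟩
  ∣ B ∣ * (∣ Bn ∣ * (f true + f false)) ≡⟨ ∣vec-suc∣ B n _ ⟩
  ∣ vec B (suc n) ∣ * (f true + f false) ∎
  where open ≡-Reasoning
        B = vec bit b
        Bn = vec B n
dot-balanced {b} (suc n) x (suc i) (s<s i<n) x≢0 f = begin
  2 * ∑ B (λ a → ∑ Bn λ as → f (inner a (x 0) xor dot as (x ∘ suc))) ≡⟨ ∑-*ˡ B 2 _ ⟨
  ∑ B (λ a → 2 * ∑ Bn λ as → f (inner a (x 0) xor dot as (x ∘ suc))) ≡⟨ ∑-cong B (λ a → trans
      (dot-balanced n (x ∘ suc) i i<n x≢0 (λ t → f (inner a (x 0) xor t))) (cong (∣ Bn ∣ *_) (xor-sumˡ f (inner a (x 0))))) ⟩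
  ∑ B (λ a → ∣ Bn ∣ * (f true + f false)) ≡⟨ ∑-const B _ ⟩
  ∣ B ∣ * (∣ Bn ∣ * (f true + f false)) ≡⟨ ∣vec-suc∣ B n _ ⟩
  ∣ vec B (suc n) ∣ * (f true + f false) ∎
  where open ≡-Reasoning
        B = vec bit b
        Bn = vec B n

hash : ∀ {b n s} → Vec (Vec (Word b) n) s → (ℕ → Word b) → Word s
hash H x = map (λ a → dot a x) H

xor-interchange : ∀ a b c d → (a xor b) xor (c xor d) ≡ (a xor c) xor (b xor d)
xor-interchange false false c d = refl
xor-interchange false true false d = refl
xor-interchange false true true false = refl
xor-interchange false true true true = refl
xor-interchange true false false d = refl
xor-interchange true false true false = refl
xor-interchange true false true true = refl
xor-interchange true true false false = refl
xor-interchange true true false true = refl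
xor-interchange true true true false = refl
xor-interchange true true true true = refl

inner-⊕ : ∀ {b} (a u v : Word b) → inner a (u ⊕ v) ≡ inner a u xor inner a v
inner-⊕ [] [] [] = refl
inner-⊕ (a ∷ as) (u ∷ us) (v ∷ vs) = trans (cong₂ _xor_ (∧-xor a u v) (inner-⊕ as us vs))
  (xor-interchange (a ∧ u) (a ∧ v) (inner as us) (inner as vs))
  where
  ∧-xor : ∀ a u v → a ∧ (u xor v) ≡ (a ∧ u) xor (a ∧ v)
  ∧-xor true u v = refl
  ∧-xor false u v = refl

dot-⊞ : ∀ {b n} (a : Vec (Word b) n) x y → dot a (x ⊞ y) ≡ dot a x xor dot a y
dot-⊞ [] x y = refl
dot-⊞ (a ∷ as) x y = trans (cong₂ _xor_ (inner-⊕ a (x 0) (y 0)) (dot-⊞ as (x ∘ suc) (y ∘ suc)))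
  (xor-interchange (inner a (x 0)) (inner a (y 0)) (dot as (x ∘ suc)) (dot as (y ∘ suc)))

hash-⊞ : ∀ {b n s} (H : Vec (Vec (Word b) n) s) x y → hash H (x ⊞ y) ≡ hash H x ⊕ hash H y
hash-⊞ [] x y = refl
hash-⊞ (a ∷ H) x y = cong₂ _∷_ (dot-⊞ a x y) (hash-⊞ H x y)

dot-cong : ∀ {b n} (a : Vec (Word b) n) {x y} → (∀ i → i < n → x i ≡ y i) → dot a x ≡ dot a y
dot-cong [] p = refl
dot-cong (a ∷ as) p = cong₂ _xor_ (cong (inner a) (p 0 z<s)) (dot-cong as λ i i<n → p (suc i) (s<s i<n))

hash-cong : ∀ {b n s} (H : Vec (Vec (Word b) n) s) {x y} → (∀ i → i < n → x i ≡ y i) → hash H x ≡ hash H y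
hash-cong [] p = refl
hash-cong (a ∷ H) p = cong₂ _∷_ (dot-cong a p) (hash-cong H p)

∣vec∣ : ∀ a n → ∣ vec a n ∣ ≡ ∣ a ∣ ^ n
∣vec∣ a n = trans (cong (2 ^_) (*-comm n (dim a))) (sym (^-*-assoc 2 (dim a) n))

*-^ : ∀ a b n → a ^ n * b ^ n ≡ (a * b) ^ n
*-^ a b zero = refl
*-^ a b (suc n) = trans (lemma a b (a ^ n) (b ^ n)) (cong (a * b *_) (*-^ a b n))
  where lemma : ∀ p q r s → p * r * (q * s) ≡ p * q * (r * s)
        lemma = solve-∀

-- By linearity a parity agrees on x and y exactly when it vanishes on their difference, a nonzero
-- string. The `s` independent parities each do so with probability 1/2.
∑-hash : ∀ {b n} s (x y : ℕ → Word b) i → i < n → x i ≢ y i →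
  2 ^ s * ∑ (vec (vec (vec bit b) n) s) (λ H → 𝟙 (hash H x ≟ʷ hash H y)) ≡ ∣ vec (vec (vec bit b) n) s ∣
∑-hash {b} {n} s x y i i<n x≢y = begin
  2 ^ s * ∑ (vec R s) (λ H → 𝟙 (hash H x ≟ʷ hash H y)) ≡⟨ cong (2 ^ s *_) (∑-cong (vec R s) prod) ⟩
  2 ^ s * ∑ (vec R s) (∏ᵛ f) ≡⟨ cong (2 ^ s *_) (∑-∏ᵛ R s f) ⟩
  2 ^ s * ∑ R f ^ s ≡⟨ *-^ 2 (∑ R f) s ⟩
  (2 * ∑ R f) ^ s ≡⟨ cong (_^ s) (trans (cong (2 *_) (∑-cong R λ a → trans (eq-xor (dot a x) (dot a y)) (cong 𝟙̂ (sym (dot-⊞ a x y)))))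
       (trans (dot-balanced n (x ⊞ y) i i<n (x≢y ∘ ⊕≡0⇒≡ (x i) (y i)) 𝟙̂) (*-identityʳ ∣ R ∣))) ⟩
  ∣ R ∣ ^ s ≡⟨ ∣vec∣ R s ⟨
  ∣ vec R s ∣ ∎
  where
  open ≡-Reasoning
  R = vec (vec bit b) n
  𝟙̂ : Bool → ℕ
  𝟙̂ t = if t then 0 else 1
  f : El R → ℕ
  f a = 𝟙 (dot a x ≟ᵇ dot a y)
  eq-xor : ∀ s t → 𝟙 (s ≟ᵇ t) ≡ 𝟙̂ (s xor t)
  eq-xor true true = refl
  eq-xor true false = refl
  eq-xor false true = refl
  eq-xor false false = refl
  prod : ∀ {s} (H : Vec (El R) s) → 𝟙 (hash H x ≟ʷ hash H y) ≡ ∏ᵛ f H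
  prod [] = refl
  prod (a ∷ H) = trans (𝟙-cong (hash (a ∷ H) x ≟ʷ hash (a ∷ H) y) ((dot a x ≟ᵇ dot a y) ×-dec (hash H x ≟ʷ hash H y))
      ∷-injective (uncurry (cong₂ _∷_)))
    (trans (𝟙-× (dot a x ≟ᵇ dot a y) (hash H x ≟ʷ hash H y)) (cong (f a *_) (prod H)))

at : ∀ {b n} → Vec (Word b) n → ℕ → Word b
at []       _       = 0ʷ
at (x ∷ xs) zero    = x
at (x ∷ xs) (suc i) = at xs i

-- Each of `θ` slots is left empty or names a position and a letter. The induction is Pascal's
-- recurrence on the first letter.
∑-sparse : ∀ b n θ → ∑ (vec (vec bit b) n) (λ z → 𝟙 (wt n (at z) ≤? θ)) ≤ (1 + n * ∣ vec bit b ∣) ^ θ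
∑-sparse b zero θ = ≤-trans (𝟙≤1 (0 ≤? θ)) (≤-reflexive (sym (^-zeroˡ θ)))
∑-sparse b (suc n) θ = begin
  ∑ B (λ a → ∑ (vec B n) λ z → 𝟙 (ne a 0ʷ + wt n (at z) ≤? θ)) ≤⟨ ∑-mono B split ⟩
  ∑ B (λ a → 𝟙 (a ≟ʷ 0ʷ) * N θ + N⁻ θ) ≡⟨ ∑-+ B _ _ ⟩
  ∑ B (λ a → 𝟙 (a ≟ʷ 0ʷ) * N θ) + ∑ B (λ a → N⁻ θ) ≡⟨ cong₂ _+_
     (trans (∑-*ʳ B (N θ) (λ a → 𝟙 (a ≟ʷ 0ʷ))) (trans (cong (_* N θ) (∑-≟ʷ {b} 0ʷ)) (*-identityˡ (N θ)))) (∑-const B (N⁻ θ)) ⟩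
  N θ + ∣ B ∣ * N⁻ θ ≤⟨ rest θ ⟩
  (1 + suc n * ∣ B ∣) ^ θ ∎
  where
  open ≤-Reasoning
  B = vec bit b
  N : ℕ → ℕ
  N θ = ∑ (vec B n) (λ z → 𝟙 (wt n (at z) ≤? θ))
  -- The count that remains once the first letter has used one unit of weight; with no unit to spend
  -- there are no such strings.
  N⁻ : ℕ → ℕ
  N⁻ zero = 0
  N⁻ (suc θ) = N θ
  split : ∀ a → ∑ (vec B n) (λ z → 𝟙 (ne a 0ʷ + wt n (at z) ≤? θ)) ≤ 𝟙 (a ≟ʷ 0ʷ) * N θ + N⁻ θ
  split a with a ≟ʷ 0ʷ
  ... | yes _ = ≤-trans (≤-reflexive (sym (+-identityʳ (N θ)))) (m≤m+n (N θ + 0) _)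
  ... | no _ = go θ
    where
    go : ∀ θ → ∑ (vec B n) (λ z → 𝟙 (suc (wt n (at z)) ≤? θ)) ≤ N⁻ θ
    go zero = ≤-reflexive (trans (∑-cong (vec B n) λ z → 𝟙-no (suc (wt n (at z)) ≤? 0) λ ())
                (trans (∑-const (vec B n) 0) (*-zeroʳ ∣ vec B n ∣)))
    go (suc θ) = ∑-mono (vec B n) λ z → 𝟙-mono (suc (wt n (at z)) ≤? suc θ) (wt n (at z) ≤? θ) s≤s⁻¹
  c = 1 + n * ∣ B ∣
  rest : ∀ θ → N θ + ∣ B ∣ * N⁻ θ ≤ (1 + suc n * ∣ B ∣) ^ θ
  rest zero = ≤-trans (≤-reflexive (trans (cong (N 0 +_) (*-zeroʳ ∣ B ∣)) (+-identityʳ (N 0)))) (∑-sparse b n 0)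
  rest (suc θ) = begin
    N (suc θ) + ∣ B ∣ * N θ ≤⟨ +-mono-≤ (∑-sparse b n (suc θ)) (*-monoʳ-≤ ∣ B ∣ (∑-sparse b n θ)) ⟩
    c * c ^ θ + ∣ B ∣ * c ^ θ ≡⟨ *-distribʳ-+ (c ^ θ) c ∣ B ∣ ⟨
    (c + ∣ B ∣) * c ^ θ ≡⟨ cong (_* c ^ θ) (lemma n ∣ B ∣) ⟩
    (1 + suc n * ∣ B ∣) * c ^ θ ≤⟨ *-monoʳ-≤ (1 + suc n * ∣ B ∣) (^-monoˡ-≤ θ (s≤s (m≤n+m (n * ∣ B ∣) ∣ B ∣))) ⟩
    (1 + suc n * ∣ B ∣) ^ suc θ ∎
    where lemma : ∀ n b → 1 + n * b + b ≡ 1 + (b + n * b)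
          lemma = solve-∀

-- A position survives when its `q` mask bits are all true, so with probability 2^-q. Blanking
-- instead of deleting keeps the length fixed.
masked : ∀ {b q n} → Vec (Word q) n → (ℕ → Word b) → Vec (Word b) n
masked []       x = []
masked (m ∷ ms) x = (if does (m ≟ʷ 1ʷ) then x 0 else 0ʷ) ∷ masked ms (x ∘ suc)

masked-cong : ∀ {b q n} (ms : Vec (Word q) n) {x y : ℕ → Word b} → (∀ i → x i ≡ y i) → masked ms x ≡ masked ms y
masked-cong [] p = refl
masked-cong (m ∷ ms) p = cong₂ _∷_ (cong (λ z → if does (m ≟ʷ 1ʷ) then z else 0ʷ) (p 0)) (masked-cong ms (p ∘ suc))

∑-≢1 : ∀ q → 1 + ∑ (vec bit q) (λ m → 𝟙 (¬? (m ≟ʷ 1ʷ))) ≡ ∣ vec bit q ∣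
∑-≢1 q = begin
  1 + ∑ B (λ m → 𝟙 (¬? (m ≟ʷ 1ʷ))) ≡⟨ cong (_+ ∑ B (λ m → 𝟙 (¬? (m ≟ʷ 1ʷ)))) (∑-≟ʷ {q} 1ʷ) ⟨
  ∑ B (λ m → 𝟙 (m ≟ʷ 1ʷ)) + ∑ B (λ m → 𝟙 (¬? (m ≟ʷ 1ʷ))) ≡⟨ ∑-+ B _ _ ⟨
  ∑ B (λ m → 𝟙 (m ≟ʷ 1ʷ) + 𝟙 (¬? (m ≟ʷ 1ʷ))) ≡⟨ ∑-cong B (λ m → 𝟙-¬ (m ≟ʷ 1ʷ)) ⟩
  ∑ B (λ m → 1) ≡⟨ ∑-const B 1 ⟩
  ∣ B ∣ * 1 ≡⟨ *-identityʳ ∣ B ∣ ⟩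
  ∣ B ∣ ∎
  where
  open ≡-Reasoning
  B = vec bit q
  𝟙-¬ : ∀ {P : Set} (p? : Dec P) → 𝟙 p? + 𝟙 (¬? p?) ≡ 1
  𝟙-¬ (yes _) = refl
  𝟙-¬ (no _) = refl

-- Restrictions agree exactly when no differing position is kept; each differing position
-- contributes a factor 1 - 1/Q, where Q = 2^q.
∑-masked : ∀ {b} q n (x y : ℕ → Word b) →
  ∣ vec bit q ∣ ^ dist n x y * ∑ (vec (vec bit q) n) (λ ms → 𝟙 (masked ms x ≟ᵛ masked ms y)) ≡
  pred ∣ vec bit q ∣ ^ dist n x y * ∣ vec (vec bit q) n ∣
∑-masked q zero x y = refl
∑-masked {b} q (suc n) x y = begin
  Q ^ dist (suc n) x y * ∑ B (λ m → ∑ Bn λ ms → 𝟙 (masked (m ∷ ms) x ≟ᵛ masked (m ∷ ms) y))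
    ≡⟨ cong (Q ^ dist (suc n) x y *_) (∑-cong B λ m → ∑-cong Bn λ ms → factor m ms) ⟩
  Q ^ dist (suc n) x y * ∑ B (λ m → ∑ Bn λ ms → head m * tail ms)
    ≡⟨ cong (Q ^ dist (suc n) x y *_) (trans (∑-cong B λ m → ∑-*ˡ Bn (head m) tail) (∑-*ʳ B (∑ Bn tail) head)) ⟩
  Q ^ dist (suc n) x y * (∑ B head * ∑ Bn tail) ≡⟨ bycase ⟩
  pred Q ^ dist (suc n) x y * (Q * ∣ Bn ∣) ≡⟨ cong (pred Q ^ dist (suc n) x y *_) (^-distribˡ-+-* 2 (dim B) (n * dim B)) ⟨
  pred Q ^ dist (suc n) x y * ∣ vec B (suc n) ∣ ∎
  where
  open ≡-Reasoning
  B = vec bit q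
  Bn = vec B n
  Q = ∣ B ∣
  sel : Word q → Word b → Word b
  sel m z = if does (m ≟ʷ 1ʷ) then z else 0ʷ
  head : Word q → ℕ
  head m = 𝟙 (sel m (x 0) ≟ʷ sel m (y 0))
  tail : Vec (Word q) n → ℕ
  tail ms = 𝟙 (masked ms (x ∘ suc) ≟ᵛ masked ms (y ∘ suc))
  factor : ∀ m ms → 𝟙 (masked (m ∷ ms) x ≟ᵛ masked (m ∷ ms) y) ≡ head m * tail ms
  factor m ms = trans
    (𝟙-cong (masked (m ∷ ms) x ≟ᵛ masked (m ∷ ms) y)
       ((sel m (x 0) ≟ʷ sel m (y 0)) ×-dec (masked ms (x ∘ suc) ≟ᵛ masked ms (y ∘ suc))) ∷-injective (uncurry (cong₂ _∷_)))
    (𝟙-× (sel m (x 0) ≟ʷ sel m (y 0)) (masked ms (x ∘ suc) ≟ᵛ masked ms (y ∘ suc)))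
  D = dist n (x ∘ suc) (y ∘ suc)
  ih = ∑-masked q n (x ∘ suc) (y ∘ suc)
  lemma₁ : ∀ p q r → p * (q * r) ≡ q * (p * r)
  lemma₁ = solve-∀
  lemma₂ : ∀ p q r s → q * p * (r * s) ≡ r * (q * (p * s))
  lemma₂ = solve-∀
  lemma₃ : ∀ p q r s → r * (q * (p * s)) ≡ r * p * (q * s)
  lemma₃ = solve-∀
  bycase : Q ^ dist (suc n) x y * (∑ B head * ∑ Bn tail) ≡ pred Q ^ dist (suc n) x y * (Q * ∣ Bn ∣)
  bycase with x 0 ≟ʷ y 0
  ... | yes x≡y = begin
    Q ^ D * (∑ B head * ∑ Bn tail) ≡⟨ cong (λ z → Q ^ D * (z * ∑ Bn tail))
      (trans (∑-cong B λ m → 𝟙-yes (sel m (x 0) ≟ʷ sel m (y 0)) (cong (sel m) x≡y)) (trans (∑-const B 1) (*-identityʳ Q))) ⟩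
    Q ^ D * (Q * ∑ Bn tail) ≡⟨ lemma₁ (Q ^ D) Q _ ⟩
    Q * (Q ^ D * ∑ Bn tail) ≡⟨ cong (Q *_) ih ⟩
    Q * (pred Q ^ D * ∣ Bn ∣) ≡⟨ lemma₁ Q (pred Q ^ D) ∣ Bn ∣ ⟩
    pred Q ^ D * (Q * ∣ Bn ∣) ∎
  ... | no x≢y = begin
    Q * Q ^ D * (∑ B head * ∑ Bn tail) ≡⟨ cong (λ z → Q * Q ^ D * (z * ∑ Bn tail)) heads ⟩
    Q * Q ^ D * (pred Q * ∑ Bn tail) ≡⟨ lemma₂ (Q ^ D) Q (pred Q) (∑ Bn tail) ⟩
    pred Q * (Q * (Q ^ D * ∑ Bn tail)) ≡⟨ cong (λ z → pred Q * (Q * z)) ih ⟩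
    pred Q * (Q * (pred Q ^ D * ∣ Bn ∣)) ≡⟨ lemma₃ (pred Q ^ D) Q (pred Q) ∣ Bn ∣ ⟩
    pred Q * pred Q ^ D * (Q * ∣ Bn ∣) ∎
    where
    head-¬ : ∀ m → head m ≡ 𝟙 (¬? (m ≟ʷ 1ʷ))
    head-¬ m with m ≟ʷ 1ʷ
    ... | yes _ = 𝟙-no (x 0 ≟ʷ y 0) x≢y
    ... | no _  = 𝟙-yes (0ʷ {b} ≟ʷ 0ʷ) refl
    heads : ∑ B head ≡ pred Q
    heads = trans (∑-cong B head-¬) (cong pred (∑-≢1 q))

-- With q = `suc p` this is Bernoulli's inequality (1 - 1/q)^d ≥ 1 - d/q, multiplied out.
bernoulli-≤ : ∀ p d → suc p * suc p ^ d ≤ suc p * p ^ d + d * suc p ^ d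
bernoulli-≤ p zero = m≤m+n _ 0
bernoulli-≤ p (suc d) = begin
  q * (q * q ^ d) ≤⟨ *-monoʳ-≤ q (bernoulli-≤ p d) ⟩
  q * (q * p ^ d + d * q ^ d) ≡⟨ lemma p d (p ^ d) (q ^ d) ⟩
  q * (p * p ^ d) + q * p ^ d + d * (q * q ^ d) ≤⟨ +-monoˡ-≤ _ (+-monoʳ-≤ (q * (p * p ^ d)) (*-monoʳ-≤ q (^-monoˡ-≤ d (n≤1+n p)))) ⟩
  q * (p * p ^ d) + q * q ^ d + d * (q * q ^ d) ≡⟨ +-assoc (q * (p * p ^ d)) _ _ ⟩
  q * (p * p ^ d) + suc d * (q * q ^ d) ∎
  where
  open ≤-Reasoning
  q = suc p
  lemma : ∀ p d r s → suc p * (suc p * r + d * s) ≡ suc p * (p * r) + suc p * r + d * (suc p * s)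
  lemma = solve-∀

-- The two leading terms of the binomial expansion.
bernoulli-≥ : ∀ p m → p ^ suc m + suc m * p ^ m ≤ suc p ^ suc m
bernoulli-≥ p zero = ≤-reflexive (lemma p)
  where lemma : ∀ p → p * 1 + 1 ≡ suc p * 1
        lemma = solve-∀
bernoulli-≥ p (suc m) = begin
  p * (p * p ^ m) + (2 + m) * (p * p ^ m) ≤⟨ m≤m+n _ (suc m * p ^ m) ⟩
  p * (p * p ^ m) + (2 + m) * (p * p ^ m) + suc m * p ^ m ≡⟨ lemma p m (p ^ m) ⟩
  suc p * (p * p ^ m + suc m * p ^ m) ≤⟨ *-monoʳ-≤ (suc p) (bernoulli-≥ p m) ⟩
  suc p * suc p ^ suc m ∎
  where
  open ≤-Reasoning
  lemma : ∀ p m r → p * (p * r) + (2 + m) * (p * r) + suc m * r ≡ suc p * (p * r + suc m * r)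
  lemma = solve-∀

-- That is, (1 - 1/q)^q ≤ 1/2 for q = `suc p`. It is used for masks (q = Q) and for repeated trials
-- (q = 64).
halving : ∀ p → 2 * p ^ suc p ≤ suc p ^ suc p
halving p = ≤-trans (≤-trans (≤-reflexive (cong (p ^ suc p +_) (+-identityʳ _)))
  (+-monoʳ-≤ (p ^ suc p) (*-monoˡ-≤ (p ^ p) (n≤1+n p)))) (bernoulli-≥ p p)

halving^ : ∀ p w d → suc p * w ≤ d → 2 ^ w * p ^ d ≤ suc p ^ d
halving^ p w d le with m≤n⇒∃[o]m+o≡n le
... | o , refl = begin
  2 ^ w * p ^ (suc p * w + o) ≡⟨ cong (2 ^ w *_) (^-distribˡ-+-* p (suc p * w) o) ⟩
  2 ^ w * (p ^ (suc p * w) * p ^ o) ≡⟨ *-assoc (2 ^ w) _ _ ⟨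
  2 ^ w * p ^ (suc p * w) * p ^ o ≡⟨ cong (λ z → 2 ^ w * z * p ^ o) (^-*-assoc p (suc p) w) ⟨
  2 ^ w * (p ^ suc p) ^ w * p ^ o ≡⟨ cong (_* p ^ o) (*-^ 2 (p ^ suc p) w) ⟩
  (2 * p ^ suc p) ^ w * p ^ o ≤⟨ *-mono-≤ (^-monoˡ-≤ w (halving p)) (^-monoˡ-≤ o (n≤1+n p)) ⟩
  (suc p ^ suc p) ^ w * suc p ^ o ≡⟨ cong (_* suc p ^ o) (^-*-assoc (suc p) (suc p) w) ⟩
  suc p ^ (suc p * w) * suc p ^ o ≡⟨ ^-distribˡ-+-* (suc p) (suc p * w) o ⟨
  suc p ^ (suc p * w + o) ∎
  where open ≤-Reasoning

-- Close strings keep equal restrictions with probability at least 1 - k/Q; taking Q ≥ 4k makes this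
-- 3/4.
masked-agree : ∀ {b} q n k (x y : ℕ → Word b) → dist n x y ≤ k →
  ∣ vec bit q ∣ * ∣ vec (vec bit q) n ∣ ≤
  ∣ vec bit q ∣ * ∑ (vec (vec bit q) n) (λ ms → 𝟙 (masked ms x ≟ᵛ masked ms y)) + k * ∣ vec (vec bit q) n ∣
masked-agree q n k x y D≤k with ∣ vec bit q ∣ | ∑-masked q n x y | m^n>0 2 (dim (vec bit q))
... | suc p | eq | _ = *-cancelˡ-≤ (suc p ^ D) {{m^n≢0 (suc p) D}} (begin
  suc p ^ D * (suc p * Ω) ≡⟨ lemma₁ (suc p) (suc p ^ D) Ω ⟩
  suc p * suc p ^ D * Ω ≤⟨ *-monoˡ-≤ Ω (bernoulli-≤ p D) ⟩
  (suc p * p ^ D + D * suc p ^ D) * Ω ≡⟨ lemma₂ (suc p) (p ^ D) D (suc p ^ D) Ω ⟩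
  suc p * (p ^ D * Ω) + suc p ^ D * (D * Ω) ≡⟨ cong (λ z → suc p * z + suc p ^ D * (D * Ω)) eq ⟨
  suc p * (suc p ^ D * S) + suc p ^ D * (D * Ω) ≤⟨ +-monoʳ-≤ _ (*-monoʳ-≤ (suc p ^ D) (*-monoˡ-≤ Ω D≤k)) ⟩
  suc p * (suc p ^ D * S) + suc p ^ D * (k * Ω) ≡⟨ lemma₃ (suc p) (suc p ^ D) S (k * Ω) ⟩
  suc p ^ D * (suc p * S + k * Ω) ∎)
  where
  open ≤-Reasoning
  D = dist n x y
  Ω = ∣ vec (vec bit q) n ∣
  S = ∑ (vec (vec bit q) n) (λ ms → 𝟙 (masked ms x ≟ᵛ masked ms y))
  lemma₁ : ∀ p q r → q * (p * r) ≡ p * q * r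
  lemma₁ = solve-∀
  lemma₂ : ∀ p q d r o → (p * q + d * r) * o ≡ p * (q * o) + r * (d * o)
  lemma₂ = solve-∀
  lemma₃ : ∀ p q s t → p * (q * s) + q * t ≡ q * (p * s + t)
  lemma₃ = solve-∀

-- Every Q differing positions halve the probability of agreement, whence the distance threshold Q *
-- w.
masked-differ : ∀ {b} q n w (x y : ℕ → Word b) → ∣ vec bit q ∣ * w ≤ dist n x y →
  2 ^ w * ∑ (vec (vec bit q) n) (λ ms → 𝟙 (masked ms x ≟ᵛ masked ms y)) ≤ ∣ vec (vec bit q) n ∣
masked-differ q n w x y le with ∣ vec bit q ∣ | ∑-masked q n x y | m^n>0 2 (dim (vec bit q)) | le
... | suc p | eq | _ | le′ = *-cancelˡ-≤ (suc p ^ D) {{m^n≢0 (suc p) D}} (begin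
  suc p ^ D * (2 ^ w * S) ≡⟨ lemma (suc p ^ D) (2 ^ w) S ⟩
  2 ^ w * (suc p ^ D * S) ≡⟨ cong (2 ^ w *_) eq ⟩
  2 ^ w * (p ^ D * Ω) ≡⟨ *-assoc (2 ^ w) (p ^ D) Ω ⟨
  2 ^ w * p ^ D * Ω ≤⟨ *-monoˡ-≤ Ω (halving^ p w D le′) ⟩
  suc p ^ D * Ω ∎)
  where
  open ≤-Reasoning
  D = dist n x y
  Ω = ∣ vec (vec bit q) n ∣
  S = ∑ (vec (vec bit q) n) (λ ms → 𝟙 (masked ms x ≟ᵛ masked ms y))
  lemma : ∀ p q r → p * (q * r) ≡ q * (p * r)
  lemma = solve-∀

-- Correlated sampling of a rotation

sh : ∀ {A : Set} → ℕ → (ℕ → A) → ℕ → A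
sh r x i = x (r + i)

Periodic : ∀ {A : Set} → ℕ → (ℕ → A) → Set
Periodic n x = ∀ i → x (n + i) ≡ x i

find : ∀ (n : ℕ) {P : ℕ → Set} → (∀ r → Dec (P r)) → ℕ
find zero    P? = 0
find (suc n) P? = if does (P? 0) then 0 else suc (find n (P? ∘ suc))

find-spec : ∀ n {P : ℕ → Set} (P? : ∀ r → Dec (P r)) r → r < n → P r → P (find n P?) × find n P? < n
find-spec (suc n) P? r r<n pr with P? 0
... | yes p0 = p0 , z<s
find-spec (suc n) P? zero r<n pr | no ¬p0 = contradiction pr ¬p0
find-spec (suc n) P? (suc r) (s<s r<n) pr | no ¬p0 with find-spec n (P? ∘ suc) r r<n pr
... | pf , lt = pf , s<s lt

encBool : Bool → Fin 2
encBool false = zero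
encBool true  = suc zero

encBool-injective : ∀ s t → encBool s ≡ encBool t → s ≡ t
encBool-injective false false _ = refl
encBool-injective true  true  _ = refl

encVec : ∀ {A : Set} {M n} → (A → Fin M) → Vec A n → Fin (M ^ n)
encVec e []       = zero
encVec e (x ∷ xs) = combine (e x) (encVec e xs)

encVec-injective : ∀ {A : Set} {M n} (e : A → Fin M) → (∀ s t → e s ≡ e t → s ≡ t) →
                   ∀ (u v : Vec A n) → encVec e u ≡ encVec e v → u ≡ v
encVec-injective e inj [] [] _ = refl
encVec-injective e inj (x ∷ u) (y ∷ v) eq with combine-injective (e x) (encVec e u) (e y) (encVec e v) eq
... | p , q = cong₂ _∷_ (inj x y p) (encVec-injective e inj u v q)

-- The number of pairs of a name and a rank. The random function is a table of this exponential
-- length, paid for in seed bits only.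
Items : ℕ → ℕ → ℕ
Items b n = ((2 ^ b) ^ n) * n

-- Reduction modulo `n` makes the code total; it loses nothing for ranks, which stay below `n`.
item : ∀ {b n} .{{_ : NonZero n}} → Vec (Word b) n → ℕ → Fin (Items b n)
item {n = n} w j = combine (encVec (encVec encBool) w) (j mod n)

item-injective : ∀ {b n} .{{_ : NonZero n}} (w w′ : Vec (Word b) n) j j′ → j < n → j′ < n →
                 item w j ≡ item w′ j′ → w ≡ w′ × j ≡ j′
item-injective {n = n} w w′ j j′ j<n j′<n eq
  with combine-injective (encVec (encVec encBool) w) (j mod n) (encVec (encVec encBool) w′) (j′ mod n) eq
... | p , q = encVec-injective (encVec encBool) (encVec-injective encBool encBool-injective) w w′ p
            , trans (sym (m<n⇒m%n≡m j<n)) (trans (sym (toℕ-fromℕ< (m%n<n j n)))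
                (trans (cong toℕ q) (trans (toℕ-fromℕ< (m%n<n j′ n)) (m<n⇒m%n≡m j′<n))))

module _ {b n : ℕ} .{{_ : NonZero n}} where

  Names : Set
  Names = ℕ → Vec (Word b) n

  -- Pairing a name with its rank among equal names gives each name its multiplicity as a weight,
  -- so that two families agreeing at most positions share most of their items.
  rank : Names → ℕ → ℕ
  rank w r = ∑< r λ r′ → 𝟙 (w r′ ≟ᵛ w r)

  rank≤ : ∀ w r → rank w r ≤ r
  rank≤ w r = ≤-trans (∑<-bound r λ i _ → 𝟙≤1 (w i ≟ᵛ w r)) (≤-reflexive (*-identityʳ r))

  itemAt : Names → ℕ → Fin (Items b n)
  itemAt w r = item (w r) (rank w r)

  -- The items of w are exactly the pairs (c , j) with j below the multiplicity of c in w.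
  select : ∀ (w : Names) c m j → j < ∑< m (λ r → 𝟙 (w r ≟ᵛ c)) → ∃ λ r → r < m × w r ≡ c × rank w r ≡ j
  select w c (suc m) j j< with j <? ∑< m (λ r → 𝟙 (w r ≟ᵛ c))
  ... | yes lt with select w c m j lt
  ...   | r , r<m , p = r , m<n⇒m<1+n r<m , p
  select w c (suc m) j j< | no ≥ with w m ≟ᵛ c | subst (j <_) (∑<-last m (λ r → 𝟙 (w r ≟ᵛ c))) j<
  ... | no _ | lt = contradiction (subst (j <_) (+-identityʳ _) lt) ≥
  ... | yes refl | lt = m , ≤-refl , refl ,
        ≤-antisym (≮⇒≥ ≥) (s≤s⁻¹ (subst (j <_) (+-comm _ 1) lt))

  module _ {ℓ : ℕ} (g : Vec (Word ℓ) (Items b n)) where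

    Fires : Fin (Items b n) → Set
    Fires i = lookup g i ≡ 1ʷ

    fires? : ∀ i → Dec (Fires i)
    fires? i = lookup g i ≟ʷ 1ʷ

    -- Defaults to 0 when no item fires.
    choose : Names → ℕ
    choose w = find n (λ r → fires? (itemAt w r)) % n

    choose-spec : ∀ w r → r < n → Fires (itemAt w r) → Fires (itemAt w (choose w)) × choose w < n
    choose-spec w r r<n fr with find-spec n (λ r → fires? (itemAt w r)) r r<n fr
    ... | ff , lt rewrite m<n⇒m%n≡m lt = ff , lt

    choose< : ∀ w → choose w < n
    choose< w = m%n<n _ n

  module _ (w₁ w₂ : Names) (per₂ : Periodic n w₂) (m : ℕ) where

    good? : ∀ r → Dec (w₁ r ≡ w₂ (m + r))
    good? r = w₁ r ≟ᵛ w₂ (m + r)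

    -- Ranks among good positions only. A name with g good positions occurs at least g times in both
    -- families, so its pairs with ranks below g are items of both. Distinct good positions thus
    -- receive distinct common items: a matching inside the multiset intersection.
    goodRank : ℕ → ℕ
    goodRank r = ∑< r λ r′ → 𝟙 (good? r′ ×-dec (w₁ r′ ≟ᵛ w₁ r))

    common : ℕ → Fin (Items b n)
    common r = item (w₁ r) (goodRank r)

    goodRank< : ∀ {r s} → r < s → w₁ r ≡ w₂ (m + r) → w₁ r ≡ w₁ s → goodRank r < goodRank s
    goodRank< {r} {s} r<s good eq = begin
      1 + goodRank r ≡⟨ +-comm 1 _ ⟩
      goodRank r + 1 ≡⟨ cong (goodRank r +_) (𝟙-yes (good? r ×-dec (w₁ r ≟ᵛ w₁ r)) (good , refl)) ⟨
      goodRank r + 𝟙 (good? r ×-dec (w₁ r ≟ᵛ w₁ r)) ≡⟨ ∑<-last r _ ⟨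
      ∑< (suc r) (λ r′ → 𝟙 (good? r′ ×-dec (w₁ r′ ≟ᵛ w₁ r))) ≤⟨ ∑<-monoˡ _ r<s ⟩
      ∑< s (λ r′ → 𝟙 (good? r′ ×-dec (w₁ r′ ≟ᵛ w₁ r))) ≡⟨ cong (λ c → ∑< s (λ r′ → 𝟙 (good? r′ ×-dec (w₁ r′ ≟ᵛ c)))) eq ⟩
      goodRank s ∎
      where open ≤-Reasoning

    goodRank≤ : ∀ r → goodRank r ≤ r
    goodRank≤ r = ≤-trans (∑<-bound r λ i _ → 𝟙≤1 (good? i ×-dec (w₁ i ≟ᵛ w₁ r))) (≤-reflexive (*-identityʳ r))

    common-injective : ∀ {r s} → r < n → s < n → w₁ r ≡ w₂ (m + r) → w₁ s ≡ w₂ (m + s) → common r ≡ common s → r ≡ s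
    common-injective {r} {s} r<n s<n gr gs eq
      with item-injective (w₁ r) (w₁ s) _ _ (≤-<-trans (goodRank≤ r) r<n) (≤-<-trans (goodRank≤ s) s<n) eq | <-cmp r s
    ... | w≡ , k≡ | tri< r<s _ _ = contradiction (goodRank< r<s gr w≡) (<-irrefl k≡)
    ... | w≡ , k≡ | tri≈ _ r≡s _ = r≡s
    ... | w≡ , k≡ | tri> _ _ s<r = contradiction (goodRank< s<r gs (sym w≡)) (<-irrefl (sym k≡))

    multiplicity : ∀ {r} → r < n → w₁ r ≡ w₂ (m + r) →
                   goodRank r < ∑< n (λ r′ → 𝟙 (good? r′ ×-dec (w₁ r′ ≟ᵛ w₁ r)))
    multiplicity {r} r<n gr = begin
      1 + goodRank r ≡⟨ +-comm 1 _ ⟩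
      goodRank r + 1 ≡⟨ cong (goodRank r +_) (𝟙-yes (good? r ×-dec (w₁ r ≟ᵛ w₁ r)) (gr , refl)) ⟨
      goodRank r + 𝟙 (good? r ×-dec (w₁ r ≟ᵛ w₁ r)) ≡⟨ ∑<-last r _ ⟨
      ∑< (suc r) (λ r′ → 𝟙 (good? r′ ×-dec (w₁ r′ ≟ᵛ w₁ r))) ≤⟨ ∑<-monoˡ _ r<n ⟩
      ∑< n (λ r′ → 𝟙 (good? r′ ×-dec (w₁ r′ ≟ᵛ w₁ r))) ∎
      where open ≤-Reasoning

    common∈₁ : ∀ {r} → r < n → w₁ r ≡ w₂ (m + r) → ∃ λ r′ → r′ < n × w₁ r′ ≡ w₁ r × common r ≡ itemAt w₁ r′
    common∈₁ {r} r<n gr with select w₁ (w₁ r) n (goodRank r) (<-≤-trans (multiplicity r<n gr)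
        (∑<-mono n λ r′ _ → 𝟙-mono (good? r′ ×-dec (w₁ r′ ≟ᵛ w₁ r)) (w₁ r′ ≟ᵛ w₁ r) proj₂))
    ... | r′ , r′<n , w≡ , k≡ = r′ , r′<n , w≡ , cong₂ item (sym w≡) (sym k≡)

    -- Good positions are matched with positions of `w₂` shifted by `m`; periodicity of `w₂` leaves
    -- multiplicities unchanged under this shift.
    common∈₂ : ∀ {r} → r < n → w₁ r ≡ w₂ (m + r) → ∃ λ r′ → r′ < n × w₂ r′ ≡ w₁ r × common r ≡ itemAt w₂ r′
    common∈₂ {r} r<n gr with select w₂ (w₁ r) n (goodRank r) (<-≤-trans (multiplicity r<n gr)
        (≤-trans (∑<-mono n λ r′ _ → 𝟙-mono (good? r′ ×-dec (w₁ r′ ≟ᵛ w₁ r)) (w₂ (m + r′) ≟ᵛ w₁ r) (λ (p , q) → trans (sym p) q))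
        (≤-reflexive (∑<-rotate n (λ r′ → 𝟙 (w₂ r′ ≟ᵛ w₁ r)) (λ i → cong (λ c → 𝟙 (c ≟ᵛ w₁ r)) (per₂ i)) m))))
    ... | r′ , r′<n , w≡ , k≡ = r′ , r′<n , w≡ , cong₂ item (sym w≡) (sym k≡)

    module _ {ℓ : ℕ} where

      -- The bad event for `choose`: a second item fires along with the common one and might be
      -- found first.
      clash : Vec (Word ℓ) (Items b n) → ℕ → Fin (Items b n) → ℕ
      clash g r y = 𝟙 (¬? (common r ≟ᶠ y)) * (𝟙 (fires? g (common r)) * 𝟙 (fires? g y))

      clashes : Vec (Word ℓ) (Items b n) → ℕ → ℕ
      clashes g r = ∑< n λ r′ → clash g r (itemAt w₁ r′) + clash g r (itemAt w₂ r′)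

      no-clash : ∀ g {r y} → Fires g (common r) → Fires g y → clash g r y ≡ 0 → common r ≡ y
      no-clash g {r} {y} fr fy eq with common r ≟ᶠ y
      ... | yes p = p
      ... | no _ with lookup g (common r) ≟ʷ 1ʷ | lookup g y ≟ʷ 1ʷ
      ...   | no ¬fr | _ = contradiction fr ¬fr
      ...   | yes _ | no ¬fy = contradiction fy ¬fy
      no-clash g fr fy () | no _ | yes _ | yes _

      -- If a common item fires and no other item of w₁ or w₂ does, both parties choose it.
      choose-agree : ∀ g → ∑< n (λ r → 𝟙 (good? r) * 𝟙 (fires? g (common r))) ≤
                     𝟙 (w₁ (choose g w₁) ≟ᵛ w₂ (choose g w₂)) + ∑< n (λ r → 𝟙 (good? r) * clashes g r)
      choose-agree g = begin
        ∑< n (λ r → 𝟙 (good? r) * 𝟙 (fires? g (common r))) ≤⟨ ∑<-mono n split ⟩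
        ∑< n (λ r → E r + 𝟙 (good? r) * clashes g r) ≡⟨ ∑<-+ n E _ ⟩
        ∑< n E + ∑< n (λ r → 𝟙 (good? r) * clashes g r) ≤⟨ +-monoˡ-≤ _ (∑<-unique n E _ (λ r _ → 𝟙≤1 (E? r)) agree unique) ⟩
        𝟙 (w₁ (choose g w₁) ≟ᵛ w₂ (choose g w₂)) + ∑< n (λ r → 𝟙 (good? r) * clashes g r) ∎
        where
        open ≤-Reasoning
        E? : ∀ r → Dec (w₁ r ≡ w₂ (m + r) × Fires g (common r) × clashes g r ≡ 0)
        E? r = good? r ×-dec (fires? g (common r) ×-dec (clashes g r ≟ 0))
        E : ℕ → ℕ
        E r = 𝟙 (E? r)
        -- A firing common item either has no clash or is paid for by its number of clashes.
        split : ∀ r → r < n → 𝟙 (good? r) * 𝟙 (fires? g (common r)) ≤ E r + 𝟙 (good? r) * clashes g r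
        split r _ = generic (good? r) (fires? g (common r)) (clashes g r)
          where
          generic : ∀ {S T : Set} (s? : Dec S) (t? : Dec T) c →
                    𝟙 s? * 𝟙 t? ≤ 𝟙 (s? ×-dec (t? ×-dec (c ≟ 0))) + 𝟙 s? * c
          generic (no _)  _       _       = z≤n
          generic (yes _) (no _)  _       = z≤n
          generic (yes _) (yes _) zero    = ≤-refl
          generic (yes _) (yes _) (suc _) = s≤s z≤n
        silent : ∀ r r′ → clashes g r ≡ 0 → r′ < n → clash g r (itemAt w₁ r′) ≡ 0 × clash g r (itemAt w₂ r′) ≡ 0
        silent r r′ c≡0 r′<n = m+n≡0⇒m≡0 _ sum≡0 , m+n≡0⇒n≡0 (clash g r (itemAt w₁ r′)) sum≡0
          where
          sum≡0 : clash g r (itemAt w₁ r′) + clash g r (itemAt w₂ r′) ≡ 0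
          sum≡0 = n≤0⇒n≡0 (subst (clash g r (itemAt w₁ r′) + clash g r (itemAt w₂ r′) ≤_) c≡0 (≤∑< n _ r′ r′<n))
        -- Some item fires, so the chosen one does, and the absence of clashes makes it the common
        -- item. The chosen rotation may differ from `r`, but its name is the same.
        chosen₁ : ∀ r → r < n → w₁ r ≡ w₂ (m + r) → Fires g (common r) → clashes g r ≡ 0 → w₁ (choose g w₁) ≡ w₁ r
        chosen₁ r r<n gr fr c≡0 with common∈₁ r<n gr
        ... | r′ , r′<n , _ , eq with choose-spec g w₁ r′ r′<n (subst (Fires g) eq fr)
        ...   | fc , c<n = sym (proj₁ (item-injective (w₁ r) (w₁ (choose g w₁)) _ _
                  (≤-<-trans (goodRank≤ r) r<n) (≤-<-trans (rank≤ w₁ _) c<n)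
                  (no-clash g fr fc (proj₁ (silent r _ c≡0 c<n)))))
        chosen₂ : ∀ r → r < n → w₁ r ≡ w₂ (m + r) → Fires g (common r) → clashes g r ≡ 0 → w₂ (choose g w₂) ≡ w₁ r
        chosen₂ r r<n gr fr c≡0 with common∈₂ r<n gr
        ... | r′ , r′<n , _ , eq with choose-spec g w₂ r′ r′<n (subst (Fires g) eq fr)
        ...   | fc , c<n = sym (proj₁ (item-injective (w₁ r) (w₂ (choose g w₂)) _ _
                  (≤-<-trans (goodRank≤ r) r<n) (≤-<-trans (rank≤ w₂ _) c<n)
                  (no-clash g fr fc (proj₂ (silent r _ c≡0 c<n)))))
        agree : ∀ r → r < n → 1 ≤ E r → 1 ≤ 𝟙 (w₁ (choose g w₁) ≟ᵛ w₂ (choose g w₂))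
        agree r r<n e with 𝟙⁻ (E? r) e
        ... | gr , fr , c≡0 = ≤-reflexive (sym (𝟙-yes (w₁ (choose g w₁) ≟ᵛ w₂ (choose g w₂))
              (trans (chosen₁ r r<n gr fr c≡0) (sym (chosen₂ r r<n gr fr c≡0)))))
        -- Two such positions would make the common item of `s`, which is also an item of `w₁`,
        -- clash with that of `r`.
        unique : ∀ r s → r < n → s < n → 1 ≤ E r → 1 ≤ E s → r ≡ s
        unique r s r<n s<n er es with 𝟙⁻ (E? r) er | 𝟙⁻ (E? s) es
        ... | gr , fr , c≡0 | gs , fs , _ with common∈₁ s<n gs
        ...   | s′ , s′<n , _ , eq = common-injective r<n s<n gr gs
                (trans (no-clash g fr (subst (Fires g) eq fs) (proj₁ (silent r s′ c≡0 s′<n))) (sym eq))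

      private
        P = ∣ vec bit ℓ ∣
        Ωg = vec (vec bit ℓ) (Items b n)
        G = ∣ Ωg ∣

      ∑-fires : ∀ i → P * ∑ Ωg (λ g → 𝟙 (fires? g i)) ≡ G
      ∑-fires i = trans (∑-lookup (vec bit ℓ) i (λ v → 𝟙 (v ≟ʷ 1ʷ)))
        (trans (cong (G *_) (∑-≟ʷ {ℓ} 1ʷ)) (*-identityʳ G))

      ∑-clash : ∀ r y → P * P * ∑ Ωg (λ g → clash g r y) ≤ G
      ∑-clash r y with common r ≟ᶠ y
      ... | yes _ = ≤-trans (≤-reflexive (trans (cong (P * P *_) (trans (∑-const Ωg 0) (*-zeroʳ G))) (*-zeroʳ (P * P)))) z≤n
      ... | no c≢y = ≤-reflexive (begin
        P * P * ∑ Ωg (λ g → 𝟙 (fires? g (common r)) * 𝟙 (fires? g y) + 0) ≡⟨ cong (P * P *_) (∑-cong Ωg λ g → +-identityʳ (𝟙 (fires? g (common r)) * 𝟙 (fires? g y))) ⟩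
        P * P * ∑ Ωg (λ g → 𝟙 (fires? g (common r)) * 𝟙 (fires? g y)) ≡⟨ ∑-lookup₂ (vec bit ℓ) (common r) y c≢y (λ u v → 𝟙 (u ≟ʷ 1ʷ) * 𝟙 (v ≟ʷ 1ʷ)) ⟩
        G * ∑ (vec bit ℓ) (λ u → ∑ (vec bit ℓ) λ v → 𝟙 (u ≟ʷ 1ʷ) * 𝟙 (v ≟ʷ 1ʷ))
          ≡⟨ cong (G *_) (∑-cong (vec bit ℓ) λ u → trans (∑-*ˡ (vec bit ℓ) (𝟙 (u ≟ʷ 1ʷ)) (λ v → 𝟙 (v ≟ʷ 1ʷ))) (trans (cong (𝟙 (u ≟ʷ 1ʷ) *_) (∑-≟ʷ {ℓ} 1ʷ)) (*-identityʳ _))) ⟩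
        G * ∑ (vec bit ℓ) (λ u → 𝟙 (u ≟ʷ 1ʷ)) ≡⟨ cong (G *_) (∑-≟ʷ {ℓ} 1ʷ) ⟩
        G * 1 ≡⟨ *-identityʳ G ⟩
        G ∎)
        where open ≡-Reasoning

      -- Union bound over the 2n items of both families, each clashing with probability at most
      -- 1/P².
      ∑-clashes : ∀ r → P * P * ∑ Ωg (λ g → clashes g r) ≤ n * (2 * G)
      ∑-clashes r = begin
        P * P * ∑ Ωg (λ g → clashes g r) ≡⟨ cong (P * P *_) (∑-∑< Ωg n _) ⟩
        P * P * ∑< n (λ r′ → ∑ Ωg λ g → clash g r (itemAt w₁ r′) + clash g r (itemAt w₂ r′)) ≡⟨ ∑<-*ˡ n (P * P) _ ⟨
        ∑< n (λ r′ → P * P * ∑ Ωg λ g → clash g r (itemAt w₁ r′) + clash g r (itemAt w₂ r′)) ≤⟨ ∑<-bound n (λ r′ _ → two r′) ⟩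
        n * (2 * G) ∎
        where
        open ≤-Reasoning
        two : ∀ r′ → P * P * ∑ Ωg (λ g → clash g r (itemAt w₁ r′) + clash g r (itemAt w₂ r′)) ≤ 2 * G
        two r′ = begin
          P * P * ∑ Ωg (λ g → clash g r (itemAt w₁ r′) + clash g r (itemAt w₂ r′)) ≡⟨ cong (P * P *_) (∑-+ Ωg _ _) ⟩
          P * P * (∑ Ωg (λ g → clash g r (itemAt w₁ r′)) + ∑ Ωg (λ g → clash g r (itemAt w₂ r′))) ≡⟨ *-distribˡ-+ (P * P) _ _ ⟩
          P * P * ∑ Ωg (λ g → clash g r (itemAt w₁ r′)) + P * P * ∑ Ωg (λ g → clash g r (itemAt w₂ r′))
            ≤⟨ +-mono-≤ (∑-clash r (itemAt w₁ r′)) (≤-trans (∑-clash r (itemAt w₂ r′)) (≤-reflexive (sym (+-identityʳ G)))) ⟩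
          2 * G ∎

      -- Divided by P²G: the choices agree with probability at least g/P - 2n²/P² for g good
      -- positions, a first-order gain against the second-order loss by clashes. This balance is why
      -- P is taken of order n.
      ∑-choose-agree : P * (∑< n (λ r → 𝟙 (good? r)) * G) ≤
        P * P * ∑ Ωg (λ g → 𝟙 (w₁ (choose g w₁) ≟ᵛ w₂ (choose g w₂))) + n * (n * (2 * G))
      ∑-choose-agree = begin
        P * (∑< n (λ r → 𝟙 (good? r)) * G) ≡⟨ cong (P *_) (trans (*-comm _ G) (sym (∑<-*ˡ n G _))) ⟩
        P * ∑< n (λ r → G * 𝟙 (good? r)) ≡⟨ cong (P *_) (∑<-cong n λ r _ → trans (cong (_* 𝟙 (good? r)) (sym (∑-fires (common r)))) (lemma P _ (𝟙 (good? r)))) ⟩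
        P * ∑< n (λ r → P * (𝟙 (good? r) * ∑ Ωg (λ g → 𝟙 (fires? g (common r))))) ≡⟨ cong (P *_) (∑<-*ˡ n P _) ⟩
        P * (P * ∑< n (λ r → 𝟙 (good? r) * ∑ Ωg (λ g → 𝟙 (fires? g (common r))))) ≡⟨ *-assoc P P _ ⟨
        P * P * ∑< n (λ r → 𝟙 (good? r) * ∑ Ωg (λ g → 𝟙 (fires? g (common r)))) ≡⟨ cong (P * P *_) (∑<-cong n λ r _ → ∑-*ˡ Ωg (𝟙 (good? r)) _) ⟨
        P * P * ∑< n (λ r → ∑ Ωg (λ g → 𝟙 (good? r) * 𝟙 (fires? g (common r)))) ≡⟨ cong (P * P *_) (∑-∑< Ωg n _) ⟨
        P * P * ∑ Ωg (λ g → ∑< n (λ r → 𝟙 (good? r) * 𝟙 (fires? g (common r)))) ≤⟨ *-monoʳ-≤ (P * P) (∑-mono Ωg choose-agree) ⟩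
        P * P * ∑ Ωg (λ g → A g + ∑< n (λ r → 𝟙 (good? r) * clashes g r)) ≡⟨ cong (P * P *_) (∑-+ Ωg A _) ⟩
        P * P * (∑ Ωg A + ∑ Ωg (λ g → ∑< n (λ r → 𝟙 (good? r) * clashes g r))) ≡⟨ *-distribˡ-+ (P * P) (∑ Ωg A) _ ⟩
        P * P * ∑ Ωg A + P * P * ∑ Ωg (λ g → ∑< n (λ r → 𝟙 (good? r) * clashes g r))
          ≤⟨ +-monoʳ-≤ (P * P * ∑ Ωg A) (*-monoʳ-≤ (P * P) (∑-mono Ωg λ g → ∑<-mono n λ r _ →
               ≤-trans (*-monoˡ-≤ (clashes g r) (𝟙≤1 (good? r))) (≤-reflexive (*-identityˡ (clashes g r))))) ⟩
        P * P * ∑ Ωg A + P * P * ∑ Ωg (λ g → ∑< n (clashes g)) ≡⟨ cong (λ z → P * P * ∑ Ωg A + P * P * z) (∑-∑< Ωg n clashes) ⟩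
        P * P * ∑ Ωg A + P * P * ∑< n (λ r → ∑ Ωg λ g → clashes g r) ≡⟨ cong (P * P * ∑ Ωg A +_) (∑<-*ˡ n (P * P) _) ⟨
        P * P * ∑ Ωg A + ∑< n (λ r → P * P * ∑ Ωg λ g → clashes g r) ≤⟨ +-monoʳ-≤ (P * P * ∑ Ωg A) (∑<-bound n λ r _ → ∑-clashes r) ⟩
        P * P * ∑ Ωg A + n * (n * (2 * G)) ∎
        where
        open ≤-Reasoning
        A : El Ωg → ℕ
        A g = 𝟙 (w₁ (choose g w₁) ≟ᵛ w₂ (choose g w₂))
        lemma : ∀ p q r → p * q * r ≡ p * (r * q)
        lemma = solve-∀

-- Success probability of one trial

dist-cong : ∀ {b} n {x x′ y y′ : ℕ → Word b} → (∀ i → x i ≡ x′ i) → (∀ i → y i ≡ y′ i) → dist n x y ≡ dist n x′ y′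
dist-cong n p q = ∑<-cong n λ i _ → cong₂ ne (p i) (q i)

dist-rotate : ∀ {b} n {x y : ℕ → Word b} → Periodic n x → Periodic n y → ∀ r → dist n (sh r x) (sh r y) ≡ dist n x y
dist-rotate n {x} {y} px py r = ∑<-rotate n (λ i → ne (x i) (y i)) (λ i → cong₂ ne (px i) (py i)) r

Trial : ℕ → ℕ → ℕ → ℕ → Space
Trial b n q ℓ = vec (vec bit q) n ⊗ vec (vec bit ℓ) (Items b n)

module _ {b n q ℓ : ℕ} .{{_ : NonZero n}} where

  names : Vec (Word q) n → (ℕ → Word b) → ℕ → Vec (Word b) n
  names ms x r = masked ms (sh r x)

  names-periodic : ∀ ms {x : ℕ → Word b} → Periodic n x → Periodic n (names ms x)
  names-periodic ms {x} px r = masked-cong ms λ i → trans (cong x (+-assoc n r i)) (px (r + i))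

  rotation : El (Trial b n q ℓ) → (ℕ → Word b) → ℕ
  rotation (ms , g) x = choose g (names ms x)

  rotation< : ∀ t x → rotation t x < n
  rotation< (ms , g) x = choose< g (names ms x)

  aligned? : ∀ θ (x₁ x₂ : ℕ → Word b) t → Dec (dist n (sh (rotation t x₁) x₁) (sh (rotation t x₂) x₂) ≤ θ)
  aligned? θ x₁ x₂ t = dist n (sh (rotation t x₁) x₁) (sh (rotation t x₂) x₂) ≤? θ

  module _ {x₁ x₂ : ℕ → Word b} (px₁ : Periodic n x₁) (px₂ : Periodic n x₂) (m k w : ℕ)
    (close : dist n x₁ (sh m x₂) ≤ k)
    (4k≤Q : 4 * k ≤ ∣ vec bit q ∣) (4n≤P : 4 * n ≤ ∣ vec bit ℓ ∣) (P≤8n : ∣ vec bit ℓ ∣ ≤ 8 * n)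
    (64n²≤2^w : 64 * (n * n) ≤ 2 ^ w) where

    private
      Q = ∣ vec bit q ∣
      Pℓ = ∣ vec bit ℓ ∣
      θ = Q * w
      Ωm = vec (vec bit q) n
      Ωγ = vec (vec bit ℓ) (Items b n)
      M = ∣ Ωm ∣
      Γ = ∣ Ωγ ∣

    private
      agree : Vec (Word q) n → ℕ
      agree ms = ∑< n λ r → 𝟙 (names ms x₁ r ≟ᵛ names ms x₂ (m + r))

      repeated : Vec (Word q) n → ℕ → ℕ → ℕ
      repeated ms r r′ = 𝟙 (θ <? dist n (sh r x₁) (sh r′ x₂)) * 𝟙 (names ms x₁ r ≟ᵛ names ms x₂ r′)

      repeats : Vec (Word q) n → ℕ
      repeats ms = ∑< n λ r → ∑< n λ r′ → repeated ms r r′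

      success? = aligned? θ x₁ x₂

      S = ∑ (Trial b n q ℓ) (λ t → 𝟙 (success? t))

      -- The expected number of good positions is at least 3n/4, since each rotation agrees with its
      -- shifted partner with probability at least 3/4.
      ∑-agree : 3 * (n * M) ≤ 4 * ∑ Ωm agree
      ∑-agree = *-cancelˡ-≤ Q {{m^n≢0 2 (dim (vec bit q))}} (+-cancelʳ-≤ (n * (Q * M)) _ _ (begin
        Q * (3 * (n * M)) + n * (Q * M) ≡⟨ lemma₁ Q n M ⟩
        4 * (n * (Q * M)) ≡⟨ cong (4 *_) (∑<-const n (Q * M)) ⟨
        4 * ∑< n (λ r → Q * M) ≤⟨ *-monoʳ-≤ 4 (∑<-mono n λ r _ → masked-agree q n k (sh r x₁) (sh (m + r) x₂) (close′ r)) ⟩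
        4 * ∑< n (λ r → Q * ∑ Ωm (λ ms → 𝟙 (names ms x₁ r ≟ᵛ names ms x₂ (m + r))) + k * M) ≡⟨ cong (4 *_) (∑<-+ n _ _) ⟩
        4 * (∑< n (λ r → Q * ∑ Ωm (λ ms → 𝟙 (names ms x₁ r ≟ᵛ names ms x₂ (m + r)))) + ∑< n (λ r → k * M))
          ≡⟨ cong (4 *_) (cong₂ _+_ (trans (∑<-*ˡ n Q _) (cong (Q *_) (sym (∑-∑< Ωm n _)))) (∑<-const n (k * M))) ⟩
        4 * (Q * ∑ Ωm agree + n * (k * M)) ≡⟨ lemma₂ Q (∑ Ωm agree) n k M ⟩
        Q * (4 * ∑ Ωm agree) + n * (4 * k * M) ≤⟨ +-monoʳ-≤ _ (*-monoʳ-≤ n (*-monoˡ-≤ M 4k≤Q)) ⟩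
        Q * (4 * ∑ Ωm agree) + n * (Q * M) ∎))
        where
        open ≤-Reasoning
        close′ : ∀ r → dist n (sh r x₁) (sh (m + r) x₂) ≤ k
        close′ r = ≤-trans (≤-reflexive (trans
          (dist-cong n {x = sh r x₁} (λ _ → refl) (λ i → cong x₂ (+-assoc m r i)))
          (dist-rotate n px₁ (λ i → trans (cong x₂ (lemma₃ m n i)) (px₂ (m + i))) r))) close
          where lemma₃ : ∀ m n i → m + (n + i) ≡ n + (m + i)
                lemma₃ = solve-∀
        lemma₁ : ∀ q n m → q * (3 * (n * m)) + n * (q * m) ≡ 4 * (n * (q * m))
        lemma₁ = solve-∀
        lemma₂ : ∀ q a n k m → 4 * (q * a + n * (k * m)) ≡ q * (4 * a) + n * (4 * k * m)
        lemma₂ = solve-∀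

      ∑-repeated : ∀ r r′ → 2 ^ w * ∑ Ωm (λ ms → repeated ms r r′) ≤ M
      ∑-repeated r r′ = begin
        2 ^ w * ∑ Ωm (λ ms → repeated ms r r′) ≡⟨ cong (2 ^ w *_) (∑-*ˡ Ωm (𝟙 far?) _) ⟩
        2 ^ w * (𝟙 far? * ∑ Ωm same) ≡⟨ lemma (2 ^ w) (𝟙 far?) (∑ Ωm same) ⟩
        𝟙 far? * (2 ^ w * ∑ Ωm same) ≤⟨ bound far? ⟩
        M ∎
        where
        open ≤-Reasoning
        far? = θ <? dist n (sh r x₁) (sh r′ x₂)
        same : El Ωm → ℕ
        same ms = 𝟙 (names ms x₁ r ≟ᵛ names ms x₂ r′)
        lemma : ∀ p q r → p * (q * r) ≡ q * (p * r)
        lemma = solve-∀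
        bound : (d : Dec (θ < dist n (sh r x₁) (sh r′ x₂))) → 𝟙 d * (2 ^ w * ∑ Ωm same) ≤ M
        bound (no _) = z≤n
        bound (yes lt) = ≤-trans (≤-reflexive (*-identityˡ (2 ^ w * ∑ Ωm same))) (masked-differ q n w (sh r x₁) (sh r′ x₂) (<⇒≤ lt))

      -- Union bound over all n² pairs of rotations, not only the chosen pair: the choice depends on
      -- the mask, so no single pair can be fixed in advance.
      ∑-repeats : 64 * ∑ Ωm repeats ≤ M
      ∑-repeats = *-cancelˡ-≤ (n * n) {{m*n≢0 n n}} (begin
        n * n * (64 * ∑ Ωm repeats) ≡⟨ lemma (n * n) (∑ Ωm repeats) ⟩
        64 * (n * n) * ∑ Ωm repeats ≤⟨ *-monoˡ-≤ (∑ Ωm repeats) 64n²≤2^w ⟩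
        2 ^ w * ∑ Ωm repeats ≡⟨ cong (2 ^ w *_) (trans (∑-∑< Ωm n _) (∑<-cong n λ r _ → ∑-∑< Ωm n _)) ⟩
        2 ^ w * ∑< n (λ r → ∑< n λ r′ → ∑ Ωm λ ms → repeated ms r r′) ≡⟨ ∑<-*ˡ n (2 ^ w) _ ⟨
        ∑< n (λ r → 2 ^ w * ∑< n λ r′ → ∑ Ωm λ ms → repeated ms r r′) ≡⟨ ∑<-cong n (λ r _ → sym (∑<-*ˡ n (2 ^ w) _)) ⟩
        ∑< n (λ r → ∑< n λ r′ → 2 ^ w * ∑ Ωm λ ms → repeated ms r r′) ≤⟨ ∑<-bound n (λ r _ → ∑<-bound n (λ r′ _ → ∑-repeated r r′)) ⟩
        n * (n * M) ≡⟨ *-assoc n n M ⟨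
        n * n * M ∎)
        where
        open ≤-Reasoning
        lemma : ∀ a b → a * (64 * b) ≡ 64 * a * b
        lemma = solve-∀

      -- Equal names at the two chosen rotations either come from close rotations or expose a far
      -- pair with equal restrictions.
      names-agree≤ : ∀ ms g → 𝟙 (names ms x₁ (choose g (names ms x₁)) ≟ᵛ names ms x₂ (choose g (names ms x₂))) ≤
                     𝟙 (success? (ms , g)) + repeats ms
      names-agree≤ ms g = 𝟙≤ (names ms x₁ r₁ ≟ᵛ names ms x₂ r₂) bound
        where
        r₁ = choose g (names ms x₁)
        r₂ = choose g (names ms x₂)
        bound : names ms x₁ r₁ ≡ names ms x₂ r₂ → 1 ≤ 𝟙 (success? (ms , g)) + repeats ms
        bound eq with dist n (sh r₁ x₁) (sh r₂ x₂) ≤? θ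
        ... | yes p = ≤-trans (≤-reflexive (sym (𝟙-yes (success? (ms , g)) p))) (m≤m+n _ _)
        ... | no ≰ = ≤-trans (≤-reflexive (sym (cong₂ _*_
                (𝟙-yes (θ <? dist n (sh r₁ x₁) (sh r₂ x₂)) (≰⇒> ≰)) (𝟙-yes (names ms x₁ r₁ ≟ᵛ names ms x₂ r₂) eq))))
              (≤-trans (≤-trans (≤∑< n (λ r′ → repeated ms r₁ r′) r₂ (choose< g (names ms x₂)))
                       (≤∑< n (λ r → ∑< n λ r′ → repeated ms r r′) r₁ (choose< g (names ms x₁)))) (m≤n+m _ _))

      ∑-main : Pℓ * (∑ Ωm agree * Γ) ≤ Pℓ * Pℓ * (S + ∑ Ωm repeats * Γ) + M * (n * (n * (2 * Γ)))
      ∑-main = begin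
        Pℓ * (∑ Ωm agree * Γ) ≡⟨ cong (Pℓ *_) (∑-*ʳ Ωm Γ agree) ⟨
        Pℓ * ∑ Ωm (λ ms → agree ms * Γ) ≡⟨ ∑-*ˡ Ωm Pℓ _ ⟨
        ∑ Ωm (λ ms → Pℓ * (agree ms * Γ)) ≤⟨ ∑-mono Ωm (λ ms → ≤-trans
            (∑-choose-agree (names ms x₁) (names ms x₂) (names-periodic ms px₂) m {ℓ})
            (+-monoˡ-≤ _ (*-monoʳ-≤ (Pℓ * Pℓ) (per-mask ms)))) ⟩
        ∑ Ωm (λ ms → Pℓ * Pℓ * (s ms + repeats ms * Γ) + R) ≡⟨ ∑-+ Ωm _ _ ⟩
        ∑ Ωm (λ ms → Pℓ * Pℓ * (s ms + repeats ms * Γ)) + ∑ Ωm (λ ms → R)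
          ≡⟨ cong₂ _+_ (trans (∑-*ˡ Ωm (Pℓ * Pℓ) _) (cong (Pℓ * Pℓ *_) (trans (∑-+ Ωm s _) (cong (S +_) (∑-*ʳ Ωm Γ repeats))))) (∑-const Ωm R) ⟩
        Pℓ * Pℓ * (S + ∑ Ωm repeats * Γ) + M * R ∎
        where
        open ≤-Reasoning
        R = n * (n * (2 * Γ))
        s : El Ωm → ℕ
        s ms = ∑ Ωγ λ g → 𝟙 (success? (ms , g))
        per-mask : ∀ ms → ∑ Ωγ (λ g → 𝟙 (names ms x₁ (choose g (names ms x₁)) ≟ᵛ names ms x₂ (choose g (names ms x₂)))) ≤
                   s ms + repeats ms * Γ
        per-mask ms = ≤-trans (∑-mono Ωγ (names-agree≤ ms)) (≤-reflexive (trans (∑-+ Ωγ _ _)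
          (cong (s ms +_) (trans (∑-const Ωγ (repeats ms)) (*-comm Γ _)))))

      -- In expectations, 3n/(4P) - 2n²/P² is at most success plus repeats. `4n≤P` bounds the loss
      -- by n/(2P), which leaves n/(4P), and `P≤8n` makes this at least 1/32. Repeats take at most
      -- 1/64, so 1/64 remains for success.
      ∑-success : M * Γ ≤ 64 * S
      ∑-success = +-cancelʳ-≤ (M * Γ) _ _ (begin
        M * Γ + M * Γ ≡⟨ lemma₀ (M * Γ) ⟩
        2 * (M * Γ) ≤⟨ *-monoʳ-≤ 2 step₂ ⟩
        2 * (32 * (S + C * Γ)) ≡⟨ lemma₄ S C Γ ⟩
        64 * S + 64 * C * Γ ≤⟨ +-monoʳ-≤ (64 * S) (*-monoˡ-≤ Γ ∑-repeats) ⟩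
        64 * S + M * Γ ∎)
        where
        open ≤-Reasoning
        C = ∑ Ωm repeats
        A = ∑ Ωm agree
        lemma₀ : ∀ x → x + x ≡ 2 * x
        lemma₀ = solve-∀
        lemma₁ : ∀ p n m g → p * (n * m * g) + p * (2 * (n * m * g)) ≡ p * (3 * (n * m) * g)
        lemma₁ = solve-∀
        lemma₂ : ∀ p a g → p * (4 * a * g) ≡ 4 * (p * (a * g))
        lemma₂ = solve-∀
        lemma₃ : ∀ p n m g s → 4 * (p * p * s + m * (n * (n * (2 * g)))) ≡ p * (4 * p * s) + 2 * (4 * n * (n * m * g))
        lemma₃ = solve-∀
        lemma₄ : ∀ s c g → 2 * (32 * (s + c * g)) ≡ 64 * s + 64 * c * g
        lemma₄ = solve-∀
        lemma₅ : ∀ p q → 2 * (p * q) ≡ p * (2 * q)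
        lemma₅ = solve-∀
        lemma₆ : ∀ n s → 4 * (8 * n) * s ≡ n * (32 * s)
        lemma₆ = solve-∀
        step₁ : n * M * Γ ≤ 4 * Pℓ * (S + C * Γ)
        step₁ = *-cancelˡ-≤ Pℓ {{m^n≢0 2 (dim (vec bit ℓ))}} (+-cancelʳ-≤ (Pℓ * (2 * (n * M * Γ))) _ _ (begin
          Pℓ * (n * M * Γ) + Pℓ * (2 * (n * M * Γ)) ≡⟨ lemma₁ Pℓ n M Γ ⟩
          Pℓ * (3 * (n * M) * Γ) ≤⟨ *-monoʳ-≤ Pℓ (*-monoˡ-≤ Γ ∑-agree) ⟩
          Pℓ * (4 * A * Γ) ≡⟨ lemma₂ Pℓ A Γ ⟩
          4 * (Pℓ * (A * Γ)) ≤⟨ *-monoʳ-≤ 4 ∑-main ⟩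
          4 * (Pℓ * Pℓ * (S + C * Γ) + M * (n * (n * (2 * Γ)))) ≡⟨ lemma₃ Pℓ n M Γ (S + C * Γ) ⟩
          Pℓ * (4 * Pℓ * (S + C * Γ)) + 2 * (4 * n * (n * M * Γ)) ≤⟨ +-monoʳ-≤ (Pℓ * (4 * Pℓ * (S + C * Γ))) (*-monoʳ-≤ 2 (*-monoˡ-≤ (n * M * Γ) 4n≤P)) ⟩
          Pℓ * (4 * Pℓ * (S + C * Γ)) + 2 * (Pℓ * (n * M * Γ)) ≡⟨ cong (Pℓ * (4 * Pℓ * (S + C * Γ)) +_) (lemma₅ Pℓ (n * M * Γ)) ⟩
          Pℓ * (4 * Pℓ * (S + C * Γ)) + Pℓ * (2 * (n * M * Γ)) ∎))
        step₂ : M * Γ ≤ 32 * (S + C * Γ)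
        step₂ = *-cancelˡ-≤ n (begin
          n * (M * Γ) ≡⟨ *-assoc n M Γ ⟨
          n * M * Γ ≤⟨ step₁ ⟩
          4 * Pℓ * (S + C * Γ) ≤⟨ *-monoˡ-≤ (S + C * Γ) (*-monoʳ-≤ 4 P≤8n) ⟩
          4 * (8 * n) * (S + C * Γ) ≡⟨ lemma₆ n (S + C * Γ) ⟩
          n * (32 * (S + C * Γ)) ∎)

    ∑-failure : 64 * ∑ (Trial b n q ℓ) (λ t → 𝟙 (¬? (aligned? (∣ vec bit q ∣ * w) x₁ x₂ t))) ≤ 63 * ∣ Trial b n q ℓ ∣
    ∑-failure = +-cancelʳ-≤ ∣T∣ _ _ (begin
      64 * F + ∣T∣ ≡⟨ cong (64 * F +_) (^-distribˡ-+-* 2 (dim Ωm) (dim Ωγ)) ⟩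
      64 * F + M * Γ ≤⟨ +-monoʳ-≤ (64 * F) ∑-success ⟩
      64 * F + 64 * S ≡⟨ *-distribˡ-+ 64 F S ⟨
      64 * (F + S) ≡⟨ cong (64 *_) (trans (sym (∑-+ (Trial b n q ℓ) _ _)) (trans (∑-cong (Trial b n q ℓ) λ t → 𝟙-¬+ (success? t)) (trans (∑-const (Trial b n q ℓ) 1) (*-identityʳ ∣T∣)))) ⟩
      64 * ∣T∣ ≡⟨ +-comm ∣T∣ (63 * ∣T∣) ⟩
      63 * ∣T∣ + ∣T∣ ∎)
      where
      open ≤-Reasoning
      ∣T∣ = ∣ Trial b n q ℓ ∣
      F = ∑ (Trial b n q ℓ) (λ t → 𝟙 (¬? (success? t)))
      𝟙-¬+ : ∀ {P : Set} (p? : Dec P) → 𝟙 (¬? p?) + 𝟙 p? ≡ 1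
      𝟙-¬+ (yes _) = refl
      𝟙-¬+ (no _) = refl

-- Approximate periods, serialisation and decoding

module _ {A : Set} {n : ℕ} .{{_ : NonZero n}} {x : ℕ → A} (px : Periodic n x) where

  periodic-* : ∀ c i → x (c * n + i) ≡ x i
  periodic-* zero i = refl
  periodic-* (suc c) i = trans (cong x (+-assoc n (c * n) i)) (trans (px (c * n + i)) (periodic-* c i))

  periodic-% : ∀ i → x i ≡ x (i % n)
  periodic-% i = trans (cong x (trans (m≡m%n+[m/n]*n i n) (+-comm (i % n) _))) (periodic-* (i / n) (i % n))

periodic-ext : ∀ {A : Set} {n} .{{_ : NonZero n}} {x y : ℕ → A} → Periodic n x → Periodic n y →
               (∀ i → i < n → x i ≡ y i) → ∀ i → x i ≡ y i
periodic-ext {n = n} px py eq i = trans (periodic-% px i) (trans (eq (i % n) (m%n<n i n)) (sym (periodic-% py i)))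

sh-periodic : ∀ {A : Set} {n} {x : ℕ → A} r → Periodic n x → Periodic n (sh r x)
sh-periodic {n = n} {x} r px i = trans (cong x (lemma r n i)) (px (r + i))
  where lemma : ∀ r n i → r + (n + i) ≡ n + (r + i)
        lemma = solve-∀

-- A subgroup of ℤ seen through its nonnegative members: in the absence of negatives, closure under
-- inverses becomes cancellation.
record Subgroup (F : ℕ → Set) : Set where
  field
    0∈   : F 0
    +∈   : ∀ {a b} → F a → F b → F (a + b)
    diff : ∀ a {b} → F a → F (a + b) → F b

  *∈ : ∀ c {a} → F a → F (c * a)
  *∈ zero    fa = 0∈
  *∈ (suc c) fa = +∈ fa (*∈ c fa)

  gcd∈ : ∀ {a b} → F a → F b → F (gcd a b)
  gcd∈ {a} {b} fa fb with Bézout.identity (gcd-GCD a b)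
  ... | Bézout.+- x y eq = diff (y * b) (*∈ y fb) (subst F (trans (sym eq) (+-comm (gcd a b) _)) (*∈ x fa))
  ... | Bézout.-+ x y eq = diff (x * a) (*∈ x fa) (subst F (trans (sym eq) (+-comm (gcd a b) _)) (*∈ y fb))

stabiliser : ∀ {A : Set} (y : ℕ → A) → Subgroup (λ a → ∀ j → y (a + j) ≡ y j)
stabiliser y = record
  { 0∈   = λ j → refl
  ; +∈   = λ {a} {b} fa fb j → trans (cong y (+-assoc a b j)) (trans (fa (b + j)) (fb j))
  ; diff = λ a {b} fa fab j → trans (sym (fa (b + j))) (trans (cong y (sym (+-assoc a b j))) (fab j))
  }

-- A proper divisor is at most half; the quotient 1 would mean that `d` divides `i`.
gcd-halves : ∀ d i → NonZero d → ¬ (d ∣ i) → 2 * gcd d i ≤ d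
gcd-halves d i nz d∤i with gcd[m,n]∣m d i
... | divides zero eq = contradiction eq (≢-nonZero⁻¹ d {{nz}})
... | divides (suc zero) eq = contradiction (subst (_∣ i) (trans (sym (+-identityʳ _)) (sym eq)) (gcd[m,n]∣n d i)) d∤i
... | divides (suc (suc c)) eq = subst (2 * gcd d i ≤_) (sym eq) (*-monoˡ-≤ (gcd d i) (s≤s (s≤s (z≤n {c}))))

module _ {P : ℕ → Set} (P? : ∀ a → Dec (P a)) where

  -- d is the gcd of n and the generators found so far; it at least halves with every new one.
  generators : ℕ → ℕ → List ℕ
  generators zero    d = []
  generators (suc i) d with P? i ×-dec ¬? (d ∣? i)
  ... | yes _ = i ∷ generators i (gcd d i)
  ... | no _  = generators i d

  generators-P : ∀ i d → All P (generators i d)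
  generators-P zero d = []
  generators-P (suc i) d with P? i ×-dec ¬? (d ∣? i)
  ... | yes (pi , _) = pi ∷ generators-P i (gcd d i)
  ... | no _ = generators-P i d

  generators-< : ∀ n i d → i ≤ n → All (_< n) (generators i d)
  generators-< n zero d _ = []
  generators-< n (suc i) d i<n with P? i ×-dec ¬? (d ∣? i)
  ... | yes _ = i<n ∷ generators-< n i (gcd d i) (<⇒≤ i<n)
  ... | no _ = generators-< n i d (<⇒≤ i<n)

  generators-length : ∀ i d → NonZero d → 2 ^ length (generators i d) ≤ d
  generators-length zero d nz = >-nonZero⁻¹ d {{nz}}
  generators-length (suc i) d nz with P? i ×-dec ¬? (d ∣? i)
  ... | yes (_ , d∤i) = ≤-trans (*-monoʳ-≤ 2 (generators-length i (gcd d i) nz′)) (gcd-halves d i nz d∤i)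
    where nz′ : NonZero (gcd d i)
          nz′ = ≢-nonZero (gcd[m,n]≢0 d i (inj₁ (≢-nonZero⁻¹ d {{nz}})))
  ... | no _ = generators-length i d nz

  -- Every `a` with `P a` was either recorded or a multiple of the current `d`, and `d` stays in the
  -- subgroup by Bézout.
  generators-span : ∀ {F} → Subgroup F → ∀ i d → F d → All F (generators i d) → ∀ a → a < i → P a → F a
  generators-span sg (suc i) d fd fs a a<i pa with P? i ×-dec ¬? (d ∣? i)
  generators-span {F} sg (suc i) d fd (fi ∷ fs) a a<i pa | yes _ with a ≟ i
  ... | yes refl = fi
  ... | no a≢i = generators-span sg i (gcd d i) (Subgroup.gcd∈ sg fd fi) fs a (≤∧≢⇒< (s≤s⁻¹ a<i) a≢i) pa
  generators-span {F} sg (suc i) d fd fs a a<i pa | no ¬new with a ≟ i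
  ... | no a≢i = generators-span sg i d fd fs a (≤∧≢⇒< (s≤s⁻¹ a<i) a≢i) pa
  ... | yes refl with d ∣? a
  ...   | yes (divides c eq) = subst F (sym eq) (Subgroup.*∈ sg c fd)
  ...   | no d∤a = contradiction (pa , d∤a) ¬new

-- Truncates as well as pads. For shifts the default 0 is a trivial period; for bit lists a default
-- makes parsing total.
padTo : ∀ {A : Set} → A → ∀ N → List A → Vec A N
padTo a zero    _        = []
padTo a (suc N) []       = a ∷ padTo a N []
padTo a (suc N) (x ∷ xs) = x ∷ padTo a N xs

padTo-toList : ∀ {A : Set} (a : A) {N} (v : Vec A N) → padTo a N (toList v) ≡ v
padTo-toList a [] = refl
padTo-toList a (x ∷ v) = cong (x ∷_) (padTo-toList a v)

padTo-All⁺ : ∀ {A : Set} {R : A → Set} a N {l} → R a → All R l → ∀ p → R (lookup (padTo a N l) p)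
padTo-All⁺ a (suc N) ra [] zero = ra
padTo-All⁺ {R = R} a (suc N) ra [] (suc p) = padTo-All⁺ {R = R} a N ra [] p
padTo-All⁺ a (suc N) ra (r ∷ rs) zero = r
padTo-All⁺ a (suc N) ra (r ∷ rs) (suc p) = padTo-All⁺ a N ra rs p

padTo-All⁻ : ∀ {A : Set} {R : A → Set} a N l → length l ≤ N → (∀ p → R (lookup (padTo a N l) p)) → All R l
padTo-All⁻ a N [] _ _ = []
padTo-All⁻ a (suc N) (x ∷ l) (s≤s le) rs = rs zero ∷ padTo-All⁻ a N l le (rs ∘ suc)

-- Serialisation of the entries

bin : ∀ L → ℕ → Word L
bin zero    r = []
bin (suc L) r = (r % 2 ≡ᵇ 1) ∷ bin L (r / 2)

val : ∀ {L} → Word L → ℕ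
val []      = 0
val (c ∷ v) = (if c then 1 else 0) + val v * 2

val-bin : ∀ L r → r < 2 ^ L → val (bin L r) ≡ r
val-bin zero zero _ = refl
val-bin zero (suc r) (s≤s ())
val-bin (suc L) r r< = trans (cong₂ _+_ (low (r % 2) (m%n<n r 2)) (cong (_* 2) (val-bin L (r / 2) (m<n*o⇒m/o<n (subst (r <_) (*-comm 2 (2 ^ L)) r<)))))
  (sym (m≡m%n+[m/n]*n r 2))
  where
  low : ∀ c → c < 2 → (if c ≡ᵇ 1 then 1 else 0) ≡ c
  low zero _ = refl
  low (suc zero) _ = refl
  low (suc (suc c)) (s≤s (s≤s ()))

chunks : ∀ {A : Set} K M → Vec A (K * M) → Vec (Vec A M) K
chunks zero    M v = []
chunks (suc K) M v = take M v ∷ chunks K M (drop M v)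

chunks-concat : ∀ {A : Set} {K M} (vs : Vec (Vec A M) K) → chunks K M (concat vs) ≡ vs
chunks-concat [] = refl
chunks-concat {K = suc K} {M} (v ∷ vs) = cong₂ _∷_ (take-++ M v (concat vs))
  (trans (cong (chunks K M) (drop-++ M v (concat vs))) (chunks-concat vs))

module _ {K L s : ℕ} where

  serialise : Vec (ℕ × Word s) K → List Bool
  serialise es = toList (concat (map (λ (r , y) → bin L r ++ y) es))

  parse : List Bool → Vec (ℕ × Word s) K
  parse l = map (λ c → val (take L c) , drop L c) (chunks K (L + s) (padTo false _ l))

  parse-serialise : ∀ es → (∀ p → proj₁ (lookup es p) < 2 ^ L) → parse (serialise es) ≡ es
  parse-serialise es small = trans (cong (map _) (trans (cong (chunks K (L + s)) (padTo-toList false _)) (chunks-concat _))) (roundtrip es small)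
    where
    roundtrip : ∀ {K} (es : Vec (ℕ × Word s) K) → (∀ p → proj₁ (lookup es p) < 2 ^ L) →
                map (λ c → val (take L c) , drop L c) (map (λ (r , y) → bin L r ++ y) es) ≡ es
    roundtrip [] _ = refl
    roundtrip ((r , y) ∷ es) small = cong₂ _∷_
      (cong₂ _,_ (trans (cong val (take-++ L (bin L r) y)) (val-bin L r (small zero))) (drop-++ L (bin L r) y))
      (roundtrip es (small ∘ suc))

-- Periodic extensions and decoding from differences

tab : ∀ {b} n → (ℕ → Word b) → Vec (Word b) n
tab zero    x = []
tab (suc n) x = x 0 ∷ tab n (x ∘ suc)

at-tab : ∀ {b} n (x : ℕ → Word b) i → i < n → at (tab n x) i ≡ x i
at-tab (suc n) x zero _ = refl
at-tab (suc n) x (suc i) (s<s i<n) = at-tab n (x ∘ suc) i i<n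

pick : ∀ {A : Set} → A → A → Fin 2 → A
pick a b zero       = a
pick a b (suc zero) = b

per : ∀ {b n} .{{_ : NonZero n}} → Vec (Word b) n → ℕ → Word b
per {n = n} X i = at X (i % n)

per-periodic : ∀ {b n} .{{_ : NonZero n}} (X : Vec (Word b) n) → Periodic n (per X)
per-periodic {n = n} X i = cong (at X) (trans (cong (_% n) (+-comm n i)) ([m+n]%n≡m%n i n))

wt-cong : ∀ {b} n {x y : ℕ → Word b} → (∀ i → i < n → x i ≡ y i) → wt n x ≡ wt n y
wt-cong n p = ∑<-cong n λ i i<n → cong (λ u → ne u 0ʷ) (p i i<n)

Strings : ℕ → ℕ → Space
Strings b n = vec (vec bit b) n

module _ {b n s : ℕ} .{{_ : NonZero n}} (θ : ℕ) (H : Vec (Vec (Word b) n) s) where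

  Known : Word s → Set
  Known y = ∃ λ (z : El (Strings b n)) → wt n (at z) ≤ θ × hash H (at z) ≡ y

  Explains : (ℕ → Word b) → Word s → Set
  Explains v y = wt n v ≤ θ × hash H v ≡ y

  -- The string `v` may be dense. In that case the property says that no sparse string has the hash
  -- of `v`, so a dense difference is never mistaken for a sparse one.
  Identifies : (ℕ → Word b) → Set
  Identifies v = ∀ (z : El (Strings b n)) → wt n (at z) ≤ θ → hash H (at z) ≡ hash H v → ∀ j → j < n → at z j ≡ v j

  known? : ∀ y → Dec (Known y)
  known? y = any? (Strings b n) λ z → (wt n (at z) ≤? θ) ×-dec (hash H (at z) ≟ʷ y)

  explains? : ∀ v y → Dec (Explains v y)
  explains? v y = (wt n v ≤? θ) ×-dec (hash H v ≟ʷ y)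

  module _ {K : ℕ} where

    -- A constraint is imposed only where the combined hash is that of some sparse string, which the
    -- decoder can test without knowing the strings.
    Consistent : (Fin 2 → Vec (ℕ × Word s) K) → (Fin 2 → ℕ → Word b) → Set
    Consistent E X = ∀ i i′ p p′ →
      let (r , y) = lookup (E i) p; (r′ , y′) = lookup (E i′) p′ in
      Known (y ⊕ y′) → Explains (sh r (X i) ⊞ sh r′ (X i′)) (y ⊕ y′)

    consistent? : ∀ E X → Dec (Consistent E X)
    consistent? E X = all? λ i → all? λ i′ → all? λ p → all? λ p′ →
      known? _ →-dec explains? _ _

    -- The true pair is consistent, so the maximum never underestimates the true distance.
    reconstruct : ℕ → (Fin 2 → Vec (ℕ × Word s) K) → ℕ
    reconstruct m E = Max (Strings b n ⊗ Strings b n) λ (X₁ , X₂) →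
      if does (consistent? E (pick (per X₁) (per X₂))) then dist n (per X₁) (sh m (per X₂)) else 0

    entries : Vec ℕ K → (ℕ → Word b) → Vec (ℕ × Word s) K
    entries rs x = map (λ r → r , hash H (sh r x)) rs

    module _ {R : Fin 2 → Vec ℕ K} {x : Fin 2 → ℕ → Word b} (px : ∀ i → Periodic n (x i))
      {E : Fin 2 → Vec (ℕ × Word s) K} (E≡ : ∀ i → E i ≡ entries (R i) (x i))
      (R< : ∀ i p → lookup (R i) p < n)
      (ident : ∀ i i′ r r′ → r < n → r′ < n → Identifies (sh r (x i) ⊞ sh r′ (x i′))) where

      private
        E-lookup : ∀ i p → lookup (E i) p ≡ (lookup (R i) p , hash H (sh (lookup (R i) p) (x i)))
        E-lookup i p = trans (cong (λ e → lookup e p) (E≡ i)) (lookup-map p _ (R i))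

        E-r : ∀ i p → proj₁ (lookup (E i) p) ≡ lookup (R i) p
        E-r i p = cong proj₁ (E-lookup i p)

        E-y : ∀ i p → proj₂ (lookup (E i) p) ≡ hash H (sh (lookup (R i) p) (x i))
        E-y i p = cong proj₂ (E-lookup i p)

        delta : (Fin 2 → ℕ → Word b) → ∀ i i′ (p p′ : Fin K) → ℕ → Word b
        delta X i i′ p p′ = sh (lookup (R i) p) (X i) ⊞ sh (lookup (R i′) p′) (X i′)

        E-delta : ∀ X i i′ p p′ j → (sh (proj₁ (lookup (E i) p)) (X i) ⊞ sh (proj₁ (lookup (E i′) p′)) (X i′)) j ≡ delta X i i′ p p′ j
        E-delta X i i′ p p′ j = cong₂ (λ r r′ → X i (r + j) ⊕ X i′ (r′ + j)) (E-r i p) (E-r i′ p′)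

        E-hash : ∀ i i′ p p′ → proj₂ (lookup (E i) p) ⊕ proj₂ (lookup (E i′) p′) ≡ hash H (delta x i i′ p p′)
        E-hash i i′ p p′ = trans (cong₂ _⊕_ (E-y i p) (E-y i′ p′)) (sym (hash-⊞ H _ _))

      -- A sparse string with the combined hash must be the true difference, by identification;
      -- hence the true difference is itself sparse.
      truth-consistent : Consistent E x
      truth-consistent i i′ p p′ (z , sparse , eq) =
          ≤-trans (≤-reflexive (wt-cong n λ j j<n → trans (E-delta x i i′ p p′ j) (sym (z≡ j j<n)))) sparse
        , trans (hash-cong H λ j _ → E-delta x i i′ p p′ j) (sym (E-hash i i′ p p′))
        where
        z≡ : ∀ j → j < n → at z j ≡ delta x i i′ p p′ j
        z≡ = ident i i′ _ _ (R< i p) (R< i′ p′) z sparse (trans eq (E-hash i i′ p p′))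

      -- A sparse true difference is recognised, and the candidate's difference, sparse with the
      -- same hash, must equal it. Rearranged, the error at one rotation equals the error at the
      -- other.
      consistent-delta : ∀ {X} → Consistent E X → (∀ i → Periodic n (X i)) → ∀ i i′ p p′ →
        dist n (sh (lookup (R i) p) (x i)) (sh (lookup (R i′) p′) (x i′)) ≤ θ →
        ∀ j → X i (lookup (R i) p + j) ⊕ x i (lookup (R i) p + j) ≡ X i′ (lookup (R i′) p′ + j) ⊕ x i′ (lookup (R i′) p′ + j)
      consistent-delta {X} con pX i i′ p p′ close j = ⊕-exchange _ _ _ _ (periodic-ext (pδ X pX) (pδ x px) eq<n j)
        where
        pδ : ∀ X → (∀ i → Periodic n (X i)) → Periodic n (delta X i i′ p p′)
        pδ X pX j = cong₂ _⊕_ (sh-periodic {x = X i} (lookup (R i) p) (pX i) j) (sh-periodic {x = X i′} (lookup (R i′) p′) (pX i′) j)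
        v = delta x i i′ p p′
        known : Known (proj₂ (lookup (E i) p) ⊕ proj₂ (lookup (E i′) p′))
        known = tab n v
          , ≤-trans (≤-reflexive (trans (wt-cong n (at-tab n v)) (sym (dist-⊞ n (sh (lookup (R i) p) (x i)) (sh (lookup (R i′) p′) (x i′)))))) close
          , trans (hash-cong H (at-tab n v)) (sym (E-hash i i′ p p′))
        δX = delta X i i′ p p′
        expl = con i i′ p p′ known
        eq<n : ∀ j → j < n → δX j ≡ v j
        eq<n j j<n = trans (sym (at-tab n δX j j<n)) (ident i i′ _ _ (R< i p) (R< i′ p′) (tab n δX)
          (≤-trans (≤-reflexive (wt-cong n λ j j<n → trans (at-tab n δX j j<n) (sym (E-delta X i i′ p p′ j)))) (proj₁ expl))
          (trans (hash-cong H λ j j<n → trans (at-tab n δX j j<n) (sym (E-delta X i i′ p p′ j)))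
            (trans (proj₂ expl) (E-hash i i′ p p′))) j j<n)

module Core {b n q ℓ s : ℕ} .{{_ : NonZero n}} (L T θ k : ℕ) (n<2^L : n < 2 ^ L) where

  -- The threshold for approximate periods: a misalignment passes through the second string, at cost
  -- `k` for the true shift and `θ` for the trial.
  θ⁺ : ℕ
  θ⁺ = θ + k

  near? : ∀ (x : ℕ → Word b) a → Dec (dist n x (sh a x) ≤ θ⁺)
  near? x a = dist n x (sh a x) ≤? θ⁺

  shifts : (ℕ → Word b) → Vec ℕ L
  shifts x = padTo 0 L (generators (near? x) n n)

  -- Rotation 0 is recorded so that each generator `a` has a partner: the pair (0 , a) yields the
  -- difference of the string and its shift by `a`.
  rotations : Vec (El (Trial b n q ℓ)) T → (ℕ → Word b) → Vec ℕ (suc (L + T))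
  rotations ts x = 0 ∷ (shifts x ++ map (λ t → rotation t x) ts)

  rotations< : ∀ ts x p → lookup (rotations ts x) p < n
  rotations< ts x zero = >-nonZero⁻¹ n
  rotations< ts x (suc p) with splitAt L p in eq
  ... | inj₁ g = subst (_< n) (trans (sym (lookup-++ˡ (shifts x) _ g)) (cong (lookup (shifts x ++ _)) (splitAt⁻¹-↑ˡ eq)))
                   (padTo-All⁺ {R = _< n} 0 L (>-nonZero⁻¹ n) (generators-< (near? x) n n n ≤-refl) g)
  ... | inj₂ t = subst (_< n) (trans (sym (trans (lookup-++ʳ (shifts x) _ t) (lookup-map t _ ts))) (cong (lookup (shifts x ++ _)) (splitAt⁻¹-↑ʳ eq)))
                   (rotation< (lookup ts t) x)

  module _ (H : Vec (Vec (Word b) n) s) (ts : Vec (El (Trial b n q ℓ)) T) (X₁ X₂ : Vec (Word b) n) (m : ℕ) where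

    private
      x : Fin 2 → ℕ → Word b
      x = pick (per X₁) (per X₂)
      R : Fin 2 → Vec ℕ (suc (L + T))
      R i = rotations ts (x i)
      px : ∀ i → Periodic n (x i)
      px zero = per-periodic X₁
      px (suc zero) = per-periodic X₂
      x₁ = per X₁
      x₂ = per X₂

    module _ {E : Fin 2 → Vec (ℕ × Word s) (suc (L + T))} (E≡ : ∀ i → E i ≡ entries θ⁺ H (R i) (x i))
      (ident : ∀ i i′ r r′ → r < n → r′ < n → Identifies θ⁺ H (sh r (x i) ⊞ sh r′ (x i′))) where

      reconstruct-≥ : dist n x₁ (sh m x₂) ≤ reconstruct θ⁺ H m E
      reconstruct-≥ = ≤-trans (≤-reflexive (sym (value (consistent? θ⁺ H E x) (truth-consistent θ⁺ H {R = R} px E≡ (λ i → rotations< ts (x i)) ident))))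
        (≤Max (Strings b n ⊗ Strings b n) _ (X₁ , X₂))
        where
        value : ∀ {P : Set} (d : Dec P) → P → (if does d then dist n x₁ (sh m x₂) else 0) ≡ dist n x₁ (sh m x₂)
        value (yes _) _ = refl
        value (no ¬p) p = contradiction p ¬p

      module _ (close : dist n x₁ (sh m x₂) ≤ k) (t : Fin T)
        (success : dist n (sh (rotation (lookup ts t) x₁) x₁) (sh (rotation (lookup ts t) x₂) x₂) ≤ θ) where

        private
          r₁ = rotation (lookup ts t) x₁
          r₂ = rotation (lookup ts t) x₂
          r₁<n = rotation< (lookup ts t) x₁
          r₂<n = rotation< (lookup ts t) x₂

          -- The offset by which the rotations chosen for the two strings are misaligned.
          a : ℕ
          a = r₁ + m + (n ∸ r₂)

          -- Modulo `n`, `a` is r₁ + m - r₂; the extra `n` keeps the identity in ℕ.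
          r₂+a : ∀ j → r₂ + (a + j) ≡ n + (m + (r₁ + j))
          r₂+a j = trans (lemma r₂ r₁ m (n ∸ r₂) j) (cong (_+ (m + (r₁ + j))) (m+[n∸m]≡n (<⇒≤ r₂<n)))
            where lemma : ∀ r₂ r₁ m d j → r₂ + (r₁ + m + d + j) ≡ r₂ + d + (m + (r₁ + j))
                  lemma = solve-∀

          swap : ∀ p q j → p + (q + j) ≡ q + (p + j)
          swap = solve-∀

          %-shift : ∀ {y : ℕ → Word b} → Periodic n y → ∀ j → y (a % n + j) ≡ y (a + j)
          %-shift {y} py j = sym (trans (cong y (trans (cong (_+ j) (m≡m%n+[m/n]*n a n)) (lemma (a % n) (a / n * n) j))) (periodic-* py (a / n) (a % n + j)))
            where lemma : ∀ p q j → p + q + j ≡ q + (p + j)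
                  lemma = solve-∀

          -- Triangle inequality through the rotation of x₂ by r₁ + m, which is the chosen rotation
          -- of x₂ shifted by `a`.
          near-a : dist n x₁ (sh (a % n) x₁) ≤ θ⁺
          near-a = begin
            dist n x₁ (sh (a % n) x₁) ≡⟨ dist-cong n {x = x₁} (λ _ → refl) (%-shift (px zero)) ⟩
            dist n x₁ (sh a x₁) ≡⟨ dist-rotate n (px zero) (sh-periodic {x = x₁} a (px zero)) r₁ ⟨
            dist n (sh r₁ x₁) (sh r₁ (sh a x₁)) ≤⟨ dist-triangle n (sh r₁ x₁) (sh r₁ (sh m x₂)) (sh r₁ (sh a x₁)) ⟩
            dist n (sh r₁ x₁) (sh r₁ (sh m x₂)) + dist n (sh r₁ (sh m x₂)) (sh r₁ (sh a x₁)) ≤⟨ +-mono-≤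
                (≤-trans (≤-reflexive (dist-rotate n (px zero) (sh-periodic {x = x₂} m (px (suc zero))) r₁)) close)
                (≤-trans (≤-reflexive (trans (dist-sym n (sh r₁ (sh m x₂)) (sh r₁ (sh a x₁))) (trans
                  (dist-cong n {x′ = sh a (sh r₁ x₁)} {y′ = sh a (sh r₂ x₂)} (λ j → cong x₁ (swap a r₁ j)) (λ j → sym (trans (cong x₂ (r₂+a j)) (px (suc zero) (m + (r₁ + j))))))
                  (dist-rotate n (sh-periodic {x = x₁} r₁ (px zero)) (sh-periodic {x = x₂} r₂ (px (suc zero))) a)))) success) ⟩
            k + θ ≡⟨ +-comm k θ ⟩
            θ⁺ ∎
            where open ≤-Reasoning

          -- A longer list would force 2^L ≤ n, so the padding truncates no generator.
          shifts-length : length (generators (near? x₁) n n) ≤ L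
          shifts-length = ≮⇒≥ λ lt → <-irrefl refl (<-≤-trans n<2^L (≤-trans (^-monoʳ-≤ 2 (<⇒≤ lt)) (generators-length (near? x₁) n n it)))
            where it : NonZero n
                  it = >-nonZero (≤-<-trans z≤n r₁<n)

          module _ (Z₁ Z₂ : Vec (Word b) n) (con : Consistent θ⁺ H E (pick (per Z₁) (per Z₂))) where

            z : Fin 2 → ℕ → Word b
            z = pick (per Z₁) (per Z₂)

            pz : ∀ i → Periodic n (z i)
            pz zero = per-periodic Z₁
            pz (suc zero) = per-periodic Z₂

            -- The error of a candidate. The recorded differences constrain only this error, not the
            -- candidate itself.
            y : Fin 2 → ℕ → Word b
            y i j = z i j ⊕ x i j

            py : ∀ i → Periodic n (y i)
            py i j = cong₂ _⊕_ (pz i j) (px i j)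

            link = consistent-delta θ⁺ H {R = R} px E≡ (λ i → rotations< ts (x i)) ident con pz

            Fixed : ℕ → Set
            Fixed a = ∀ j → y zero (a + j) ≡ y zero j

            fixed-shift : ∀ g → dist n x₁ (sh (lookup (shifts x₁) g) x₁) ≤ θ⁺ → Fixed (lookup (shifts x₁) g)
            fixed-shift g near j = sym (subst (λ r → y zero j ≡ y zero (r + j)) look
              (link zero zero zero (suc (g ↑ˡ T)) (subst (λ r → dist n x₁ (sh r x₁) ≤ θ⁺) (sym look) near) j))
              where look : lookup (R zero) (suc (g ↑ˡ T)) ≡ lookup (shifts x₁) g
                    look = lookup-++ˡ (shifts x₁) _ g

            -- The stabiliser of the error contains `n` by periodicity and the generators by
            -- `fixed-shift`, hence every approximate period.
            fixed-a : Fixed (a % n)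
            fixed-a = generators-span (near? x₁) (stabiliser (y zero)) n n (py zero)
              (All.zipWith (λ (p , f) → f p) (generators-P (near? x₁) n n ,
                padTo-All⁻ {R = λ a → dist n x₁ (sh a x₁) ≤ θ⁺ → Fixed a} 0 L _ shifts-length fixed-shift))
              (a % n) (m%n<n a n) near-a

            look-t : ∀ i → lookup (R i) (suc (L ↑ʳ t)) ≡ rotation (lookup ts t) (x i)
            look-t i = trans (lookup-++ʳ (shifts (x i)) _ t) (lookup-map t _ ts)

            link-t : ∀ j → y zero (r₁ + j) ≡ y (suc zero) (r₂ + j)
            link-t j = subst₂ (λ r r′ → y zero (r + j) ≡ y (suc zero) (r′ + j)) (look-t zero) (look-t (suc zero))
              (link zero (suc zero) (suc (L ↑ʳ t)) (suc (L ↑ʳ t))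
                (subst₂ (λ r r′ → dist n (sh r x₁) (sh r′ x₂) ≤ θ⁺) (sym (look-t zero)) (sym (look-t (suc zero))) (≤-trans success (m≤m+n θ k))) j)

            aligned′ : ∀ j → y zero (r₁ + j) ≡ y (suc zero) (m + (r₁ + j))
            aligned′ j = begin
              y zero (r₁ + j) ≡⟨ fixed-a (r₁ + j) ⟨
              y zero (a % n + (r₁ + j)) ≡⟨ %-shift (py zero) (r₁ + j) ⟩
              y zero (a + (r₁ + j)) ≡⟨ cong (y zero) (swap a r₁ j) ⟩
              y zero (r₁ + (a + j)) ≡⟨ link-t (a + j) ⟩
              y (suc zero) (r₂ + (a + j)) ≡⟨ cong (y (suc zero)) (r₂+a j) ⟩
              y (suc zero) (n + (m + (r₁ + j))) ≡⟨ py (suc zero) (m + (r₁ + j)) ⟩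
              y (suc zero) (m + (r₁ + j)) ∎
              where open ≡-Reasoning

            aligned : ∀ j → y zero j ≡ y (suc zero) (m + j)
            aligned j = begin
              y zero j ≡⟨ py zero j ⟨
              y zero (n + j) ≡⟨ cong (y zero) r₁+ ⟨
              y zero (r₁ + (n ∸ r₁ + j)) ≡⟨ aligned′ (n ∸ r₁ + j) ⟩
              y (suc zero) (m + (r₁ + (n ∸ r₁ + j))) ≡⟨ cong (λ i → y (suc zero) (m + i)) r₁+ ⟩
              y (suc zero) (m + (n + j)) ≡⟨ sh-periodic {x = y (suc zero)} m (py (suc zero)) j ⟩
              y (suc zero) (m + j) ∎
              where
              open ≡-Reasoning
              r₁+ : r₁ + (n ∸ r₁ + j) ≡ n + j
              r₁+ = trans (sym (+-assoc r₁ (n ∸ r₁) j)) (cong (_+ j) (m+[n∸m]≡n (<⇒≤ r₁<n)))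

            -- The errors agree position by position at offset `m`, so they cancel and the two
            -- difference strings are equal.
            same-dist : dist n (per Z₁) (sh m (per Z₂)) ≡ dist n x₁ (sh m x₂)
            same-dist = ∑<-cong n λ j _ → trans (ne-⊕ (per Z₁ j) (per Z₂ (m + j)))
              (trans (cong (λ u → ne u 0ʷ) (⊕-exchange (per Z₁ j) (x₁ j) (per Z₂ (m + j)) (x₂ (m + j)) (aligned j)))
                     (sym (ne-⊕ (x₁ j) (x₂ (m + j)))))

        reconstruct-≡ : reconstruct θ⁺ H m E ≡ dist n x₁ (sh m x₂)
        reconstruct-≡ = ≤-antisym (Max≤ (Strings b n ⊗ Strings b n) λ (Z₁ , Z₂) → bound Z₁ Z₂ (consistent? θ⁺ H E (pick (per Z₁) (per Z₂)))) reconstruct-≥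
          where
          bound : ∀ Z₁ Z₂ (d : Dec (Consistent θ⁺ H E (pick (per Z₁) (per Z₂)))) →
                  (if does d then dist n (per Z₁) (sh m (per Z₂)) else 0) ≤ dist n x₁ (sh m x₂)
          bound Z₁ Z₂ (no _) = z≤n
          bound Z₁ Z₂ (yes con) = ≤-reflexive (same-dist Z₁ Z₂ con)

-- Error events of the linear hash and of the recoding

dist≡0⇒≡ : ∀ {b n} (x y : ℕ → Word b) → dist n x y ≡ 0 → ∀ j → j < n → x j ≡ y j
dist≡0⇒≡ {n = n} x y eq j j<n with x j ≟ʷ y j
... | yes p = p
... | no p with () ← subst₂ _≤_ (ne-≢ (x j) (y j) p) eq (≤∑< n (λ j → ne (x j) (y j)) j j<n)

dist≢0⇒≢ : ∀ {b} n (x y : ℕ → Word b) → dist n x y ≢ 0 → ∃ λ j → j < n × x j ≢ y j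
dist≢0⇒≢ zero x y d≢0 = contradiction refl d≢0
dist≢0⇒≢ (suc n) x y d≢0 with x 0 ≟ʷ y 0
... | no p = 0 , z<s , p
... | yes p with dist≢0⇒≢ n (x ∘ suc) (y ∘ suc) d≢0
...   | j , j<n , p′ = suc j , s<s j<n , p′

∑₂ : (Fin 2 → ℕ) → ℕ
∑₂ f = f zero + f (suc zero)

≤∑₂ : ∀ f i → f i ≤ ∑₂ f
≤∑₂ f zero       = m≤m+n _ _
≤∑₂ f (suc zero) = m≤n+m _ _

module _ {b n s : ℕ} .{{_ : NonZero n}} (θ : ℕ) where

  -- A count rather than an event: it bounds the indicator of failure, and its expectation is the
  -- union bound.
  misidentified : Vec (Vec (Word b) n) s → (ℕ → Word b) → ℕ
  misidentified H v = ∑ (Strings b n) λ z →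
    𝟙 (wt n (at z) ≤? θ) * (𝟙 (¬? (dist n (at z) v ≟ 0)) * 𝟙 (hash H (at z) ≟ʷ hash H v))

  misidentified≡0 : ∀ H v → misidentified H v ≡ 0 → Identifies θ H v
  misidentified≡0 H v eq z sparse same with dist n (at z) v ≟ 0
  ... | yes d≡0 = dist≡0⇒≡ (at z) v d≡0
  ... | no d≢0 with () ← subst₂ _≤_
        (cong₂ _*_ (𝟙-yes (wt n (at z) ≤? θ) sparse) (cong₂ _*_ (𝟙-yes (¬? (dist n (at z) v ≟ 0)) d≢0) (𝟙-yes (hash H (at z) ≟ʷ hash H v) same)))
        eq (≤∑ (Strings b n) _ z)

  private
    Ω = vec (Strings b n) s
    Z = (1 + n * ∣ vec bit b ∣) ^ θ

  -- At most `Z` sparse strings compete, and each one differing from `v` has the same hash with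
  -- probability 2^-s.
  ∑-misidentified : ∀ v → 2 ^ s * ∑ Ω (λ H → misidentified H v) ≤ Z * ∣ Ω ∣
  ∑-misidentified v = begin
    2 ^ s * ∑ Ω (λ H → misidentified H v) ≡⟨ cong (2 ^ s *_) (∑-swap Ω (Strings b n) _) ⟩
    2 ^ s * ∑ (Strings b n) (λ z → ∑ Ω λ H → sparse z * (differ z * 𝟙 (hash H (at z) ≟ʷ hash H v)))
      ≡⟨ cong (2 ^ s *_) (∑-cong (Strings b n) λ z → trans (∑-*ˡ Ω (sparse z) _) (cong (sparse z *_) (∑-*ˡ Ω (differ z) _))) ⟩
    2 ^ s * ∑ (Strings b n) (λ z → sparse z * (differ z * same z)) ≡⟨ ∑-*ˡ (Strings b n) (2 ^ s) _ ⟨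
    ∑ (Strings b n) (λ z → 2 ^ s * (sparse z * (differ z * same z))) ≡⟨ ∑-cong (Strings b n) (λ z → lemma (2 ^ s) (sparse z) (differ z) (same z)) ⟩
    ∑ (Strings b n) (λ z → sparse z * (differ z * (2 ^ s * same z))) ≤⟨ ∑-mono (Strings b n) (λ z → *-monoʳ-≤ (sparse z) (bound z (¬? (dist n (at z) v ≟ 0)))) ⟩
    ∑ (Strings b n) (λ z → sparse z * ∣ Ω ∣) ≡⟨ ∑-*ʳ (Strings b n) ∣ Ω ∣ sparse ⟩
    ∑ (Strings b n) sparse * ∣ Ω ∣ ≤⟨ *-monoˡ-≤ ∣ Ω ∣ (∑-sparse b n θ) ⟩
    Z * ∣ Ω ∣ ∎
    where
    open ≤-Reasoning
    sparse differ same : El (Strings b n) → ℕ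
    sparse z = 𝟙 (wt n (at z) ≤? θ)
    differ z = 𝟙 (¬? (dist n (at z) v ≟ 0))
    same z = ∑ Ω λ H → 𝟙 (hash H (at z) ≟ʷ hash H v)
    lemma : ∀ a b c d → a * (b * (c * d)) ≡ b * (c * (a * d))
    lemma = solve-∀
    bound : ∀ z (d : Dec (dist n (at z) v ≢ 0)) → 𝟙 d * (2 ^ s * same z) ≤ ∣ Ω ∣
    bound z (no _) = z≤n
    bound z (yes d≢0) with dist≢0⇒≢ n (at z) v d≢0
    ... | j , j<n , p = ≤-reflexive (trans (*-identityˡ (2 ^ s * same z)) (∑-hash s (at z) v j j<n p))

  ∑-∑₂ : ∀ (f : El Ω → Fin 2 → ℕ) c → (∀ i → 2 ^ s * ∑ Ω (λ H → f H i) ≤ c) → 2 ^ s * ∑ Ω (λ H → ∑₂ (f H)) ≤ 2 * c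
  ∑-∑₂ f c p = begin
    2 ^ s * ∑ Ω (λ H → f H zero + f H (suc zero)) ≡⟨ trans (cong (2 ^ s *_) (∑-+ Ω _ _)) (*-distribˡ-+ (2 ^ s) _ _) ⟩
    2 ^ s * ∑ Ω (λ H → f H zero) + 2 ^ s * ∑ Ω (λ H → f H (suc zero)) ≤⟨ +-mono-≤ (p zero) (p (suc zero)) ⟩
    c + c ≡⟨ cong (c +_) (+-identityʳ c) ⟨
    2 * c ∎
    where open ≤-Reasoning

  ∑-∑<-bound : ∀ (f : El Ω → ℕ → ℕ) c → (∀ r → 2 ^ s * ∑ Ω (λ H → f H r) ≤ c) → 2 ^ s * ∑ Ω (λ H → ∑< n (f H)) ≤ n * c
  ∑-∑<-bound f c p = ≤-trans (≤-reflexive (trans (cong (2 ^ s *_) (∑-∑< Ω n f)) (sym (∑<-*ˡ n (2 ^ s) _)))) (∑<-bound n λ r _ → p r)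

  misidentifications : Vec (Vec (Word b) n) s → (Fin 2 → ℕ → Word b) → ℕ
  misidentifications H x = ∑₂ λ i → ∑₂ λ i′ → ∑< n λ r → ∑< n λ r′ → misidentified H (sh r (x i) ⊞ sh r′ (x i′))

  misidentifications≡0 : ∀ H x → misidentifications H x ≡ 0 →
    ∀ i i′ r r′ → r < n → r′ < n → Identifies θ H (sh r (x i) ⊞ sh r′ (x i′))
  misidentifications≡0 H x eq i i′ r r′ r<n r′<n = misidentified≡0 H (sh r (x i) ⊞ sh r′ (x i′)) (n≤0⇒n≡0 (subst (f i i′ r r′ ≤_) eq
    (≤-trans (≤∑< n (f i i′ r) r′ r′<n) (≤-trans (≤∑< n (λ r → ∑< n (f i i′ r)) r r<n)
    (≤-trans (≤∑₂ (λ i′ → ∑< n λ r → ∑< n (f i i′ r)) i′) (≤∑₂ (λ i → ∑₂ λ i′ → ∑< n λ r → ∑< n (f i i′ r)) i))))))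
    where f = λ i i′ r r′ → misidentified H (sh r (x i) ⊞ sh r′ (x i′))

  ∑-misidentifications : ∀ x → 2 ^ s * ∑ Ω (λ H → misidentifications H x) ≤ 2 * (2 * (n * (n * (Z * ∣ Ω ∣))))
  ∑-misidentifications x = ∑-∑₂ _ _ λ i → ∑-∑₂ _ _ λ i′ → ∑-∑<-bound _ _ λ r → ∑-∑<-bound _ _ λ r′ → ∑-misidentified (sh r (x i) ⊞ sh r′ (x i′))

-- Recoding the alphabet and rotations as shifts

at-∷ʳ : ∀ {b n} (xs : Vec (Word b) n) x i → i < n → at (xs ∷ʳ x) i ≡ at xs i
at-∷ʳ (y ∷ xs) x zero _ = refl
at-∷ʳ (y ∷ xs) x (suc i) (s<s i<n) = at-∷ʳ xs x i i<n

at-∷ʳ-last : ∀ {b n} (xs : Vec (Word b) n) x → at (xs ∷ʳ x) n ≡ x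
at-∷ʳ-last [] x = refl
at-∷ʳ-last (y ∷ xs) x = at-∷ʳ-last xs x

per-at : ∀ {b n} .{{_ : NonZero n}} (X : Vec (Word b) n) i → i < n → per X i ≡ at X i
per-at X i i<n = cong (at X) (m<n⇒m%n≡m i<n)

cyc-cycInv : ∀ {σ n} (S : Str σ (suc n)) → cyc (cycInv S) ≡ S
cyc-cycInv (x ∷ S) = sym (proj₂ (proj₂ (initLast (x ∷ S))))

-- For strings of length 1 + n, where one inverse rotation equals n rotations.
offset : ℕ → ℤ → ℕ
offset n (pos m)    = m
offset n (negsuc m) = suc m * n

module _ {σ b : ℕ} where

  recode : ∀ {n} → Vec (Word b) σ → Str σ n → Vec (Word b) n
  recode h S = map (lookup h) S

  -- The only loss caused by recoding: distinct letters with equal codes. Distances never grow, and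
  -- they shrink by at most this number.
  collisions : ∀ {n} → Str σ n → Str σ n → Vec (Word b) σ → ℕ
  collisions []      []      h = 0
  collisions (x ∷ S) (y ∷ U) h = 𝟙 (¬? (x ≟ᶠ y)) * 𝟙 (lookup h x ≟ʷ lookup h y) + collisions S U h

  dist≤Ham : ∀ {n} (S U : Str σ n) h → dist n (at (recode h S)) (at (recode h U)) ≤ Ham S U
  dist≤Ham [] [] h = z≤n
  dist≤Ham (x ∷ S) (y ∷ U) h = +-mono-≤ (here (x ≟ᶠ y)) (dist≤Ham S U h)
    where
    here : (d : Dec (x ≡ y)) → ne (lookup h x) (lookup h y) ≤ (if does d then 0 else 1)
    here (yes refl) = ≤-reflexive (ne-≡ (lookup h x) (lookup h x) refl)
    here (no _) with lookup h x ≟ʷ lookup h y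
    ... | yes _ = z≤n
    ... | no _ = ≤-refl

  Ham≤dist : ∀ {n} (S U : Str σ n) h → Ham S U ≤ dist n (at (recode h S)) (at (recode h U)) + collisions S U h
  Ham≤dist [] [] h = z≤n
  Ham≤dist {suc n} (x ∷ S) (y ∷ U) h = ≤-trans (+-mono-≤ (here (x ≟ᶠ y) (lookup h x ≟ʷ lookup h y)) (Ham≤dist S U h))
    (≤-reflexive (lemma (ne (lookup h x) (lookup h y)) (𝟙 (¬? (x ≟ᶠ y)) * 𝟙 (lookup h x ≟ʷ lookup h y)) (dist n (at (recode h S)) (at (recode h U))) (collisions S U h)))
    where
    lemma : ∀ p q r s → p + q + (r + s) ≡ p + r + (q + s)
    lemma = solve-∀
    here : (d : Dec (x ≡ y)) (e : Dec (lookup h x ≡ lookup h y)) →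
           (if does d then 0 else 1) ≤ (if does e then 0 else 1) + 𝟙 (¬? d) * 𝟙 e
    here (yes _) _ = z≤n
    here (no _) (yes _) = ≤-refl
    here (no _) (no _) = ≤-refl

  -- Linearity of expectation: a pair of distinct letters collides with probability 2^-b.
  ∑-collisions : ∀ {n} (S U : Str σ n) → ∣ vec bit b ∣ * ∑ (vec (vec bit b) σ) (collisions S U) ≤ n * ∣ vec (vec bit b) σ ∣
  ∑-collisions [] [] = ≤-reflexive (trans (cong (∣ vec bit b ∣ *_) (trans (∑-const (vec (vec bit b) σ) 0) (*-zeroʳ ∣ vec (vec bit b) σ ∣))) (*-zeroʳ ∣ vec bit b ∣))
  ∑-collisions {suc n} (x ∷ S) (y ∷ U) = begin
    W * ∑ Ω (λ h → 𝟙 (¬? (x ≟ᶠ y)) * 𝟙 (lookup h x ≟ʷ lookup h y) + collisions S U h) ≡⟨ cong (W *_) (∑-+ Ω _ _) ⟩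
    W * (∑ Ω (λ h → 𝟙 (¬? (x ≟ᶠ y)) * 𝟙 (lookup h x ≟ʷ lookup h y)) + ∑ Ω (collisions S U)) ≡⟨ *-distribˡ-+ W _ _ ⟩
    W * ∑ Ω (λ h → 𝟙 (¬? (x ≟ᶠ y)) * 𝟙 (lookup h x ≟ʷ lookup h y)) + W * ∑ Ω (collisions S U)
      ≤⟨ +-mono-≤ (≤-trans (≤-reflexive (cong (W *_) (∑-*ˡ Ω (𝟙 (¬? (x ≟ᶠ y))) _))) (here (¬? (x ≟ᶠ y)))) (∑-collisions S U) ⟩
    ∣ Ω ∣ + n * ∣ Ω ∣ ∎
    where
    open ≤-Reasoning
    Ω = vec (vec bit b) σ
    W = ∣ vec bit b ∣
    same = ∑ Ω λ h → 𝟙 (lookup h x ≟ʷ lookup h y)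
    uniform : x ≢ y → W * same ≡ ∣ Ω ∣
    uniform x≢y = *-cancelˡ-≡ _ _ W {{m^n≢0 2 (dim (vec bit b))}} (trans (sym (*-assoc W W same)) (trans
      (∑-lookup₂ (vec bit b) x y x≢y (λ u v → 𝟙 (u ≟ʷ v)))
      (trans (cong (∣ Ω ∣ *_) (trans (∑-swap (vec bit b) (vec bit b) (λ u v → 𝟙 (u ≟ʷ v))) (trans (∑-cong (vec bit b) λ v → ∑-≟ʷ v) (trans (∑-const (vec bit b) 1) (*-identityʳ W)))))
             (*-comm ∣ Ω ∣ W))))
    here : (d : Dec (x ≢ y)) → W * (𝟙 d * same) ≤ ∣ Ω ∣
    here (no _) = ≤-trans (≤-reflexive (*-zeroʳ W)) z≤n
    here (yes x≢y) = ≤-reflexive (trans (cong (W *_) (*-identityˡ same)) (uniform x≢y))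

  module _ {n : ℕ} (h : Vec (Word b) σ) where

    per-cyc : ∀ (S : Str σ (suc n)) i → per (recode h (cyc S)) i ≡ per (recode h S) (suc i)
    per-cyc (x ∷ S) = periodic-ext (per-periodic (recode h (S ∷ʳ x))) (sh-periodic {x = per (recode h (x ∷ S))} 1 (per-periodic (recode h (x ∷ S)))) eq
      where
      eq : ∀ i → i < suc n → per (recode h (S ∷ʳ x)) i ≡ per (recode h (x ∷ S)) (suc i)
      eq i i<1+n rewrite map-∷ʳ (lookup h) x S with i ≟ n
      ... | yes refl = trans (per-at (recode h S ∷ʳ lookup h x) n i<1+n) (trans (at-∷ʳ-last (recode h S) (lookup h x))
              (cong (at (recode h (x ∷ S))) (sym (n%n≡0 (suc n)))))
      ... | no i≢n = trans (per-at (recode h S ∷ʳ lookup h x) i i<1+n) (trans (at-∷ʳ (recode h S) (lookup h x) i i<n)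
              (sym (per-at (recode h (x ∷ S)) (suc i) (s<s i<n))))
        where i<n = ≤∧≢⇒< (s≤s⁻¹ i<1+n) i≢n

    per-cycInv : ∀ (S : Str σ (suc n)) i → per (recode h (cycInv S)) i ≡ per (recode h S) (n + i)
    per-cycInv S i = trans (sym (per-periodic (recode h (cycInv S)) i))
      (trans (sym (per-cyc (cycInv S) (n + i))) (cong (λ U → per (recode h U) (n + i)) (cyc-cycInv S)))

    per-iter-cyc : ∀ m (S : Str σ (suc n)) i → per (recode h (iter cyc m S)) i ≡ per (recode h S) (m + i)
    per-iter-cyc zero S i = refl
    per-iter-cyc (suc m) S i = trans (per-cyc (iter cyc m S) i) (trans (per-iter-cyc m S (suc i)) (cong (per (recode h S)) (+-suc m i)))

    per-iter-cycInv : ∀ m (S : Str σ (suc n)) i → per (recode h (iter cycInv m S)) i ≡ per (recode h S) (m * n + i)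
    per-iter-cycInv zero S i = refl
    per-iter-cycInv (suc m) S i = trans (per-cycInv (iter cycInv m S) i) (trans (per-iter-cycInv m S (n + i))
      (cong (per (recode h S)) (trans (sym (+-assoc (m * n) n i)) (cong (_+ i) (+-comm (m * n) n)))))

    per-cycPow : ∀ m (S : Str σ (suc n)) i → per (recode h (cycPow m S)) i ≡ per (recode h S) (offset n m + i)
    per-cycPow (pos m)    = per-iter-cyc m
    per-cycPow (negsuc m) = per-iter-cycInv (suc m)

    dist-cycPow : ∀ m (S U : Str σ (suc n)) →
      dist (suc n) (per (recode h S)) (sh (offset n m) (per (recode h U))) ≡
      dist (suc n) (at (recode h S)) (at (recode h (cycPow m U)))
    dist-cycPow m S U = ∑<-cong (suc n) λ i i<n → cong₂ ne (per-at (recode h S) i i<n)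
      (trans (sym (per-cycPow m U i)) (per-at (recode h (cycPow m U)) i i<n))

-- The sketch

∑-⊗₁ : ∀ a b c (f : El a → ℕ) → c * ∑ a f ≤ ∣ a ∣ → c * ∑ (a ⊗ b) (λ (x , y) → f x) ≤ ∣ a ⊗ b ∣
∑-⊗₁ a b c f le = begin
  c * ∑ a (λ x → ∑ b λ y → f x) ≡⟨ cong (c *_) (trans (∑-cong a λ x → ∑-const b (f x)) (∑-*ˡ a ∣ b ∣ f)) ⟩
  c * (∣ b ∣ * ∑ a f) ≡⟨ lemma c ∣ b ∣ (∑ a f) ⟩
  c * ∑ a f * ∣ b ∣ ≤⟨ *-monoˡ-≤ ∣ b ∣ le ⟩
  ∣ a ∣ * ∣ b ∣ ≡⟨ ^-distribˡ-+-* 2 (dim a) (dim b) ⟨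
  ∣ a ⊗ b ∣ ∎
  where
  open ≤-Reasoning
  lemma : ∀ p q r → p * (q * r) ≡ p * r * q
  lemma = solve-∀

∑-⊗₂ : ∀ a b c (f : El a → El b → ℕ) → (∀ x → c * ∑ b (f x) ≤ ∣ b ∣) → c * ∑ (a ⊗ b) (λ (x , y) → f x y) ≤ ∣ a ⊗ b ∣
∑-⊗₂ a b c f le = begin
  c * ∑ a (λ x → ∑ b (f x)) ≡⟨ ∑-*ˡ a c _ ⟨
  ∑ a (λ x → c * ∑ b (f x)) ≤⟨ ∑-mono a le ⟩
  ∑ a (λ x → ∣ b ∣) ≡⟨ ∑-const a ∣ b ∣ ⟩
  ∣ a ∣ * ∣ b ∣ ≡⟨ ^-distribˡ-+-* 2 (dim a) (dim b) ⟨
  ∣ a ⊗ b ∣ ∎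
  where open ≤-Reasoning

∏ᵛ≡0 : ∀ {A : Set} {n} (f : A → ℕ) (v : Vec A n) → ∏ᵛ f v ≡ 0 → ∃ λ i → f (lookup v i) ≡ 0
∏ᵛ≡0 f (x ∷ v) eq with m*n≡0⇒m≡0∨n≡0 (f x) eq
... | inj₁ fx≡0 = zero , fx≡0
... | inj₂ rest with ∏ᵛ≡0 f v rest
...   | i , eq′ = suc i , eq′

-- The product of the failure indicators is 1 only if all trials fail, which has probability at most
-- (d/e)^N ≤ 1/c.
amplify : ∀ a N (f : El a → ℕ) c d e .{{_ : NonZero d}} → e * ∑ a f ≤ d * ∣ a ∣ → c * d ^ N ≤ e ^ N →
          c * ∑ (vec a N) (∏ᵛ f) ≤ ∣ vec a N ∣
amplify a N f c d e le gap = *-cancelˡ-≤ (d ^ N) {{m^n≢0 d N}} (begin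
  d ^ N * (c * ∑ (vec a N) (∏ᵛ f)) ≡⟨ cong (λ z → d ^ N * (c * z)) (∑-∏ᵛ a N f) ⟩
  d ^ N * (c * ∑ a f ^ N) ≡⟨ lemma (d ^ N) c _ ⟩
  c * d ^ N * ∑ a f ^ N ≤⟨ *-monoˡ-≤ (∑ a f ^ N) gap ⟩
  e ^ N * ∑ a f ^ N ≡⟨ *-^ e (∑ a f) N ⟩
  (e * ∑ a f) ^ N ≤⟨ ^-monoˡ-≤ N le ⟩
  (d * ∣ a ∣) ^ N ≡⟨ *-^ d ∣ a ∣ N ⟨
  d ^ N * ∣ a ∣ ^ N ≡⟨ cong (d ^ N *_) (∣vec∣ a N) ⟨
  d ^ N * ∣ vec a N ∣ ∎)
  where
  open ≤-Reasoning
  lemma : ∀ p q r → p * (q * r) ≡ q * p * r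
  lemma = solve-∀

-- An error count that certifies correctness when it vanishes dominates the indicator of a wrong
-- answer.
wrong≤ : ∀ c e → (e ≡ 0 → c ≡ true) → 𝟙 ((if c then false else true) ≟ᵇ true) ≤ e
wrong≤ true e _ = z≤n
wrong≤ false zero p with () ← p refl
wrong≤ false (suc e) _ = s≤s z≤n

correct-exact : ∀ {h out k} → h ≤ k → out ≡ h → (if h ≤ᵇ k then out ≡ᵇ h else (suc k ≤ᵇ out)) ≡ true
correct-exact {h} {out} {k} h≤k out≡h rewrite Equivalence.to T-≡ (≤⇒≤ᵇ h≤k) = Equivalence.to T-≡ (≡⇒≡ᵇ out h out≡h)

correct-far : ∀ {h out k} → ¬ h ≤ k → h ≤ out → (if h ≤ᵇ k then out ≡ᵇ h else (suc k ≤ᵇ out)) ≡ true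
correct-far {h} {out} {k} h≰k h≤out with h ≤ᵇ k in eq
... | true  = contradiction (≤ᵇ⇒≤ h k (Equivalence.from T-≡ eq)) h≰k
... | false = Equivalence.to T-≡ (≤⇒≤ᵇ (<-≤-trans (≰⇒> h≰k) h≤out))

module Scheme (σ n⁻ k b q ℓ s L T w : ℕ) (n<2^L : suc n⁻ < 2 ^ L) where

  n θ : ℕ
  n = suc n⁻
  θ = ∣ vec bit q ∣ * w

  open Core {b} {n} {q} {ℓ} {s} L T θ k n<2^L public

  -- The alphabet hash comes first: once it is fixed, so are the recoded strings, and the other two
  -- components are independent of them.
  Ωh ΩH ΩT Ω : Space
  Ωh = vec (vec bit b) σ
  ΩH = vec (Strings b n) s
  ΩT = vec (Trial b n q ℓ) T
  Ω  = Ωh ⊗ (ΩH ⊗ ΩT)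

  summary : El Ω → Str σ n → Vec (ℕ × Word s) (suc (L + T))
  summary (h , H , ts) S = entries θ⁺ H (rotations ts (per (recode h S))) (per (recode h S))

  sketch : Sketcher σ n (dim Ω)
  sketch seed S = serialise {L = L} (summary (fromSeed Ω seed) S)

  decode : Decoder (dim Ω)
  decode seed l₁ l₂ m = let (h , H , ts) = fromSeed Ω seed in
    reconstruct θ⁺ H {suc (L + T)} (offset n⁻ m) (pick (parse {L = L} l₁) (parse {L = L} l₂))

  length-sketch : ∀ seed S → length (sketch seed S) ≡ suc (L + T) * (L + s)
  length-sketch seed S = trans (length-toList flat) (length-flat flat)
    where
    flat = concat (map (λ (r , y) → bin L r ++ y) (summary (fromSeed Ω seed) S))
    length-flat : ∀ {A : Set} {n} (v : Vec A n) → Vec.length v ≡ n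
    length-flat [] = refl
    length-flat (x ∷ v) = cong suc (length-flat v)

  parse-sketch : ∀ seed S → parse {L = L} (sketch seed S) ≡ summary (fromSeed Ω seed) S
  parse-sketch seed S = parse-serialise _ λ p → <-trans (subst (_< n) (sym (cong proj₁ (lookup-map p _ (rotations ts x)))) (rotations< ts x p)) n<2^L
    where
    ω = fromSeed Ω seed
    ts = proj₂ (proj₂ ω)
    x = per (recode (proj₁ ω) S)

  module _ (S₁ S₂ : Str σ n) (m : ℤ) where

    private
      U = cycPow m S₂
      M = offset n⁻ m
      x : El Ωh → Fin 2 → ℕ → Word b
      x h = pick (per (recode h S₁)) (per (recode h S₂))

    e₁ : El Ωh → ℕ
    e₁ h = collisions S₁ U h

    e₂ : El Ωh → El ΩH → ℕ
    e₂ h H = misidentifications θ⁺ H (x h)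

    e₃ : El Ωh → El ΩT → ℕ
    e₃ h ts = ∏ᵛ (λ t → 𝟙 (¬? (aligned? θ (x h zero) (x h (suc zero)) t))) ts

    module _ (seed : Seed (dim Ω)) where

      private
        h = proj₁ (fromSeed Ω seed)
        H = proj₁ (proj₂ (fromSeed Ω seed))
        ts = proj₂ (proj₂ (fromSeed Ω seed))
        D = dist n (x h zero) (sh M (x h (suc zero)))
        E : Fin 2 → Vec (ℕ × Word s) (suc (L + T))
        E = pick (parse {L = L} (sketch seed S₁)) (parse {L = L} (sketch seed S₂))
        E≡ : ∀ i → E i ≡ entries θ⁺ H (rotations ts (x h i)) (x h i)
        E≡ zero = parse-sketch seed S₁
        E≡ (suc zero) = parse-sketch seed S₂

        D≤Ham : D ≤ Ham S₁ U
        D≤Ham = ≤-trans (≤-reflexive (dist-cycPow h m S₁ S₂)) (dist≤Ham S₁ U h)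

        D≡Ham : e₁ h ≡ 0 → D ≡ Ham S₁ U
        D≡Ham eq = ≤-antisym D≤Ham (≤-trans (Ham≤dist S₁ U h)
          (≤-reflexive (trans (cong₂ _+_ (sym (dist-cycPow h m S₁ S₂)) eq) (+-identityʳ D))))

        ident : e₂ h H ≡ 0 → ∀ i i′ r r′ → r < n → r′ < n → Identifies θ⁺ H (sh r (x h i) ⊞ sh r′ (x h i′))
        ident = misidentifications≡0 θ⁺ H (x h)

      correct-when-far : ¬ Ham S₁ U ≤ k → e₁ h + e₂ h H ≡ 0 → correctOn k sketch decode S₁ S₂ m seed ≡ true
      correct-when-far far eq = correct-far {Ham S₁ U} {decode seed (sketch seed S₁) (sketch seed S₂) m} far (≤-trans (≤-reflexive (sym (D≡Ham (m+n≡0⇒m≡0 _ eq))))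
        (reconstruct-≥ H ts (recode h S₁) (recode h S₂) M {E} E≡ (ident (m+n≡0⇒n≡0 (e₁ h) eq))))

      correct-when-close : Ham S₁ U ≤ k → e₁ h + e₂ h H + e₃ h ts ≡ 0 → correctOn k sketch decode S₁ S₂ m seed ≡ true
      correct-when-close close eq = correct-exact {Ham S₁ U} {decode seed (sketch seed S₁) (sketch seed S₂) m} close (trans out (D≡Ham (m+n≡0⇒m≡0 _ eq₁₂)))
        where
        eq₁₂ = m+n≡0⇒m≡0 (e₁ h + e₂ h H) eq
        aligned : ∃ λ t → dist n (sh (rotation (lookup ts t) (x h zero)) (x h zero)) (sh (rotation (lookup ts t) (x h (suc zero))) (x h (suc zero))) ≤ θ
        aligned = proj₁ failing , dec-true (aligned? θ (x h zero) (x h (suc zero)) (lookup ts (proj₁ failing))) (proj₂ failing)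
          where
          failing = ∏ᵛ≡0 (λ t → 𝟙 (¬? (aligned? θ (x h zero) (x h (suc zero)) t))) ts (m+n≡0⇒n≡0 (e₁ h + e₂ h H) eq)
          dec-true : ∀ {P : Set} (p? : Dec P) → 𝟙 (¬? p?) ≡ 0 → P
          dec-true (yes p) _ = p
          dec-true (no _) ()
        out : decode seed (sketch seed S₁) (sketch seed S₂) m ≡ D
        out = reconstruct-≡ H ts (recode h S₁) (recode h S₂) M {E} E≡ (ident (m+n≡0⇒n≡0 (e₁ h) eq₁₂))
                (≤-trans D≤Ham close) (proj₁ aligned) (proj₂ aligned)

  module _
    (4k≤Q : 4 * k ≤ ∣ vec bit q ∣) (4n≤P : 4 * n ≤ ∣ vec bit ℓ ∣) (P≤8n : ∣ vec bit ℓ ∣ ≤ 8 * n)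
    (64n²≤2^w : 64 * (n * n) ≤ 2 ^ w)
    (b-large : 4 * n * n ≤ ∣ vec bit b ∣)
    (s-large : 4 * n * (2 * (2 * (n * (n * (1 + n * ∣ vec bit b ∣) ^ θ⁺)))) ≤ 2 ^ s)
    (T-large : 4 * n * 63 ^ T ≤ 64 ^ T) where

    private
      module _ (S₁ S₂ : Str σ n) (m : ℤ) where
        f₁ f₂ f₃ : El Ω → ℕ
        f₁ (h , H , ts) = e₁ S₁ S₂ m h
        f₂ (h , H , ts) = e₂ S₁ S₂ m h H
        f₃ (h , H , ts) = e₃ S₁ S₂ m h ts

        bound₁ : 4 * n * ∑ Ω f₁ ≤ ∣ Ω ∣
        bound₁ = ∑-⊗₁ Ωh (ΩH ⊗ ΩT) (4 * n) (e₁ S₁ S₂ m) (*-cancelˡ-≤ n (begin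
          n * (4 * n * E) ≡⟨ lemma n E ⟩
          4 * n * n * E ≤⟨ *-monoˡ-≤ E b-large ⟩
          ∣ vec bit b ∣ * E ≤⟨ ∑-collisions {b = b} S₁ (cycPow m S₂) ⟩
          n * ∣ Ωh ∣ ∎))
          where
          open ≤-Reasoning
          E = ∑ Ωh (e₁ S₁ S₂ m)
          lemma : ∀ n e → n * (4 * n * e) ≡ 4 * n * n * e
          lemma = solve-∀

        bound₂ : 4 * n * ∑ Ω f₂ ≤ ∣ Ω ∣
        bound₂ = ∑-⊗₂ Ωh (ΩH ⊗ ΩT) (4 * n) (λ h (H , ts) → e₂ S₁ S₂ m h H) λ h → ∑-⊗₁ ΩH ΩT (4 * n) (e₂ S₁ S₂ m h)
          (cancel (∑ ΩH (e₂ S₁ S₂ m h)) ((1 + n * ∣ vec bit b ∣) ^ θ⁺) {{m^n≢0 (1 + n * ∣ vec bit b ∣) θ⁺}} s-large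
            (∑-misidentifications {b} {n} {s} θ⁺ (pick (per (recode h S₁)) (per (recode h S₂)))))
          where
          open ≤-Reasoning
          cancel : ∀ E Z .{{_ : NonZero Z}} → 4 * n * (2 * (2 * (n * (n * Z)))) ≤ 2 ^ s →
                   2 ^ s * E ≤ 2 * (2 * (n * (n * (Z * ∣ ΩH ∣)))) → 4 * n * E ≤ ∣ ΩH ∣
          cancel E Z large le = *-cancelˡ-≤ (2 * (2 * (n * (n * Z))))
            {{m*n≢0 2 _ {{it}} {{m*n≢0 2 _ {{it}} {{m*n≢0 n _ {{it}} {{m*n≢0 n Z}}}}}}}} (begin
            2 * (2 * (n * (n * Z))) * (4 * n * E) ≡⟨ lemma (2 * (2 * (n * (n * Z)))) (4 * n) E ⟩
            4 * n * (2 * (2 * (n * (n * Z)))) * E ≤⟨ *-monoˡ-≤ E large ⟩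
            2 ^ s * E ≤⟨ le ⟩
            2 * (2 * (n * (n * (Z * ∣ ΩH ∣)))) ≡⟨ lemma′ n Z ∣ ΩH ∣ ⟩
            2 * (2 * (n * (n * Z))) * ∣ ΩH ∣ ∎)
            where
            it : ∀ {n} → NonZero (suc n)
            it = _
            lemma : ∀ p q r → p * (q * r) ≡ q * p * r
            lemma = solve-∀
            lemma′ : ∀ n z o → 2 * (2 * (n * (n * (z * o)))) ≡ 2 * (2 * (n * (n * z))) * o
            lemma′ = solve-∀

        bound₃ : Ham S₁ (cycPow m S₂) ≤ k → 4 * n * ∑ Ω f₃ ≤ ∣ Ω ∣
        bound₃ close = ∑-⊗₂ Ωh (ΩH ⊗ ΩT) (4 * n) (λ h (H , ts) → e₃ S₁ S₂ m h ts) λ h →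
          ∑-⊗₂ ΩH ΩT (4 * n) (λ H ts → e₃ S₁ S₂ m h ts) λ H →
          amplify (Trial b n q ℓ) T _ (4 * n) 63 64
            (∑-failure {q = q} {ℓ = ℓ} (per-periodic (recode h S₁)) (per-periodic (recode h S₂)) (offset n⁻ m) k w
              (≤-trans (≤-reflexive (dist-cycPow h m S₁ S₂)) (≤-trans (dist≤Ham S₁ (cycPow m S₂) h) close))
              4k≤Q 4n≤P P≤8n 64n²≤2^w)
            T-large

    sketch-correct : IsECS σ n k 1 1 (dim Ω) sketch decode
    sketch-correct S₁ S₂ m = begin
      count bad ^ 1 * n ^ 1 ≡⟨ cong₂ _*_ (^-identityʳ (count bad)) (^-identityʳ n) ⟩
      count bad * n ≡⟨ cong (_* n) (count-∑ bad) ⟩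
      B * n ≤⟨ *-cancelˡ-≤ 4 (total (Ham S₁ (cycPow m S₂) ≤? k)) ⟩
      ∣ Ω ∣ ≡⟨ ^-identityʳ ∣ Ω ∣ ⟨
      ∣ Ω ∣ ^ 1 ∎
      where
      open ≤-Reasoning
      bad : Seed (dim Ω) → Bool
      bad = λ seed → if correctOn k sketch decode S₁ S₂ m seed then false else true
      B = ∑ (vec bit (dim Ω)) (λ seed → 𝟙 (bad seed ≟ᵇ true))
      g₁ = f₁ S₁ S₂ m
      g₂ = f₂ S₁ S₂ m
      g₃ = f₃ S₁ S₂ m
      lemma : ∀ b n → 4 * (b * n) ≡ 4 * n * b
      lemma = solve-∀
      -- Each of the three error events has probability at most 1/(4n), so their sum stays below
      -- 1/n. For far pairs only the first two enter.
      total : Dec (Ham S₁ (cycPow m S₂) ≤ k) → 4 * (B * n) ≤ 4 * ∣ Ω ∣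
      total (yes close) = begin
        4 * (B * n) ≡⟨ lemma B n ⟩
        4 * n * B ≤⟨ *-monoʳ-≤ (4 * n) (∑-mono (vec bit (dim Ω)) λ seed → wrong≤ (correctOn k sketch decode S₁ S₂ m seed) _ (correct-when-close S₁ S₂ m seed close)) ⟩
        4 * n * ∑ (vec bit (dim Ω)) (λ seed → g₁ (fromSeed Ω seed) + g₂ (fromSeed Ω seed) + g₃ (fromSeed Ω seed))
          ≡⟨ cong (4 * n *_) (∑-fromSeed Ω (λ ω → g₁ ω + g₂ ω + g₃ ω)) ⟩
        4 * n * ∑ Ω (λ ω → g₁ ω + g₂ ω + g₃ ω) ≡⟨ cong (4 * n *_) (trans (∑-+ Ω _ _) (cong (_+ ∑ Ω g₃) (∑-+ Ω g₁ g₂))) ⟩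
        4 * n * (∑ Ω g₁ + ∑ Ω g₂ + ∑ Ω g₃) ≡⟨ trans (*-distribˡ-+ (4 * n) (∑ Ω g₁ + ∑ Ω g₂) _) (cong (_+ 4 * n * ∑ Ω g₃) (*-distribˡ-+ (4 * n) (∑ Ω g₁) _)) ⟩
        4 * n * ∑ Ω g₁ + 4 * n * ∑ Ω g₂ + 4 * n * ∑ Ω g₃ ≤⟨ +-mono-≤ (+-mono-≤ (bound₁ S₁ S₂ m) (bound₂ S₁ S₂ m)) (bound₃ S₁ S₂ m close) ⟩
        ∣ Ω ∣ + ∣ Ω ∣ + ∣ Ω ∣ ≤⟨ three ∣ Ω ∣ ⟩
        4 * ∣ Ω ∣ ∎
        where
        three : ∀ o → o + o + o ≤ 4 * o
        three o = ≤-trans (m≤m+n (o + o + o) o) (≤-reflexive (l o))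
          where l : ∀ o → o + o + o + o ≡ 4 * o
                l = solve-∀
      total (no far) = begin
        4 * (B * n) ≡⟨ lemma B n ⟩
        4 * n * B ≤⟨ *-monoʳ-≤ (4 * n) (∑-mono (vec bit (dim Ω)) λ seed → wrong≤ (correctOn k sketch decode S₁ S₂ m seed) _ (correct-when-far S₁ S₂ m seed far)) ⟩
        4 * n * ∑ (vec bit (dim Ω)) (λ seed → g₁ (fromSeed Ω seed) + g₂ (fromSeed Ω seed))
          ≡⟨ cong (4 * n *_) (∑-fromSeed Ω (λ ω → g₁ ω + g₂ ω)) ⟩
        4 * n * ∑ Ω (λ ω → g₁ ω + g₂ ω) ≡⟨ cong (4 * n *_) (∑-+ Ω g₁ g₂) ⟩
        4 * n * (∑ Ω g₁ + ∑ Ω g₂) ≡⟨ *-distribˡ-+ (4 * n) (∑ Ω g₁) _ ⟩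
        4 * n * ∑ Ω g₁ + 4 * n * ∑ Ω g₂ ≤⟨ +-mono-≤ (bound₁ S₁ S₂ m) (bound₂ S₁ S₂ m) ⟩
        ∣ Ω ∣ + ∣ Ω ∣ ≤⟨ two ∣ Ω ∣ ⟩
        4 * ∣ Ω ∣ ∎
        where
        two : ∀ o → o + o ≤ 4 * o
        two o = ≤-trans (m≤m+n (o + o) (o + o)) (≤-reflexive (l o))
          where l : ∀ o → o + o + (o + o) ≡ 4 * o
                l = solve-∀

  -- The sketch has the same length for every seed and string, so the bad event is empty.
  sketch-size : ∀ {sz} → suc (L + T) * (L + s) ≤ sz → HasSize σ n 1 1 (dim Ω) sz sketch
  sketch-size {sz} le S = ≤-trans (≤-reflexive (cong (λ c → c ^ 1 * n ^ 1) none)) z≤n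
    where
    short : ∀ seed → 𝟙 ((suc sz ≤ᵇ length (sketch seed S)) ≟ᵇ true) ≡ 0
    short seed = 𝟙-no ((suc sz ≤ᵇ length (sketch seed S)) ≟ᵇ true) λ eq →
      <-irrefl refl (<-≤-trans (≤ᵇ⇒≤ (suc sz) _ (Equivalence.from T-≡ eq)) (≤-trans (≤-reflexive (length-sketch seed S)) le))
    none : count (λ seed → suc sz ≤ᵇ length (sketch seed S)) ≡ 0
    none = trans (count-∑ (λ seed → suc sz ≤ᵇ length (sketch seed S))) (trans (∑-cong (vec bit (dim Ω)) short) (trans (∑-const (vec bit (dim Ω)) 0) (*-zeroʳ ∣ vec bit (dim Ω) ∣)))

-- Choice of parameters

n<2^1+log : ∀ n → n < 2 ^ suc ⌊log₂ n ⌋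
n<2^1+log n = ≰⇒> λ le → <-irrefl refl (subst (_≤ ⌊log₂ n ⌋) (⌊log₂[2^n]⌋≡n (suc ⌊log₂ n ⌋)) (⌊log₂⌋-mono-≤ le))

2^log≤n : ∀ n → 1 ≤ n → 2 ^ ⌊log₂ n ⌋ ≤ n
2^log≤n = <-rec _ step
  where
  double : ∀ l → 2 ^ l ≤ 2 * 2 ^ (l ∸ 1)
  double zero = s≤s z≤n
  double (suc l) = ≤-refl
  step : ∀ n → (∀ {m} → m < n → 1 ≤ m → 2 ^ ⌊log₂ m ⌋ ≤ m) → 1 ≤ n → 2 ^ ⌊log₂ n ⌋ ≤ n
  step (suc zero) rec _ = s≤s z≤n
  step n@(suc (suc n′)) rec _ = begin
    2 ^ ⌊log₂ n ⌋ ≤⟨ double ⌊log₂ n ⌋ ⟩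
    2 * 2 ^ (⌊log₂ n ⌋ ∸ 1) ≡⟨ cong (λ l → 2 * 2 ^ l) (⌊log₂⌊n/2⌋⌋≡⌊log₂n⌋∸1 n) ⟨
    2 * 2 ^ ⌊log₂ ⌊ n /2⌋ ⌋ ≤⟨ *-monoʳ-≤ 2 (rec (⌊n/2⌋<n (suc n′)) (s≤s z≤n)) ⟩
    2 * ⌊ n /2⌋ ≡⟨ cong (⌊ n /2⌋ +_) (+-identityʳ ⌊ n /2⌋) ⟩
    ⌊ n /2⌋ + ⌊ n /2⌋ ≤⟨ +-monoʳ-≤ ⌊ n /2⌋ (⌊n/2⌋≤⌈n/2⌉ n) ⟩
    ⌊ n /2⌋ + ⌈ n /2⌉ ≡⟨ ⌊n/2⌋+⌈n/2⌉≡n n ⟩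
    n ∎
    where open ≤-Reasoning

∣word∣ : ∀ b → ∣ vec bit b ∣ ≡ 2 ^ b
∣word∣ b = cong (2 ^_) (*-identityʳ b)

module Parameters (n k : ℕ) (1≤n : 1 ≤ n) (1≤k : 1 ≤ k) where

  -- Q = 2^q lies between 4k and 8k, and P = 2^ℓ between 4n and 8n. `b` gives 2^b ≥ 4n² against
  -- letter collisions, and `w` gives 2^w ≥ 64n² for the union over pairs of rotations. `T` spends
  -- 64 trials on each of 2 + L halvings, as 2^(2+L) ≥ 4n. `s` bounds the logarithm of 16n³ (4n²
  -- differences, failure 1/(4n)) plus that of the number of sparse strings.
  L b q ℓ w T θ⁺ s : ℕ
  L  = suc ⌊log₂ n ⌋
  b  = 2 + (L + L)
  q  = 2 + suc ⌊log₂ k ⌋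
  ℓ  = 2 + L
  w  = 6 + (L + L)
  T  = 64 * (2 + L)
  θ⁺ = ∣ vec bit q ∣ * w + k
  s  = 4 + (L + (L + L)) + (L + b) * θ⁺

  private
    N = 2 ^ L
    n<N : n < N
    n<N = n<2^1+log n
    n≤N = <⇒≤ n<N

    2^L+L : 2 ^ (L + L) ≡ N * N
    2^L+L = ^-distribˡ-+-* 2 L L

  4k≤Q : 4 * k ≤ ∣ vec bit q ∣
  4k≤Q = begin
    4 * k ≤⟨ *-monoʳ-≤ 4 (<⇒≤ (n<2^1+log k)) ⟩
    4 * 2 ^ suc ⌊log₂ k ⌋ ≡⟨ ^-distribˡ-+-* 2 2 (suc ⌊log₂ k ⌋) ⟨
    2 ^ q ≡⟨ ∣word∣ q ⟨
    ∣ vec bit q ∣ ∎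
    where open ≤-Reasoning

  Q≤8k : ∣ vec bit q ∣ ≤ 8 * k
  Q≤8k = begin
    ∣ vec bit q ∣ ≡⟨ ∣word∣ q ⟩
    2 ^ q ≡⟨ ^-distribˡ-+-* 2 3 ⌊log₂ k ⌋ ⟩
    8 * 2 ^ ⌊log₂ k ⌋ ≤⟨ *-monoʳ-≤ 8 (2^log≤n k 1≤k) ⟩
    8 * k ∎
    where open ≤-Reasoning

  4n≤2^ℓ : 4 * n ≤ 2 ^ ℓ
  4n≤2^ℓ = ≤-trans (*-monoʳ-≤ 4 n≤N) (≤-reflexive (sym (^-distribˡ-+-* 2 2 L)))

  4n≤P : 4 * n ≤ ∣ vec bit ℓ ∣
  4n≤P = ≤-trans 4n≤2^ℓ (≤-reflexive (sym (∣word∣ ℓ)))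

  P≤8n : ∣ vec bit ℓ ∣ ≤ 8 * n
  P≤8n = begin
    ∣ vec bit ℓ ∣ ≡⟨ ∣word∣ ℓ ⟩
    2 ^ ℓ ≡⟨ ^-distribˡ-+-* 2 3 ⌊log₂ n ⌋ ⟩
    8 * 2 ^ ⌊log₂ n ⌋ ≤⟨ *-monoʳ-≤ 8 (2^log≤n n 1≤n) ⟩
    8 * n ∎
    where open ≤-Reasoning

  64n²≤2^w : 64 * (n * n) ≤ 2 ^ w
  64n²≤2^w = begin
    64 * (n * n) ≤⟨ *-monoʳ-≤ 64 (*-mono-≤ n≤N n≤N) ⟩
    64 * (N * N) ≡⟨ cong (64 *_) 2^L+L ⟨
    64 * 2 ^ (L + L) ≡⟨ ^-distribˡ-+-* 2 6 (L + L) ⟨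
    2 ^ w ∎
    where open ≤-Reasoning

  b-large : 4 * n * n ≤ ∣ vec bit b ∣
  b-large = begin
    4 * n * n ≡⟨ *-assoc 4 n n ⟩
    4 * (n * n) ≤⟨ *-monoʳ-≤ 4 (*-mono-≤ n≤N n≤N) ⟩
    4 * (N * N) ≡⟨ cong (4 *_) 2^L+L ⟨
    4 * 2 ^ (L + L) ≡⟨ ^-distribˡ-+-* 2 2 (L + L) ⟨
    2 ^ b ≡⟨ ∣word∣ b ⟨
    ∣ vec bit b ∣ ∎
    where open ≤-Reasoning

  s-large : 4 * n * (2 * (2 * (n * (n * (1 + n * ∣ vec bit b ∣) ^ θ⁺)))) ≤ 2 ^ s
  s-large = begin
    4 * n * (2 * (2 * (n * (n * (1 + n * ∣ vec bit b ∣) ^ θ⁺)))) ≡⟨ lemma n ((1 + n * ∣ vec bit b ∣) ^ θ⁺) ⟩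
    16 * (n * (n * n)) * (1 + n * ∣ vec bit b ∣) ^ θ⁺ ≤⟨ *-mono-≤ (*-monoʳ-≤ 16 (*-mono-≤ n≤N (*-mono-≤ n≤N n≤N))) (^-monoˡ-≤ θ⁺ base) ⟩
    16 * (N * (N * N)) * (2 ^ (L + b)) ^ θ⁺ ≡⟨ cong₂ (λ u v → 16 * u * v)
      (trans (cong (N *_) (sym 2^L+L)) (sym (^-distribˡ-+-* 2 L (L + L)))) (^-*-assoc 2 (L + b) θ⁺) ⟩
    16 * 2 ^ (L + (L + L)) * 2 ^ ((L + b) * θ⁺) ≡⟨ cong (_* 2 ^ ((L + b) * θ⁺)) (^-distribˡ-+-* 2 4 (L + (L + L))) ⟨
    2 ^ (4 + (L + (L + L))) * 2 ^ ((L + b) * θ⁺) ≡⟨ ^-distribˡ-+-* 2 (4 + (L + (L + L))) ((L + b) * θ⁺) ⟨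
    2 ^ s ∎
    where
    open ≤-Reasoning
    lemma : ∀ n z → 4 * n * (2 * (2 * (n * (n * z)))) ≡ 16 * (n * (n * n)) * z
    lemma = solve-∀
    base : 1 + n * ∣ vec bit b ∣ ≤ 2 ^ (L + b)
    base = begin
      1 + n * ∣ vec bit b ∣ ≤⟨ +-monoˡ-≤ (n * ∣ vec bit b ∣) (m^n>0 2 (dim (vec bit b))) ⟩
      suc n * ∣ vec bit b ∣ ≤⟨ *-monoˡ-≤ ∣ vec bit b ∣ n<N ⟩
      N * ∣ vec bit b ∣ ≡⟨ cong (N *_) (∣word∣ b) ⟩
      N * 2 ^ b ≡⟨ ^-distribˡ-+-* 2 L b ⟨
      2 ^ (L + b) ∎

  T-large : 4 * n * 63 ^ T ≤ 64 ^ T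
  T-large = ≤-trans (*-monoˡ-≤ (63 ^ T) 4n≤2^ℓ) (halving^ 63 (2 + L) T ≤-refl)

  private
    1≤L : 1 ≤ L
    1≤L = s≤s z≤n

    +*≤ : ∀ c d {m} → 1 ≤ m → c + d * m ≤ (c + d) * m
    +*≤ c d {m} 1≤m = ≤-trans (+-monoˡ-≤ (d * m) (≤-trans (≤-reflexive (sym (*-identityʳ c))) (*-monoʳ-≤ c 1≤m)))
      (≤-reflexive (sym (*-distribʳ-+ m c d)))

    entries≤ : suc (L + T) ≤ 194 * L
    entries≤ = begin
      1 + (L + T) ≡⟨ cong (λ z → 1 + (L + z)) (*-distribˡ-+ 64 2 L) ⟩
      1 + (L + (128 + 64 * L)) ≡⟨ lemma L (64 * L) ⟩
      129 + 65 * L ≤⟨ +*≤ 129 65 1≤L ⟩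
      194 * L ∎
      where
      open ≤-Reasoning
      lemma : ∀ l z → 1 + (l + (128 + z)) ≡ 129 + (l + z)
      lemma = solve-∀

    θ⁺≤ : θ⁺ ≤ 65 * (k * L)
    θ⁺≤ = begin
      ∣ vec bit q ∣ * w + k ≤⟨ +-mono-≤ (*-mono-≤ Q≤8k w≤) (≤-trans (≤-reflexive (sym (*-identityʳ k))) (*-monoʳ-≤ k 1≤L)) ⟩
      8 * k * (8 * L) + k * L ≡⟨ lemma k L ⟩
      65 * (k * L) ∎
      where
      open ≤-Reasoning
      lemma : ∀ k l → 8 * k * (8 * l) + k * l ≡ 65 * (k * l)
      lemma = solve-∀
      w≤ : w ≤ 8 * L
      w≤ = ≤-trans (≤-reflexive (cong (λ z → 6 + (L + z)) (sym (+-identityʳ L)))) (+*≤ 6 2 1≤L)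

    L+s≤ : L + s ≤ 333 * (k * (L * L))
    L+s≤ = begin
      L + (4 + (L + (L + L)) + (L + b) * θ⁺) ≤⟨ +-monoʳ-≤ L (+-monoʳ-≤ (4 + (L + (L + L))) (*-mono-≤ L+b≤ θ⁺≤)) ⟩
      L + (4 + (L + (L + L)) + 5 * L * (65 * (k * L))) ≡⟨ lemma L k ⟩
      4 + 4 * L + 325 * (k * (L * L)) ≤⟨ +-monoˡ-≤ _ (≤-trans (+*≤ 4 4 1≤L) (*-monoʳ-≤ 8 L≤)) ⟩
      8 * (k * (L * L)) + 325 * (k * (L * L)) ≡⟨ *-distribʳ-+ (k * (L * L)) 8 325 ⟨
      333 * (k * (L * L)) ∎
      where
      open ≤-Reasoning
      lemma : ∀ l k → l + (4 + (l + (l + l)) + 5 * l * (65 * (k * l))) ≡ 4 + 4 * l + 325 * (k * (l * l))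
      lemma = solve-∀
      lemma′ : ∀ l → l + (2 + (l + l)) ≡ 2 + 3 * l
      lemma′ = solve-∀
      L+b≤ : L + b ≤ 5 * L
      L+b≤ = ≤-trans (≤-reflexive (lemma′ L)) (+*≤ 2 3 1≤L)
      L≤ : L ≤ k * (L * L)
      L≤ = ≤-trans (≤-reflexive (sym (trans (*-identityˡ (L * 1)) (*-identityʳ L)))) (*-mono-≤ 1≤k (*-monoʳ-≤ L 1≤L))

  -- One factor `L` counts the entries and two come from the hash length, one of them through `w`.
  -- `C` serves both as factor and as exponent, hence the two lower bounds on it.
  size≤ : ∀ C → 3 ≤ C → 194 * 333 ≤ C → suc (L + T) * (L + s) ≤ polylogBound C n k
  size≤ C 3≤C c≤C = begin
    suc (L + T) * (L + s) ≤⟨ *-mono-≤ entries≤ L+s≤ ⟩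
    194 * L * (333 * (k * (L * L))) ≡⟨ lemma 194 333 L k ⟩
    194 * 333 * k * L ^ 3 ≤⟨ *-mono-≤ (*-monoˡ-≤ k c≤C) (^-monoʳ-≤ L 3≤C) ⟩
    C * k * L ^ C ∎
    where
    open ≤-Reasoning
    lemma : ∀ p q l k → p * l * (q * (k * (l * l))) ≡ p * q * k * (l * (l * (l * 1)))
    lemma = solve-∀

sketches : ∀ C → 3 ≤ C → 194 * 333 ≤ C → ∀ (σ n k : ℕ) → 1 ≤ k → k ≤ n →
  ∃ λ (r : ℕ) → Σ (Sketcher σ n r) λ sk → Σ (Decoder r) λ dec →
    IsECS σ n k 1 1 r sk dec × HasSize σ n 1 1 r (polylogBound C n k) sk
sketches C 3≤C c≤C σ zero k 1≤k k≤0 = contradiction (≤-trans 1≤k k≤0) λ ()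
sketches C 3≤C c≤C σ n@(suc n⁻) k 1≤k k≤n =
  dim S.Ω , S.sketch , S.decode , S.sketch-correct 4k≤Q 4n≤P P≤8n 64n²≤2^w b-large s-large T-large , S.sketch-size (size≤ C 3≤C c≤C)
  where
  open Parameters n k (s≤s z≤n) 1≤k
  module S = Scheme σ n⁻ k b q ℓ s L T w (n<2^1+log n)

theorem1 : ∃ λ (C : ℕ) → ∃ λ (c : ℕ) → ∃ λ (d : ℕ) → ∃ λ (N : ℕ) →
    ∀ (σ n k : ℕ) → 1 ≤ k → k ≤ n → N ≤ n →
      ∃ λ (r : ℕ) → Σ (Sketcher σ n r) λ sk → Σ (Decoder r) λ dec →
        IsECS σ n k (suc c) (suc d) r sk dec
        × HasSize σ n (suc c) (suc d) r (polylogBound C n k) sk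
theorem1 = 194 * 333 , 0 , 0 , 0 , λ σ n k 1≤k k≤n _ →
  sketches (194 * 333) (≤ᵇ⇒≤ 3 (194 * 333) _) ≤-refl σ n k 1≤k k≤n
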